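{- For integers $a,k \geq 0$, let $RS_a = \sum_{i\geq 0} (-1)^i h_{a+i}\, e_i^\perp$ and define $$CS_{a^k} = \sum_\lambda (-1)^{|\lambda|}\, (RS_a)^k(s_\lambda)\, s_{\lambda'}^\perp ,$$ the sum over all partitions $\lambda$, where $(RS_a)^k(s_\lambda)$ acts by multiplication. Then $CS_{a^k} s_\lambda = s_{\lambda + a^k}$ if $l(\lambda) \leq k$, and $CS_{a^k} s_\lambda = 0$ if $l(\lambda) > k$.
   Context: $h_j$, $e_i$, $s_\lambda$ are the complete homogeneous, elementary and Schur symmetric functions ($h_0=e_0=1$); $g^\perp$ is the adjoint of multiplication by $g$ with respect to the Hall inner product; $\lambda'$ is the conjugate partition. For $l(\lambda)\le k$, $\lambda+a^k=(\lambda_1+a,\ldots,\lambda_k+a)$ with $\lambda_i=0$ for $i>l(\lambda)$. -}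

module Defs where

open import Data.Bool using (Bool; true; false; if_then_else_; _∧_)
open import Data.Nat as ℕ using (ℕ; zero; suc; _≤_; _<_; _≥_; _∸_; _⊓_; _≡ᵇ_; _≤ᵇ_; _<?_; _≟_)
open import Data.Integer as ℤ using (ℤ; +_)
open import Data.Nat.ListAction using (sum)
open import Data.List using (List; []; _∷_; [_]; _++_; map; concatMap; filter; length; upTo; reverse; replicate; zipWith; foldr)
open import Data.List.Properties using (≡-dec)
open import Data.List.Relation.Unary.All using (All)
open import Data.List.Relation.Unary.Linked using (Linked)
open import Data.List.Relation.Binary.Permutation.Propositional using (_↭_)
open import Data.Product using (Σ; _×_; ∃-syntax)
open import Relation.Nullary using (does)
open import Relation.Binary.PropositionalEquality using (_≡_; _≢_)

-- Formal power series in x₁, x₂, … with integer coefficients.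
-- A monomial x^γ is given by its exponent list γ (γᵢ = exponent of xᵢ,
-- implicitly padded with zeros).  A series is its coefficient function.

Series : Set
Series = List ℕ → ℤ

_≈_ : Series → Series → Set
f ≈ g = ∀ γ → f γ ≡ g γ

sumℤ : List ℤ → ℤ
sumℤ = foldr ℤ._+_ (+ 0)

zeroS : Series
zeroS _ = + 0

_⊕_ : Series → Series → Series
(f ⊕ g) γ = f γ ℤ.+ g γ

_·_ : ℤ → Series → Series
(c · f) γ = c ℤ.* f γ

below : List ℕ → List (List ℕ)
below [] = [ [] ]
below (g ∷ gs) = concatMap (λ a → map (a ∷_) (below gs)) (upTo (suc g))

_⊛_ : Series → Series → Series
(f ⊛ g) γ = sumℤ (map (λ α → f α ℤ.* g (zipWith _∸_ γ α)) (below γ))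

boolℤ : Bool → ℤ
boolℤ true = + 1
boolℤ false = + 0

sign : ℕ → ℤ
sign n = ℤ.-[1+ 0 ] ℤ.^ n

iter : {A : Set} → ℕ → (A → A) → A → A
iter zero F x = x
iter (suc k) F x = F (iter k F x)

record Sym (f : Series) : Set where
  field
    padInv  : ∀ γ → f (γ ++ [ 0 ]) ≡ f γ
    permInv : ∀ {γ δ} → γ ↭ δ → f γ ≡ f δ
    bounded : ∃[ d ] (∀ γ → d < sum γ → f γ ≡ + 0)

Homogeneous : ℕ → Series → Set
Homogeneous d g = ∀ γ → sum γ ≢ d → g γ ≡ + 0

IsPartition : List ℕ → Set
IsPartition λ₀ = Linked _≥_ λ₀ × All (0 <_) λ₀

partsFuel : ℕ → ℕ → ℕ → List (List ℕ)
partsFuel _ zero _ = [ [] ]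
partsFuel zero (suc _) _ = []
partsFuel (suc fuel) (suc n) m =
  concatMap (λ j → map (j ∷_) (partsFuel fuel (suc n ∸ j) j))
            (map suc (upTo (m ⊓ suc n)))

partitionsOf : ℕ → List (List ℕ)
partitionsOf n = partsFuel n n n

headℕ : List ℕ → ℕ
headℕ [] = 0
headℕ (x ∷ _) = x

conj : List ℕ → List ℕ
conj λ₀ = map (λ j → length (filter (λ x → j <? x) λ₀)) (upTo (headℕ λ₀))

addRect : ℕ → ℕ → List ℕ → List ℕ
addRect a k λ₀ = map (a ℕ.+_) (λ₀ ++ replicate (k ∸ length λ₀) 0)

hS : ℕ → Series
hS j γ = boolℤ (sum γ ≡ᵇ j)

squarefree : List ℕ → Bool
squarefree [] = true
squarefree (x ∷ xs) = (x ≤ᵇ 1) ∧ squarefree xs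

eS : ℕ → Series
eS i γ = boolℤ ((sum γ ≡ᵇ i) ∧ squarefree γ)

hProd : List ℕ → Series
hProd = foldr (λ j acc → hS j ⊛ acc) (hS 0)

insertDesc : ℕ → List ℕ → List ℕ
insertDesc x [] = [ x ]
insertDesc x (y ∷ ys) = if y ≤ᵇ x then x ∷ y ∷ ys else y ∷ insertDesc x ys

sortDesc : List ℕ → List ℕ
sortDesc = foldr insertDesc []

monS : List ℕ → Series
monS μ γ = boolℤ (does (≡-dec _≟_ (sortDesc (filter (λ x → 0 <? x) γ)) μ))

-- Schur function s_λ = Σ_T x^T over SSYT T of shape λ, via Kostka numbers:
-- an SSYT of shape λ with entries ≤ n is a chain of partitions in which
-- the cells containing n form a horizontal strip λ/μ.

range : ℕ → ℕ → List ℕ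
range lo hi = map (lo ℕ.+_) (upTo (suc (hi ∸ lo)))

interlace : List ℕ → List (List ℕ)
interlace [] = [ [] ]
interlace (x ∷ []) = map [_] (range 0 x)
interlace (x ∷ y ∷ r) = concatMap (λ m → map (m ∷_) (interlace (y ∷ r))) (range y x)

strips : List ℕ → ℕ → List (List ℕ)
strips λ₀ c = filter (λ μ → sum λ₀ ≟ c ℕ.+ sum μ) (interlace λ₀)

-- number of SSYT of shape λ with content (γ_n, …, γ_1) (reversed content)
kostkaRev : List ℕ → List ℕ → ℕ
kostkaRev λ₀ [] = if sum λ₀ ≡ᵇ 0 then 1 else 0
kostkaRev λ₀ (c ∷ cs) = sum (map (λ μ → kostkaRev μ cs) (strips λ₀ c))

schurS : List ℕ → Series
schurS λ₀ γ = + kostkaRev λ₀ (reverse γ)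

-- The Hall inner product, graded: `ip n f g` is the Hall pairing of the
-- degree-n components of f and g.  It is specified by its defining
-- property ⟨h_λ, m_μ⟩ = δ_{λμ} together with (bi)additivity.

record IsHallPairing (ip : ℕ → Series → Series → ℤ) : Set where
  field
    respects : ∀ n {f f′ g g′} → f ≈ f′ → g ≈ g′ → ip n f g ≡ ip n f′ g′
    addˡ     : ∀ n f f′ g → ip n (f ⊕ f′) g ≡ ip n f g ℤ.+ ip n f′ g
    addʳ     : ∀ n f g g′ → ip n f (g ⊕ g′) ≡ ip n f g ℤ.+ ip n f g′
    basis    : ∀ n λ₀ μ → IsPartition λ₀ → IsPartition μ →
               ip n (hProd λ₀) (monS μ)
                 ≡ boolℤ (does (≡-dec _≟_ λ₀ μ) ∧ (sum λ₀ ≡ᵇ n))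

-- `perp g` is g^⊥, the adjoint of multiplication by g, for every
-- homogeneous symmetric function g (degree d):
--   ⟨g^⊥ f, u⟩ = ⟨f, g u⟩, graded: ⟨(g^⊥ f)_n, u_n⟩ = ⟨f_{n+d}, (g u)_{n+d}⟩.
IsSkewing : (ℕ → Series → Series → ℤ) → (Series → Series → Series) → Set
IsSkewing ip perp =
  ∀ g d → Sym g → Homogeneous d g → ∀ f → Sym f →
    Sym (perp g f) × (∀ n u → Sym u → ip n (perp g f) u ≡ ip (n ℕ.+ d) f (g ⊛ u))

-- RS_a = Σ_{i≥0} (-1)^i h_{a+i} e_i^⊥.  The coefficient of x^γ only gets
-- contributions from i ≤ |γ| (h_{a+i} has degree a+i), so the sum is cut there.
RS : (Series → Series → Series) → ℕ → Series → Series
RS perp a f γ =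
  sumℤ (map (λ i → (sign i ℤ.* (hS (a ℕ.+ i) ⊛ perp (eS i) f) γ)) (upTo (suc (sum γ))))

-- CS_{a^k} = Σ_λ (-1)^{|λ|} (RS_a)^k(s_λ) s_{λ'}^⊥.  The term for λ has all
-- its monomials of degree ≥ |λ|, so the coefficient of x^γ only involves
-- partitions λ with |λ| ≤ |γ|.
CS : (Series → Series → Series) → ℕ → ℕ → Series → Series
CS perp a k f γ =
  sumℤ (map (λ ν → sign (sum ν) ℤ.* (iter k (RS perp a) (schurS ν) ⊛ perp (schurS (conj ν)) f) γ)
            (concatMap partitionsOf (upTo (suc (sum γ)))))

-- Write f_γ for the coefficient of x^γ, so that h_c^⊥ is the operator ∂ c f = f (c ∷ ·), and let Ē n = (-1)^n e_n^⊥
-- be the inverse power series of the ∂ c.  With RS(z) = Σ RS_m z^m = H(z) Σ Ē_n z^{-n} one has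
-- RS_m RS_n = - RS_{n-1} RS_{m+1}; hence D ℓ = RS_{α₁} ⋯ RS_{α_k} 1, with ℓ = α + (k-1, …, 0), is alternating in ℓ.
-- Cancellation of alternating terms turns the branching rule of D into the interlacing rule of tableaux, so that
-- s_λ = D (λ + (k-1, …, 0)); orthonormality of these functions gives h_α = Σ_ν K_{να} s_ν, and applying ω gives
-- the dual Cauchy kernel e_α = Σ_ν K_{να} s_{ν'}.
--
-- By the kernel, Σ_ν (-1)^{|ν|} s_ν (s_{ν'}^⊥ f) is the series M f whose coefficient at α is Ē_{α₁} Ē_{α₂} ⋯ f.
-- The operators RS_a act on it by RS_a (S · M f) = Σ_j (RS_{a+j} S) · M (∂ j f), and multiplying the two factors of M f
-- leaves only the constant term of f.  Therefore CS_{a^k} f = Σ_{β ∈ ℕ^k} f_β RS_{a+β₁} ⋯ RS_{a+β_k} 1.  For f = s_λ the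
-- coefficients vanish when l(λ) > k; otherwise, since the summand is alternating, all terms cancel but the one for β = λ.

module Submission where

open import Defs
open import Data.Bool using (Bool; true; false; if_then_else_; _∧_)
open import Data.Empty using (⊥; ⊥-elim)
open import Data.Unit using (⊤; tt)
open import Data.Nat as ℕ using (ℕ; zero; suc; _≤_; _<_; _≥_; _∸_; _⊓_; _≡ᵇ_; _≤ᵇ_; z≤n; s≤s; s≤s⁻¹; _≟_; _<?_)
import Data.Nat.Properties as ℕₚ
open import Data.Nat.Induction using (<-rec)
open import Data.Nat.ListAction using (sum)
open import Data.Nat.ListAction.Properties using (sum-↭; sum-++)
open import Data.Integer as ℤ using (ℤ; +_; -[1+_]; _+_; _*_; -_)
import Data.Integer.Properties as ℤₚ
open import Data.Integer.Tactic.RingSolver using (solve-∀)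
open import Data.List using (List; []; _∷_; [_]; _++_; _∷ʳ_; map; concatMap; filter; length; upTo; applyUpTo; reverse; replicate; zipWith; foldr)
import Data.List.Properties as Lₚ
open import Data.List.Relation.Unary.All as All using (All; []; _∷_)
import Data.List.Relation.Unary.All.Properties as Allₚ
open import Data.List.Relation.Unary.Linked using (Linked; []; [-]; _∷_)
open import Data.List.Relation.Binary.Permutation.Propositional using (_↭_; prep; swap; ↭-refl; ↭-sym; ↭-trans)
import Data.List.Relation.Binary.Permutation.Propositional.Properties as ↭ₚ
open import Data.Product using (_×_; _,_; proj₁; proj₂; ∃-syntax)
open import Data.Nat.Tactic.RingSolver renaming (solve-∀ to ℕ-solve-∀)
import Data.Bool
open import Function using (_∘_; id; case_of_)
open import Relation.Binary.Definitions using (tri<; tri≈; tri>)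
open import Relation.Nullary using (Dec; yes; no; does)
open import Relation.Nullary.Decidable using (dec-false)
open import Relation.Unary using (Decidable)
open import Relation.Binary.PropositionalEquality using (_≡_; _≢_; refl; sym; trans; cong; cong₂; subst; subst₂; module ≡-Reasoning)
open ≡-Reasoning

-- Finite sums

-- `ip` and `perp` are given only by their specifications on symmetric functions, so facts about
-- them have to come from one source: pairing with `hProd γ` reads off the coefficient at γ. Before
-- this can be exploited, products of complete functions must be shown to span, which is why
-- Jacobi-Trudi and spanning by Schur functions precede any use of adjoints. All operators are then
-- replaced by explicit ones that act on arbitrary series, are linear, and recurse on the exponent
-- list; peeling off its first exponent turns an identity into one about sums over i + j = n.
-- Infinite sums are the other obstacle. `W z` is written as a finite sum over δ ≤ γ, and the cuts
-- in `RS` and `CS` are matched to it afterwards: the sum over ν with |ν| ≤ |γ| agrees with the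
-- kernel only up to degree |γ|, but RS_a with a ≥ 0 never reads a higher degree. The exponent ε of
-- the second factor of CS stays a mere parameter while RS_a acts on the first; the two exponents
-- are joined only at the end.

∑ : {A : Set} → List A → (A → ℤ) → ℤ
∑ xs f = sumℤ (map f xs)

+ˡ : ∀ a {b c : ℤ} → b ≡ c → a + b ≡ a + c
+ˡ a = cong (λ z → a + z)

+ʳ : ∀ {b c : ℤ} a → b ≡ c → b + a ≡ c + a
+ʳ a = cong (λ z → z + a)

+-interchange : ∀ a b c d → (a + b) + (c + d) ≡ (a + c) + (b + d)
+-interchange = solve-∀

ℕ-interchange : ∀ a b c d → (a ℕ.+ b) ℕ.+ (c ℕ.+ d) ≡ (a ℕ.+ c) ℕ.+ (b ℕ.+ d)
ℕ-interchange = ℕ-solve-∀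

infix 4 _≗₂_
_≗₂_ : {A B : Set} → (A → B → ℤ) → (A → B → ℤ) → Set
F ≗₂ G = ∀ i j → F i j ≡ G i j

module _ {A : Set} where

  ∑-cong : ∀ (xs : List A) {f g : A → ℤ} → (∀ x → f x ≡ g x) → ∑ xs f ≡ ∑ xs g
  ∑-cong []       e = refl
  ∑-cong (x ∷ xs) e = cong₂ _+_ (e x) (∑-cong xs e)

  ∑-cong-All : ∀ {xs : List A} {f g : A → ℤ} → All (λ x → f x ≡ g x) xs → ∑ xs f ≡ ∑ xs g
  ∑-cong-All []       = refl
  ∑-cong-All (e ∷ es) = cong₂ _+_ e (∑-cong-All es)

  ∑-zero : ∀ (xs : List A) → ∑ xs (λ _ → + 0) ≡ + 0
  ∑-zero []       = refl
  ∑-zero (x ∷ xs) = trans (ℤₚ.+-identityˡ _) (∑-zero xs)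

  ∑-0 : ∀ (xs : List A) {f : A → ℤ} → (∀ x → f x ≡ + 0) → ∑ xs f ≡ + 0
  ∑-0 xs e = trans (∑-cong xs e) (∑-zero xs)

  ∑-0-All : ∀ {xs : List A} {f : A → ℤ} → All (λ x → f x ≡ + 0) xs → ∑ xs f ≡ + 0
  ∑-0-All {xs} es = trans (∑-cong-All es) (∑-zero xs)

  ∑-+ : ∀ (xs : List A) (f g : A → ℤ) → ∑ xs (λ x → f x + g x) ≡ ∑ xs f + ∑ xs g
  ∑-+ []       f g = refl
  ∑-+ (x ∷ xs) f g = begin
    f x + g x + ∑ xs (λ x → f x + g x)   ≡⟨ +ˡ (f x + g x) (∑-+ xs f g) ⟩
    f x + g x + (∑ xs f + ∑ xs g)        ≡⟨ +-interchange (f x) (g x) _ _ ⟩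
    (f x + ∑ xs f) + (g x + ∑ xs g)      ∎

  ∑-*ˡ : ∀ k (xs : List A) (f : A → ℤ) → ∑ xs (λ x → k * f x) ≡ k * ∑ xs f
  ∑-*ˡ k []       f = sym (ℤₚ.*-zeroʳ k)
  ∑-*ˡ k (x ∷ xs) f = trans (+ˡ (k * f x) (∑-*ˡ k xs f)) (sym (ℤₚ.*-distribˡ-+ k (f x) _))

  ∑-neg : ∀ (xs : List A) (f : A → ℤ) → ∑ xs (λ x → - f x) ≡ - ∑ xs f
  ∑-neg []       f = refl
  ∑-neg (x ∷ xs) f = trans (+ˡ (- f x) (∑-neg xs f)) (sym (ℤₚ.neg-distrib-+ (f x) _))

  ∑-++ : ∀ (xs ys : List A) (f : A → ℤ) → ∑ (xs ++ ys) f ≡ ∑ xs f + ∑ ys f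
  ∑-++ []       ys f = sym (ℤₚ.+-identityˡ _)
  ∑-++ (x ∷ xs) ys f = trans (+ˡ (f x) (∑-++ xs ys f)) (sym (ℤₚ.+-assoc (f x) _ _))

  ∑-filter : ∀ {P : A → Set} (P? : Decidable P) (xs : List A) (f : A → ℤ) →
             ∑ (filter P? xs) f ≡ ∑ xs (λ x → boolℤ (does (P? x)) * f x)
  ∑-filter P? []       f = refl
  ∑-filter P? (x ∷ xs) f with does (P? x)
  ... | true  = cong₂ _+_ (sym (ℤₚ.*-identityˡ (f x))) (∑-filter P? xs f)
  ... | false = trans (∑-filter P? xs f) (sym (ℤₚ.+-identityˡ _))

∑-map : ∀ {A B : Set} (g : A → B) xs (f : B → ℤ) → ∑ (map g xs) f ≡ ∑ xs (λ x → f (g x))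
∑-map g []       f = refl
∑-map g (x ∷ xs) f = +ˡ (f (g x)) (∑-map g xs f)

∑-concatMap : ∀ {A B : Set} (g : A → List B) xs (f : B → ℤ) →
              ∑ (concatMap g xs) f ≡ ∑ xs (λ x → ∑ (g x) f)
∑-concatMap g []       f = refl
∑-concatMap g (x ∷ xs) f = trans (∑-++ (g x) _ f) (+ˡ (∑ (g x) f) (∑-concatMap g xs f))

∑-swap : ∀ {A B : Set} (xs : List A) (ys : List B) (F : A → B → ℤ) →
         ∑ xs (λ x → ∑ ys (F x)) ≡ ∑ ys (λ y → ∑ xs (λ x → F x y))
∑-swap []       ys F = sym (∑-zero ys)
∑-swap (x ∷ xs) ys F = trans (+ˡ (∑ ys (F x)) (∑-swap xs ys F)) (sym (∑-+ ys (F x) _))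

∑-upTo-suc : ∀ n (F : ℕ → ℤ) → ∑ (upTo (suc n)) F ≡ F 0 + ∑ (upTo n) (F ∘ suc)
∑-upTo-suc n F = +ˡ (F 0)
  (trans (cong (λ l → ∑ l F) (sym (Lₚ.map-upTo suc n))) (∑-map suc (upTo n) F))

∑-upTo-snoc : ∀ n (F : ℕ → ℤ) → ∑ (upTo (suc n)) F ≡ ∑ (upTo n) F + F n
∑-upTo-snoc n F = begin
  ∑ (upTo (suc n)) F          ≡⟨ cong (λ l → ∑ l F) (sym (Lₚ.upTo-∷ʳ n)) ⟩
  ∑ (upTo n ∷ʳ n) F           ≡⟨ ∑-++ (upTo n) (n ∷ []) F ⟩
  ∑ (upTo n) F + (F n + + 0)  ≡⟨ +ˡ (∑ (upTo n) F) (ℤₚ.+-identityʳ (F n)) ⟩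
  ∑ (upTo n) F + F n          ∎

∑-upTo-+ : ∀ m n (F : ℕ → ℤ) → ∑ (upTo (m ℕ.+ n)) F ≡ ∑ (upTo m) F + ∑ (upTo n) (λ i → F (m ℕ.+ i))
∑-upTo-+ zero    n F = sym (ℤₚ.+-identityˡ _)
∑-upTo-+ (suc m) n F = begin
  ∑ (upTo (suc m ℕ.+ n)) F                                         ≡⟨ ∑-upTo-suc (m ℕ.+ n) F ⟩
  F 0 + ∑ (upTo (m ℕ.+ n)) (F ∘ suc)                               ≡⟨ +ˡ (F 0) (∑-upTo-+ m n (F ∘ suc)) ⟩
  F 0 + (∑ (upTo m) (F ∘ suc) + ∑ (upTo n) (λ i → F (suc m ℕ.+ i))) ≡⟨ sym (ℤₚ.+-assoc (F 0) _ _) ⟩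
  F 0 + ∑ (upTo m) (F ∘ suc) + ∑ (upTo n) (λ i → F (suc m ℕ.+ i))   ≡⟨ +ʳ (∑ (upTo n) (λ i → F (suc m ℕ.+ i))) (sym (∑-upTo-suc m F)) ⟩
  ∑ (upTo (suc m)) F + ∑ (upTo n) (λ i → F (suc m ℕ.+ i))           ∎

∑-upTo-cong : ∀ n {F G : ℕ → ℤ} → (∀ i → i < n → F i ≡ G i) → ∑ (upTo n) F ≡ ∑ (upTo n) G
∑-upTo-cong zero    e = refl
∑-upTo-cong (suc n) {F} {G} e = begin
  ∑ (upTo (suc n)) F            ≡⟨ ∑-upTo-suc n F ⟩
  F 0 + ∑ (upTo n) (F ∘ suc)    ≡⟨ cong₂ _+_ (e 0 (s≤s z≤n)) (∑-upTo-cong n (λ i i<n → e (suc i) (s≤s i<n))) ⟩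
  G 0 + ∑ (upTo n) (G ∘ suc)    ≡⟨ sym (∑-upTo-suc n G) ⟩
  ∑ (upTo (suc n)) G            ∎

∑-upTo-0 : ∀ n {F : ℕ → ℤ} → (∀ i → i < n → F i ≡ + 0) → ∑ (upTo n) F ≡ + 0
∑-upTo-0 n e = trans (∑-upTo-cong n e) (∑-zero (upTo n))

∑-upTo-single : ∀ n k {F : ℕ → ℤ} → k < n → (∀ i → i ≢ k → F i ≡ + 0) → ∑ (upTo n) F ≡ F k
∑-upTo-single (suc n) zero {F} _ e = begin
  ∑ (upTo (suc n)) F          ≡⟨ ∑-upTo-suc n F ⟩
  F 0 + ∑ (upTo n) (F ∘ suc)  ≡⟨ +ˡ (F 0) (∑-0 (upTo n) (λ i → e (suc i) (λ ()))) ⟩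
  F 0 + + 0                   ≡⟨ ℤₚ.+-identityʳ _ ⟩
  F 0                         ∎
∑-upTo-single (suc n) (suc k) {F} (s≤s k<n) e = begin
  ∑ (upTo (suc n)) F          ≡⟨ ∑-upTo-suc n F ⟩
  F 0 + ∑ (upTo n) (F ∘ suc)  ≡⟨ cong₂ _+_ (e 0 (λ ())) (∑-upTo-single n k k<n (λ i i≢k → e (suc i) (i≢k ∘ ℕₚ.suc-injective))) ⟩
  + 0 + F (suc k)             ≡⟨ ℤₚ.+-identityˡ _ ⟩
  F (suc k)                   ∎

self-neg⇒0 : ∀ x → x ≡ - x → x ≡ + 0
self-neg⇒0 (+ zero)      e = refl
self-neg⇒0 (+ suc n)     ()
self-neg⇒0 (-[1+ n ])    ()

-- Exchanging the two summation variables shows that the sum is its own negative.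
∑-antisym : ∀ {A : Set} (xs : List A) (F : A → A → ℤ) → (∀ i j → F i j ≡ - F j i) →
            ∑ xs (λ i → ∑ xs (F i)) ≡ + 0
∑-antisym xs F anti = self-neg⇒0 _ (begin
  ∑ xs (λ i → ∑ xs (F i))              ≡⟨ ∑-swap xs xs F ⟩
  ∑ xs (λ j → ∑ xs (λ i → F i j))      ≡⟨ ∑-cong xs (λ j → ∑-cong xs (λ i → anti i j)) ⟩
  ∑ xs (λ j → ∑ xs (λ i → - F j i))    ≡⟨ ∑-cong xs (λ j → ∑-neg xs (F j)) ⟩
  ∑ xs (λ j → - ∑ xs (F j))            ≡⟨ ∑-neg xs _ ⟩
  - ∑ xs (λ j → ∑ xs (F j))            ∎)

-- Indicators that record degree conditions

ind : ℕ → ℕ → ℤ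
ind m n = boolℤ (m ≡ᵇ n)

ind-yes : ∀ {m n} → m ≡ n → ind m n ≡ + 1
ind-yes {zero}  refl = refl
ind-yes {suc m} refl = ind-yes {m} refl

ind-no : ∀ {m n} → m ≢ n → ind m n ≡ + 0
ind-no {zero}  {zero}  ne = ⊥-elim (ne refl)
ind-no {zero}  {suc n} ne = refl
ind-no {suc m} {zero}  ne = refl
ind-no {suc m} {suc n} ne = ind-no {m} {n} (ne ∘ cong suc)

ind-cong : ∀ {m n p q} → (m ≡ n → p ≡ q) → (p ≡ q → m ≡ n) → ind m n ≡ ind p q
ind-cong {m} {n} f g with m ≟ n
... | yes e = trans (ind-yes e) (sym (ind-yes (f e)))
... | no ne = trans (ind-no ne) (sym (ind-no (ne ∘ g)))

ind-no-* : ∀ {m n} x → m ≢ n → ind m n * x ≡ + 0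
ind-no-* x ne = cong (_* x) (ind-no ne)

ind-yes-* : ∀ {m n} x → m ≡ n → ind m n * x ≡ x
ind-yes-* x e = trans (cong (_* x) (ind-yes e)) (ℤₚ.*-identityˡ x)

-- Convolution sums: C n F = Σ_{i+j=n} F i j

splits : ℕ → List (ℕ × ℕ)
splits zero    = (0 , 0) ∷ []
splits (suc n) = (0 , suc n) ∷ map (λ p → suc (proj₁ p) , proj₂ p) (splits n)

C : ℕ → (ℕ → ℕ → ℤ) → ℤ
C n F = ∑ (splits n) (λ p → F (proj₁ p) (proj₂ p))

splits-sum : ∀ n → All (λ p → proj₁ p ℕ.+ proj₂ p ≡ n) (splits n)
splits-sum zero    = refl ∷ []
splits-sum (suc n) = refl ∷ Allₚ.map⁺ (All.map (cong suc) (splits-sum n))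

C-zero : ∀ F → C 0 F ≡ F 0 0
C-zero F = ℤₚ.+-identityʳ (F 0 0)

C-suc : ∀ n F → C (suc n) F ≡ F 0 (suc n) + C n (λ i j → F (suc i) j)
C-suc n F = +ˡ (F 0 (suc n)) (∑-map (λ p → suc (proj₁ p) , proj₂ p) (splits n) (λ p → F (proj₁ p) (proj₂ p)))

C-cong : ∀ n {F G} → F ≗₂ G → C n F ≡ C n G
C-cong n e = ∑-cong (splits n) (λ p → e (proj₁ p) (proj₂ p))

C-cong-≤ : ∀ n {F G : ℕ → ℕ → ℤ} → (∀ i j → i ℕ.+ j ≡ n → F i j ≡ G i j) → C n F ≡ C n G
C-cong-≤ n e = ∑-cong-All (All.map (λ {p} → e (proj₁ p) (proj₂ p)) (splits-sum n))

C-0 : ∀ n {F : ℕ → ℕ → ℤ} → (∀ i j → F i j ≡ + 0) → C n F ≡ + 0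
C-0 n e = ∑-0 (splits n) (λ p → e (proj₁ p) (proj₂ p))

C-+ : ∀ n F G → C n (λ i j → F i j + G i j) ≡ C n F + C n G
C-+ n F G = ∑-+ (splits n) _ _

C-neg : ∀ n F → C n (λ i j → - F i j) ≡ - C n F
C-neg n F = ∑-neg (splits n) _

C-snoc : ∀ n F → C (suc n) F ≡ C n (λ i j → F i (suc j)) + F (suc n) 0
C-snoc zero F = begin
  C 1 F                    ≡⟨ C-suc 0 F ⟩
  F 0 1 + C 0 (λ i j → F (suc i) j) ≡⟨ cong₂ _+_ (sym (C-zero (λ i j → F i (suc j)))) (C-zero (λ i j → F (suc i) j)) ⟩
  C 0 (λ i j → F i (suc j)) + F 1 0 ∎
C-snoc (suc n) F = begin
  C (suc (suc n)) F                                     ≡⟨ C-suc (suc n) F ⟩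
  F 0 (suc (suc n)) + C (suc n) (λ i j → F (suc i) j)   ≡⟨ +ˡ (F 0 (suc (suc n))) (C-snoc n (λ i j → F (suc i) j)) ⟩
  F 0 (suc (suc n)) + (C n (λ i j → F (suc i) (suc j)) + F (suc (suc n)) 0) ≡⟨ sym (ℤₚ.+-assoc (F 0 (suc (suc n))) (C n (λ i j → F (suc i) (suc j))) (F (suc (suc n)) 0)) ⟩
  F 0 (suc (suc n)) + C n (λ i j → F (suc i) (suc j)) + F (suc (suc n)) 0   ≡⟨ +ʳ (F (suc (suc n)) 0) (sym (C-suc n (λ i j → F i (suc j)))) ⟩
  C (suc n) (λ i j → F i (suc j)) + F (suc (suc n)) 0   ∎

C-comm : ∀ n F → C n F ≡ C n (λ i j → F j i)
C-comm zero    F = refl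
C-comm (suc n) F = begin
  C (suc n) F                                ≡⟨ C-suc n F ⟩
  F 0 (suc n) + C n (λ i j → F (suc i) j)    ≡⟨ ℤₚ.+-comm (F 0 (suc n)) _ ⟩
  C n (λ i j → F (suc i) j) + F 0 (suc n)    ≡⟨ +ʳ (F 0 (suc n)) (C-comm n (λ i j → F (suc i) j)) ⟩
  C n (λ i j → F (suc j) i) + F 0 (suc n)    ≡⟨ sym (C-snoc n (λ i j → F j i)) ⟩
  C (suc n) (λ i j → F j i)                  ∎

-- Both sides run over i + j + k = n; separating i = 0 from i > 0 gives the induction.
C-assoc : ∀ n (F : ℕ → ℕ → ℕ → ℤ) →
          C n (λ p k → C p (λ i j → F i j k)) ≡ C n (λ i q → C q (λ j k → F i j k))
C-assoc zero    F = refl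
C-assoc (suc n) F = begin
  C (suc n) (λ p k → C p (λ i j → F i j k))
    ≡⟨ C-suc n (λ p k → C p (λ i j → F i j k)) ⟩
  C 0 (λ i j → F i j (suc n)) + C n (λ p k → C (suc p) (λ i j → F i j k))
    ≡⟨ cong₂ _+_ (C-zero (λ i j → F i j (suc n)))
                (trans (C-cong n (λ p k → C-suc p (λ i j → F i j k)))
                       (C-+ n (λ p k → F 0 (suc p) k) (λ p k → C p (λ i j → F (suc i) j k)))) ⟩
  F 0 0 (suc n) + (C n (λ p k → F 0 (suc p) k) + C n (λ p k → C p (λ i j → F (suc i) j k)))
    ≡⟨ sym (ℤₚ.+-assoc (F 0 0 (suc n)) _ _) ⟩
  F 0 0 (suc n) + C n (λ p k → F 0 (suc p) k) + C n (λ p k → C p (λ i j → F (suc i) j k))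
    ≡⟨ cong₂ _+_ (sym (C-suc n (F 0))) (C-assoc n (λ i → F (suc i))) ⟩
  C (suc n) (F 0) + C n (λ i q → C q (F (suc i)))
    ≡⟨ sym (C-suc n (λ i q → C q (F i))) ⟩
  C (suc n) (λ i q → C q (F i)) ∎

C-swap : ∀ n m (F : ℕ → ℕ → ℕ → ℕ → ℤ) →
         C n (λ i j → C m (λ k l → F i j k l)) ≡ C m (λ k l → C n (λ i j → F i j k l))
C-swap n m F = ∑-swap (splits n) (splits m) _

C-exchange : ∀ n (F : ℕ → ℕ → ℕ → ℤ) →
             C n (λ i q → C q (λ j k → F i j k)) ≡ C n (λ i q → C q (λ j k → F j i k))
C-exchange n F = begin
  C n (λ i q → C q (λ j k → F i j k))  ≡⟨ sym (C-assoc n F) ⟩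
  C n (λ p k → C p (λ i j → F i j k))  ≡⟨ C-cong n (λ p k → C-comm p (λ i j → F i j k)) ⟩
  C n (λ p k → C p (λ i j → F j i k))  ≡⟨ C-assoc n (λ i j → F j i) ⟩
  C n (λ i q → C q (λ j k → F j i k))  ∎

C-upTo : ∀ n F → C n F ≡ ∑ (upTo (suc n)) (λ i → F i (n ∸ i))
C-upTo zero    F = refl
C-upTo (suc n) F = begin
  C (suc n) F                               ≡⟨ C-suc n F ⟩
  F 0 (suc n) + C n (λ i j → F (suc i) j)   ≡⟨ +ˡ (F 0 (suc n)) (C-upTo n (λ i j → F (suc i) j)) ⟩
  F 0 (suc n) + ∑ (upTo (suc n)) (λ i → F (suc i) (n ∸ i)) ≡⟨ sym (∑-upTo-suc (suc n) (λ i → F i (suc n ∸ i))) ⟩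
  ∑ (upTo (suc (suc n))) (λ i → F i (suc n ∸ i)) ∎

C-first : ∀ n F → (∀ i j → F (suc i) j ≡ + 0) → C n F ≡ F 0 n
C-first zero    F e = C-zero F
C-first (suc n) F e = trans (C-suc n F) (trans (+ˡ (F 0 (suc n)) (C-0 n e)) (ℤₚ.+-identityʳ (F 0 (suc n))))

C-last : ∀ n F → (∀ i j → F i (suc j) ≡ + 0) → C n F ≡ F n 0
C-last n F e = trans (C-comm n F) (C-first n (λ i j → F j i) (λ i j → e j i))

-- Linear functionals and operators on series

record Lin (L : Series → ℤ) : Set where
  field
    resp : ∀ {f g} → f ≈ g → L f ≡ L g
    add  : ∀ f g → L (f ⊕ g) ≡ L f + L g
    scl  : ∀ c f → L (c · f) ≡ c * L f

neg : Series → Series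
neg f γ = - f γ

module _ {L : Series → ℤ} (l : Lin L) where
  open Lin l

  lin-0 : ∀ {f} → f ≈ zeroS → L f ≡ + 0
  lin-0 {f} f≈0 = trans (resp f≈0) (scl (+ 0) zeroS)

  lin-neg : ∀ f → L (neg f) ≡ - L f
  lin-neg f = trans (resp (λ γ → sym (ℤₚ.-1*i≡-i (f γ))))
                    (trans (scl (- + 1) f) (ℤₚ.-1*i≡-i (L f)))

  lin-∑ : ∀ {A : Set} (xs : List A) (F : A → Series) → L (λ γ → ∑ xs (λ x → F x γ)) ≡ ∑ xs (λ x → L (F x))
  lin-∑ []       F = lin-0 (λ _ → refl)
  lin-∑ (x ∷ xs) F = trans (add (F x) (λ γ → ∑ xs (λ x → F x γ))) (+ˡ (L (F x)) (lin-∑ xs F))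

  lin-C : ∀ n (F : ℕ → ℕ → Series) → L (λ γ → C n (λ i j → F i j γ)) ≡ C n (λ i j → L (F i j))
  lin-C n F = lin-∑ (splits n) (λ p → F (proj₁ p) (proj₂ p))

  lin-∑* : ∀ {A : Set} (xs : List A) (k : A → ℤ) (F : A → Series) →
           L (λ γ → ∑ xs (λ x → k x * F x γ)) ≡ ∑ xs (λ x → k x * L (F x))
  lin-∑* xs k F = trans (lin-∑ xs (λ x → k x · F x)) (∑-cong xs (λ x → scl (k x) (F x)))

open Lin

eval-lin : ∀ γ → Lin (λ f → f γ)
eval-lin γ .resp e = e γ
eval-lin γ .add f g = refl
eval-lin γ .scl c f = refl

zero-lin : Lin (λ _ → + 0)
zero-lin .resp e = refl
zero-lin .add f g = refl
zero-lin .scl c f = sym (ℤₚ.*-zeroʳ c)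

neg-lin : ∀ {L} → Lin L → Lin (λ f → - L f)
neg-lin l .resp e = cong -_ (resp l e)
neg-lin {L} l .add f g = trans (cong -_ (add l f g)) (ℤₚ.neg-distrib-+ (L f) (L g))
neg-lin {L} l .scl c f = trans (cong -_ (scl l c f)) (ℤₚ.neg-distribʳ-* c (L f))

+-lin : ∀ {L M} → Lin L → Lin M → Lin (λ f → L f + M f)
+-lin l m .resp e = cong₂ _+_ (resp l e) (resp m e)
+-lin {L} {M} l m .add f g =
  trans (cong₂ _+_ (add l f g) (add m f g)) (+-interchange (L f) (L g) (M f) (M g))
+-lin {L} {M} l m .scl c f =
  trans (cong₂ _+_ (scl l c f) (scl m c f)) (sym (ℤₚ.*-distribˡ-+ c (L f) (M f)))

*-lin : ∀ k {L} → Lin L → Lin (λ f → k * L f)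
*-lin k l .resp e = cong (k *_) (resp l e)
*-lin k {L} l .add f g = trans (cong (k *_) (add l f g)) (ℤₚ.*-distribˡ-+ k (L f) (L g))
*-lin k {L} l .scl c f = trans (cong (k *_) (scl l c f)) (mid k c (L f))
  where mid : ∀ k c x → k * (c * x) ≡ c * (k * x)
        mid = solve-∀

∑-lin : ∀ {A : Set} (xs : List A) {L : A → Series → ℤ} → (∀ x → Lin (L x)) → Lin (λ f → ∑ xs (λ x → L x f))
∑-lin []       l = zero-lin
∑-lin (x ∷ xs) l = +-lin (l x) (∑-lin xs l)

C-lin : ∀ n {L : ℕ → ℕ → Series → ℤ} → (∀ i j → Lin (L i j)) → Lin (λ f → C n (λ i j → L i j f))
C-lin n l = ∑-lin (splits n) (λ p → l (proj₁ p) (proj₂ p))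

∘-lin : ∀ {L} {O : Series → Series} → Lin L → (∀ γ → Lin (λ f → O f γ)) → Lin (λ f → L (O f))
∘-lin l o .resp e = resp l (λ γ → resp (o γ) e)
∘-lin l o .add f g = trans (resp l (λ γ → add (o γ) f g)) (add l _ _)
∘-lin l o .scl c f = trans (resp l (λ γ → scl (o γ) c f)) (scl l c _)

-- Coefficient extraction and invariant series

∂ : ℕ → Series → Series
∂ c f γ = f (c ∷ γ)

∂-lin : ∀ c γ → Lin (λ f → ∂ c f γ)
∂-lin c γ = eval-lin (c ∷ γ)

-- `Sym` without its degree bound, so that `∂`, `Ē` and `Op` inherit it without bookkeeping. The
-- padding zero stands in front because this gives `∂ 0 f ≈ f`.
record PI (f : Series) : Set where
  field
    perm : ∀ {γ δ} → γ ↭ δ → f γ ≡ f δ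
    pad  : ∀ γ → f (0 ∷ γ) ≡ f γ
open PI

PI-resp : ∀ {f g} → f ≈ g → PI f → PI g
PI-resp e p .perm {γ} {δ} r = trans (sym (e γ)) (trans (perm p r) (e δ))
PI-resp e p .pad γ = trans (sym (e (0 ∷ γ))) (trans (pad p γ) (e γ))

PI-⊕ : ∀ {f g} → PI f → PI g → PI (f ⊕ g)
PI-⊕ p q .perm r = cong₂ _+_ (perm p r) (perm q r)
PI-⊕ p q .pad γ = cong₂ _+_ (pad p γ) (pad q γ)

PI-· : ∀ c {f} → PI f → PI (c · f)
PI-· c p .perm r = cong (c *_) (perm p r)
PI-· c p .pad γ = cong (c *_) (pad p γ)

PI-neg : ∀ {f} → PI f → PI (neg f)
PI-neg p .perm r = cong -_ (perm p r)
PI-neg p .pad γ = cong -_ (pad p γ)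

PI-∂ : ∀ c {f} → PI f → PI (∂ c f)
PI-∂ c p .perm r = perm p (prep c r)
PI-∂ c p .pad γ = trans (perm p (swap c 0 ↭-refl)) (pad p (c ∷ γ))

PI-∂∂ : ∀ {f} → PI f → ∀ a b → ∂ a (∂ b f) ≈ ∂ b (∂ a f)
PI-∂∂ p a b γ = perm p (swap b a ↭-refl)

-- ∂ c and Ē n stand for h_c^⊥ and (-1)^n e_n^⊥.  The Ē n are the inverse power
-- series of the ∂ c; Ē≥ n p is the part of Ē (n + p) whose last ∂ has index ≥ p.

Ē≥ : ℕ → ℕ → Series → Series
Ē≥ zero    p f = neg (∂ p f)
Ē≥ (suc n) p f γ = Ē≥ n (suc p) f γ + - Ē≥ n 1 (∂ p f) γ

Ē : ℕ → Series → Series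
Ē zero    f = f
Ē (suc n) f = Ē≥ n 1 f

Ē≥-lin : ∀ n p γ → Lin (λ f → Ē≥ n p f γ)
Ē≥-lin zero    p γ = neg-lin (∂-lin p γ)
Ē≥-lin (suc n) p γ = +-lin (Ē≥-lin n (suc p) γ) (neg-lin (∘-lin (Ē≥-lin n 1 γ) (∂-lin p)))

Ē-lin : ∀ n γ → Lin (λ f → Ē n f γ)
Ē-lin zero    γ = eval-lin γ
Ē-lin (suc n) γ = Ē≥-lin n 1 γ

Ē≥-PI : ∀ n p {f} → PI f → PI (Ē≥ n p f)
Ē≥-PI zero    p i = PI-neg (PI-∂ p i)
Ē≥-PI (suc n) p i = PI-⊕ (Ē≥-PI n (suc p) i) (PI-neg (Ē≥-PI n 1 (PI-∂ p i)))

Ē-PI : ∀ n {f} → PI f → PI (Ē n f)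
Ē-PI zero    i = i
Ē-PI (suc n) i = Ē≥-PI n 1 i

-- `Ē≥` raises the index p one step at a time, which keeps the inverse series structurally
-- recursive; collecting the steps gives the usual recursion for inverse coefficients.
Ē≥-rec : ∀ n p f γ → Ē≥ n p f γ ≡ - C n (λ i j → Ē i (∂ (p ℕ.+ j) f) γ)
Ē≥-rec zero p f γ = cong -_ (trans (cong (λ q → ∂ q f γ) (sym (ℕₚ.+-identityʳ p))) (sym (C-zero (λ i j → Ē i (∂ (p ℕ.+ j) f) γ))))
Ē≥-rec (suc n) p f γ = begin
  Ē≥ n (suc p) f γ + - Ē (suc n) (∂ p f) γ
    ≡⟨ cong₂ (λ x q → x + - Ē (suc n) (∂ q f) γ) (Ē≥-rec n (suc p) f γ) (sym (ℕₚ.+-identityʳ p)) ⟩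
  - C n (λ i j → Ē i (∂ (suc p ℕ.+ j) f) γ) + - Ē (suc n) (∂ (p ℕ.+ 0) f) γ
    ≡⟨ sym (ℤₚ.neg-distrib-+ (C n (λ i j → Ē i (∂ (suc p ℕ.+ j) f) γ)) _) ⟩
  - (C n (λ i j → Ē i (∂ (suc p ℕ.+ j) f) γ) + Ē (suc n) (∂ (p ℕ.+ 0) f) γ)
    ≡⟨ cong (λ x → - (x + Ē (suc n) (∂ (p ℕ.+ 0) f) γ))
         (C-cong n (λ i j → cong (λ q → Ē i (∂ q f) γ) (sym (ℕₚ.+-suc p j)))) ⟩
  - (C n (λ i j → Ē i (∂ (p ℕ.+ suc j) f) γ) + Ē (suc n) (∂ (p ℕ.+ 0) f) γ)
    ≡⟨ cong -_ (sym (C-snoc n (λ i j → Ē i (∂ (p ℕ.+ j) f) γ))) ⟩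
  - C (suc n) (λ i j → Ē i (∂ (p ℕ.+ j) f) γ) ∎

Ē-rec : ∀ n f γ → Ē (suc n) f γ ≡ - C n (λ i j → Ē i (∂ (suc j) f) γ)
Ē-rec n = Ē≥-rec n 1

-- Since `∂ 0` is the identity, the term j = 0 is `Ē (suc n) f`, which cancels the other terms by
-- the recursion.
Ē-∂-inverse : ∀ n {f} → PI f → ∀ γ → C (suc n) (λ i j → Ē i (∂ j f) γ) ≡ + 0
Ē-∂-inverse n {f} p γ = begin
  C (suc n) (λ i j → Ē i (∂ j f) γ)                          ≡⟨ C-snoc n (λ i j → Ē i (∂ j f) γ) ⟩
  C n (λ i j → Ē i (∂ (suc j) f) γ) + Ē (suc n) (∂ 0 f) γ    ≡⟨ cong₂ _+_ (trans (sym (ℤₚ.neg-involutive _)) (cong -_ (sym (Ē-rec n f γ)))) (resp (Ē-lin (suc n) γ) (pad p)) ⟩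
  - Ē (suc n) f γ + Ē (suc n) f γ                            ≡⟨ ℤₚ.+-inverseˡ (Ē (suc n) f γ) ⟩
  + 0                                                        ∎

∂-Ē≥ : ∀ n p c {f} → PI f → ∂ c (Ē≥ n p f) ≈ Ē≥ n p (∂ c f)
∂-Ē≥ zero    p c i γ = cong -_ (PI-∂∂ i c p γ)
∂-Ē≥ (suc n) p c i γ = cong₂ _+_ (∂-Ē≥ n (suc p) c i γ)
  (cong -_ (trans (∂-Ē≥ n 1 c (PI-∂ p i) γ) (resp (Ē≥-lin n 1 γ) (PI-∂∂ i c p))))

∂-Ē : ∀ n c {f} → PI f → ∂ c (Ē n f) ≈ Ē n (∂ c f)
∂-Ē zero    c i γ = refl
∂-Ē (suc n) c i γ = ∂-Ē≥ n 1 c i γ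

Ē-Ē≥ : ∀ m n p {f} → PI f → Ē m (Ē≥ n p f) ≈ Ē≥ n p (Ē m f)
Ē-Ē≥ m zero p {f} i γ = trans (lin-neg (Ē-lin m γ) (∂ p f)) (cong -_ (sym (∂-Ē m p i γ)))
Ē-Ē≥ m (suc n) p {f} i γ = begin
  Ē m (Ē≥ n (suc p) f ⊕ neg (Ē≥ n 1 (∂ p f))) γ
    ≡⟨ add (Ē-lin m γ) (Ē≥ n (suc p) f) _ ⟩
  Ē m (Ē≥ n (suc p) f) γ + Ē m (neg (Ē≥ n 1 (∂ p f))) γ
    ≡⟨ cong₂ _+_ (Ē-Ē≥ m n (suc p) i γ) (lin-neg (Ē-lin m γ) _) ⟩
  Ē≥ n (suc p) (Ē m f) γ + - Ē m (Ē≥ n 1 (∂ p f)) γ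
    ≡⟨ cong (λ x → Ē≥ n (suc p) (Ē m f) γ + - x)
         (trans (Ē-Ē≥ m n 1 (PI-∂ p i) γ) (resp (Ē≥-lin n 1 γ) (λ δ → sym (∂-Ē m p i δ)))) ⟩
  Ē≥ n (suc p) (Ē m f) γ + - Ē≥ n 1 (∂ p (Ē m f)) γ ∎

Ē-comm : ∀ m n {f} → PI f → Ē m (Ē n f) ≈ Ē n (Ē m f)
Ē-comm m zero    i γ = refl
Ē-comm m (suc n) i γ = Ē-Ē≥ m n 1 i γ

Ēpred : ℕ → Series → Series
Ēpred zero    f = zeroS
Ēpred (suc n) f = Ē n f

-- For z < 0 the small δ in `W z` have z + |δ| < 0; Ē is extended by zero to such indices.
Ēz : ℤ → Series → Series
Ēz (+ n)    f = Ē n f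
Ēz -[1+ n ] f = zeroS

Ēz-lin : ∀ z γ → Lin (λ f → Ēz z f γ)
Ēz-lin (+ n)    γ = Ē-lin n γ
Ēz-lin -[1+ n ] γ = zero-lin

Ēz-comm : ∀ y z {f} → PI f → Ēz y (Ēz z f) ≈ Ēz z (Ēz y f)
Ēz-comm (+ m)    (+ n)    i γ = Ē-comm m n i γ
Ēz-comm (+ m)    -[1+ n ] i γ = lin-0 (Ē-lin m γ) (λ _ → refl)
Ēz-comm -[1+ m ] (+ n)    i γ = sym (lin-0 (Ē-lin n γ) (λ _ → refl))
Ēz-comm -[1+ m ] -[1+ n ] i γ = refl

-- The sum z + a, counted so that `up z (suc a)` computes to `up (ℤ.suc z) a`, the form needed in
-- `Op-shift`.
up : ℤ → ℕ → ℤ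
up z zero    = z
up z (suc a) = up (ℤ.suc z) a

up-+ : ∀ z a → up z a ≡ z + + a
up-+ z zero    = sym (ℤₚ.+-identityʳ z)
up-+ z (suc a) = trans (up-+ (ℤ.suc z) a) (mid z (+ a))
  where mid : ∀ z a → + 1 + z + a ≡ z + (+ 1 + a)
        mid = solve-∀

up-up : ∀ z a b → up (up z a) b ≡ up z (a ℕ.+ b)
up-up z zero    b = refl
up-up z (suc a) b = up-up (ℤ.suc z) a b

up-comm : ∀ z a b → up (up z a) b ≡ up (up z b) a
up-comm z a b = trans (up-up z a b) (trans (cong (up z) (ℕₚ.+-comm a b)) (sym (up-up z b a)))

up-suc : ∀ z a → up (ℤ.suc z) a ≡ ℤ.suc (up z a)
up-suc z zero    = refl
up-suc z (suc a) = up-suc (ℤ.suc z) a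

up-pred : ∀ z a → up (ℤ.pred z) a ≡ ℤ.pred (up z a)
up-pred z zero    = refl
up-pred z (suc a) = trans (cong (λ y → up y a) (mid z)) (up-pred (ℤ.suc z) a)
  where mid : ∀ z → + 1 + (- + 1 + z) ≡ - + 1 + (+ 1 + z)
        mid = solve-∀

-- Op φ z f γ = Σ_{δ ≤ γ} φ (z + |δ|) (∂ (γ - δ) f): multiplication by the series
-- Σ_j h_j t^j combined with the functionals φ.

Op : (ℤ → Series → ℤ) → ℤ → Series → Series
Op φ z f []      = φ z f
Op φ z f (c ∷ γ) = C c (λ a b → Op φ (up z a) (∂ b f) γ)

module _ {φ : ℤ → Series → ℤ} (φ-lin : ∀ z → Lin (φ z)) where

  Op-lin : ∀ z γ → Lin (λ f → Op φ z f γ)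
  Op-lin z []      = φ-lin z
  Op-lin z (c ∷ γ) = C-lin c (λ a b → ∘-lin (Op-lin (up z a) γ) (∂-lin b))

  Op-perm : ∀ z {f} → PI f → ∀ {γ δ} → γ ↭ δ → Op φ z f γ ≡ Op φ z f δ
  Op-perm z i _↭_.refl = refl
  Op-perm z i (prep c r) = C-cong c (λ a b → Op-perm (up z a) (PI-∂ b i) r)
  Op-perm z {f} i (swap {γ} {δ} x y r) = begin
    C x (λ a b → C y (λ a′ b′ → Op φ (up (up z a) a′) (∂ b′ (∂ b f)) γ))
      ≡⟨ C-swap x y _ ⟩
    C y (λ a′ b′ → C x (λ a b → Op φ (up (up z a) a′) (∂ b′ (∂ b f)) γ))
      ≡⟨ C-cong y (λ a′ b′ → C-cong x (λ a b →
           trans (cong (λ w → Op φ w (∂ b′ (∂ b f)) γ) (up-comm z a a′))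
             (trans (resp (Op-lin (up (up z a′) a) γ) (PI-∂∂ i b′ b))
                    (Op-perm (up (up z a′) a) (PI-∂ b (PI-∂ b′ i)) r)))) ⟩
    C y (λ a′ b′ → C x (λ a b → Op φ (up (up z a′) a) (∂ b (∂ b′ f)) δ)) ∎
  Op-perm z i (_↭_.trans r s) = trans (Op-perm z i r) (Op-perm z i s)

  Op-∂0 : ∀ z f γ → ∂ 0 (Op φ z f) γ ≡ Op φ z (∂ 0 f) γ
  Op-∂0 z f γ = C-zero (λ a b → Op φ (up z a) (∂ b f) γ)

  Op-PI : ∀ z {f} → PI f → PI (Op φ z f)
  Op-PI z i .perm = Op-perm z i
  Op-PI z {f} i .pad γ = trans (Op-∂0 z f γ) (resp (Op-lin z γ) (pad i))

  -- The first exponent of δ is zero, or one unit of it moves into z. For `T` this is one step of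
  -- h_c^⊥ (h_j g) = Σ_a h_{j-a} h_{c-a}^⊥ g.
  Op-shift : ∀ c z f → ∂ (suc c) (Op φ z f) ≈ (Op φ z (∂ (suc c) f) ⊕ ∂ c (Op φ (ℤ.suc z) f))
  Op-shift c z f γ = C-suc c (λ a b → Op φ (up z a) (∂ b f) γ)

  private
    -- The recursion for `Ē (suc m)` combined with `Op-shift` leaves three sums: the first folds
    -- back into `Ē (suc m) f`, the last is a convolution of the two inverse series.
    ĒOp-step : ∀ m z {f} → PI f → ∀ γ →
      (∀ {i} → i < suc m → ∀ {g} → PI g → ∀ γ →
         Ē i (Op φ z g) γ ≡ Op φ z (Ē i g) γ + - Op φ (ℤ.suc z) (Ēpred i g) γ) →
      Ē (suc m) (Op φ z f) γ ≡
      Op φ z (Ē (suc m) f) γ + Op φ (ℤ.suc z) (λ δ → C m (λ i j → Ēpred i (∂ (suc j) f) δ)) γ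
        + - C m (λ i j → Ē i (∂ j (Op φ (ℤ.suc z) f)) γ)
    ĒOp-step m z {f} p γ IH = begin
      Ē (suc m) (Op φ z f) γ
        ≡⟨ Ē-rec m (Op φ z f) γ ⟩
      - C m (λ i j → Ē i (∂ (suc j) (Op φ z f)) γ)
        ≡⟨ cong -_ (C-cong-≤ m (λ i j i+j≡m →
             trans (trans (resp (Ē-lin i γ) (Op-shift j z f))
                          (add (Ē-lin i γ) (Op φ z (∂ (suc j) f)) (∂ j (Op φ (ℤ.suc z) f))))
               (+ʳ (Ē i (∂ j (Op φ (ℤ.suc z) f)) γ)
                 (IH (s≤s (subst (i ≤_) i+j≡m (ℕₚ.m≤m+n i j))) (PI-∂ (suc j) p) γ)))) ⟩
      - C m (λ i j → A i j + - B i j + Ē i (∂ j (Op φ (ℤ.suc z) f)) γ)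
        ≡⟨ cong -_ (trans (C-+ m (λ i j → A i j + - B i j) Y)
                          (+ʳ (C m Y) (trans (C-+ m A (λ i j → - B i j)) (+ˡ (C m A) (C-neg m B))))) ⟩
      - (C m A + - C m B + C m Y)
        ≡⟨ arrange (C m A) (C m B) (C m Y) ⟩
      - C m A + C m B + - C m Y
        ≡⟨ cong₂ (λ x y → x + y + - C m Y)
             (trans (cong -_ (sym (lin-C (Op-lin z γ) m (λ i j → Ē i (∂ (suc j) f)))))
               (trans (sym (lin-neg (Op-lin z γ) _))
                      (resp (Op-lin z γ) (λ δ → sym (Ē-rec m f δ)))))
             (sym (lin-C (Op-lin (ℤ.suc z) γ) m (λ i j → Ēpred i (∂ (suc j) f)))) ⟩
      Op φ z (Ē (suc m) f) γ + Op φ (ℤ.suc z) (λ δ → C m (λ i j → Ēpred i (∂ (suc j) f) δ)) γ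
        + - C m Y ∎
      where
      A B Y : ℕ → ℕ → ℤ
      A i j = Op φ z (Ē i (∂ (suc j) f)) γ
      B i j = Op φ (ℤ.suc z) (Ēpred i (∂ (suc j) f)) γ
      Y i j = Ē i (∂ j (Op φ (ℤ.suc z) f)) γ
      arrange : ∀ a b y → - (a + - b + y) ≡ - a + b + - y
      arrange = solve-∀

  -- Up to sign the rule e_n^⊥ (h_j g) = h_j e_n^⊥ g + h_{j-1} e_{n-1}^⊥ g, for all `Op` at once: of
  -- the e_i^⊥, only i = 0 and i = 1 act nontrivially on a complete function.
  Ē-Op : ∀ n z {f} → PI f → ∀ γ →
         Ē n (Op φ z f) γ ≡ Op φ z (Ē n f) γ + - Op φ (ℤ.suc z) (Ēpred n f) γ
  Ē-Op = <-rec (λ n → ∀ z {f} → PI f → ∀ γ →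
         Ē n (Op φ z f) γ ≡ Op φ z (Ē n f) γ + - Op φ (ℤ.suc z) (Ēpred n f) γ) go
    where
    go : ∀ n → _ → _
    go zero IH z {f} p γ = sym (trans
      (+ˡ (Op φ z f γ) (cong -_ (lin-0 (Op-lin (ℤ.suc z) γ) (λ _ → refl)))) (ℤₚ.+-identityʳ _))
    -- For n = 1 the convolution is the single term `∂ 0`, the identity; it supplies the correction
    -- which for larger n comes from the middle sum.
    go (suc zero) IH z {f} p γ = trans (ĒOp-step 0 z p γ (λ l → IH l z)) (cong₂ _+_
      (trans (+ˡ (Op φ z (Ē 1 f) γ) (lin-0 (Op-lin (ℤ.suc z) γ) (λ δ → C-zero (λ i j → Ēpred i (∂ (suc j) f) δ)))) (ℤₚ.+-identityʳ (Op φ z (Ē 1 f) γ)))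
      (cong -_ (trans (C-zero (λ i j → Ē i (∂ j (Op φ (ℤ.suc z) f)) γ)) (pad (Op-PI (ℤ.suc z) p) γ))))
    go (suc (suc m)) IH z {f} p γ = trans (ĒOp-step (suc m) z p γ (λ l → IH l z)) (begin
      Op φ z (Ē (suc (suc m)) f) γ + Op φ (ℤ.suc z) (λ δ → C (suc m) (λ i j → Ēpred i (∂ (suc j) f) δ)) γ
        + - C (suc m) (λ i j → Ē i (∂ j (Op φ (ℤ.suc z) f)) γ)
        ≡⟨ cong₂ (λ x y → Op φ z (Ē (suc (suc m)) f) γ + x + - y)
             (trans (resp (Op-lin (ℤ.suc z) γ) (λ δ → trans (C-suc m (λ i j → Ēpred i (∂ (suc j) f) δ))
                 (trans (ℤₚ.+-identityˡ (C m (λ i j → Ē i (∂ (suc j) f) δ)))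
                   (trans (sym (ℤₚ.neg-involutive _)) (cong -_ (sym (Ē-rec m f δ)))))))
               (lin-neg (Op-lin (ℤ.suc z) γ) (Ē (suc m) f)))
             (Ē-∂-inverse m (Op-PI (ℤ.suc z) p) γ) ⟩
      Op φ z (Ē (suc (suc m)) f) γ + - Op φ (ℤ.suc z) (Ē (suc m) f) γ + + 0
        ≡⟨ ℤₚ.+-identityʳ _ ⟩
      Op φ z (Ē (suc (suc m)) f) γ + - Op φ (ℤ.suc z) (Ē (suc m) f) γ ∎)

Ēz-Op : ∀ {φ} (φ-lin : ∀ z → Lin (φ z)) x z {f} → PI f → ∀ γ →
        Ēz x (Op φ z f) γ ≡ Op φ z (Ēz x f) γ + - Op φ (ℤ.suc z) (Ēz (ℤ.pred x) f) γ
Ēz-Op φ-lin (+ zero)  z p γ = Ē-Op φ-lin zero z p γ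
Ēz-Op φ-lin (+ suc n) z p γ = Ē-Op φ-lin (suc n) z p γ
Ēz-Op φ-lin -[1+ n ]  z p γ = sym (cong₂ (λ x y → x + - y)
  (lin-0 (Op-lin φ-lin z γ) (λ _ → refl)) (lin-0 (Op-lin φ-lin (ℤ.suc z) γ) (λ _ → refl)))

Op-Op : ∀ {φ ψ} (φ-lin : ∀ z → Lin (φ z)) y z f c γ →
        Op φ z (Op ψ y f) (c ∷ γ) ≡
        C c (λ a q → C q (λ b d → Op φ (up z a) (Op ψ (up y b) (∂ d f)) γ))
Op-Op φ-lin y z f c γ = C-cong c (λ a q → lin-C (Op-lin φ-lin (up z a) γ) q (λ b d → Op _ (up y b) (∂ d f)))

-- An exchange relation between two such operators holds as soon as it holds for constant terms.
Op-exchange : ∀ {φ₁ ψ₁ φ₂ ψ₂ φ₃ ψ₃ : ℤ → Series → ℤ} →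
  (∀ z → Lin (φ₁ z)) → (∀ z → Lin (φ₂ z)) → (∀ z → Lin (φ₃ z)) →
  (∀ z y {f} → PI f → φ₁ z (Op ψ₁ y f) ≡ φ₂ y (Op ψ₂ z f) + - φ₃ (ℤ.suc y) (Op ψ₃ (ℤ.pred z) f)) →
  ∀ z y {f} → PI f → ∀ γ →
  Op φ₁ z (Op ψ₁ y f) γ ≡ Op φ₂ y (Op ψ₂ z f) γ + - Op φ₃ (ℤ.suc y) (Op ψ₃ (ℤ.pred z) f) γ
Op-exchange l₁ l₂ l₃ base z y p [] = base z y p
Op-exchange {φ₁} {ψ₁} {φ₂} {ψ₂} {φ₃} {ψ₃} l₁ l₂ l₃ base z y {f} p (c ∷ γ) = begin
  Op φ₁ z (Op ψ₁ y f) (c ∷ γ)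
    ≡⟨ Op-Op l₁ y z f c γ ⟩
  C c (λ a q → C q (λ b d → Op φ₁ (up z a) (Op ψ₁ (up y b) (∂ d f)) γ))
    ≡⟨ C-cong c (λ a q → C-cong q (λ b d →
         Op-exchange l₁ l₂ l₃ base (up z a) (up y b) (PI-∂ d p) γ)) ⟩
  C c (λ a q → C q (λ b d → X b a d + - Y b a d))
    ≡⟨ C-cong c (λ a q → trans (C-+ q (λ b d → X b a d) (λ b d → - Y b a d))
                               (+ˡ (C q (λ b d → X b a d)) (C-neg q (λ b d → Y b a d)))) ⟩
  C c (λ a q → C q (λ b d → X b a d) + - C q (λ b d → Y b a d))
    ≡⟨ trans (C-+ c (λ a q → C q (λ b d → X b a d)) (λ a q → - C q (λ b d → Y b a d)))
             (+ˡ (C c (λ a q → C q (λ b d → X b a d))) (C-neg c (λ a q → C q (λ b d → Y b a d)))) ⟩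
  C c (λ a q → C q (λ b d → X b a d)) + - C c (λ a q → C q (λ b d → Y b a d))
    ≡⟨ cong₂ (λ x w → x + - w) (C-exchange c (λ a b d → X b a d))
         (trans (C-exchange c (λ a b d → Y b a d)) (C-cong c (λ b q → C-cong q (λ a d →
           cong₂ (λ u v → Op φ₃ u (Op ψ₃ v (∂ d f)) γ) (sym (up-suc y b)) (sym (up-pred z a)))))) ⟩
  C c (λ b q → C q (λ a d → Op φ₂ (up y b) (Op ψ₂ (up z a) (∂ d f)) γ)) +
    - C c (λ b q → C q (λ a d → Op φ₃ (up (ℤ.suc y) b) (Op ψ₃ (up (ℤ.pred z) a) (∂ d f)) γ))
    ≡⟨ cong₂ (λ x w → x + - w) (sym (Op-Op l₂ z y f c γ)) (sym (Op-Op l₃ (ℤ.pred z) (ℤ.suc y) f c γ)) ⟩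
  Op φ₂ y (Op ψ₂ z f) (c ∷ γ) + - Op φ₃ (ℤ.suc y) (Op ψ₃ (ℤ.pred z) f) (c ∷ γ) ∎
  where
  X Y : ℕ → ℕ → ℕ → ℤ
  X b a d = Op φ₂ (up y b) (Op ψ₂ (up z a) (∂ d f)) γ
  Y b a d = Op φ₃ (ℤ.suc (up y b)) (Op ψ₃ (ℤ.pred (up z a)) (∂ d f)) γ


-- The operators W_z (= RS_{-z}), multiplication by h_j, and the alternating family D

isZero : ℤ → ℤ
isZero (+ zero)    = + 1
isZero (+ (suc _)) = + 0
isZero -[1+ _ ]    = + 0

φW φT : ℤ → Series → ℤ
φW z f = Ēz z f []
φT z f = isZero z * f []

φW-lin : ∀ z → Lin (φW z)
φW-lin z = Ēz-lin z []

φT-lin : ∀ z → Lin (φT z)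
φT-lin z = *-lin (isZero z) (eval-lin [])

W T : ℤ → Series → Series
W = Op φW
T = Op φT

W-lin : ∀ z γ → Lin (λ f → W z f γ)
W-lin = Op-lin φW-lin

T-lin : ∀ z γ → Lin (λ f → T z f γ)
T-lin = Op-lin φT-lin

Op-0 : ∀ z f γ → Op (λ _ _ → + 0) z f γ ≡ + 0
Op-0 z f []      = refl
Op-0 z f (c ∷ γ) = C-0 c (λ a b → Op-0 (up z a) (∂ b f) γ)

-- RS_m RS_n = - RS_{n-1} RS_{m+1}
W-W : ∀ z y {f} → PI f → ∀ γ → W z (W y f) γ ≡ - W (ℤ.suc y) (W (ℤ.pred z) f) γ
W-W z y {f} p γ = trans
  -- The zero functional removes the first term of the exchange relation and leaves the negated one.
  (Op-exchange {φW} {φW} {λ _ _ → + 0} {φW} {φW} {φW} φW-lin (λ _ → zero-lin) φW-lin base z y p γ)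
  (trans (+ʳ (- W (ℤ.suc y) (W (ℤ.pred z) f) γ) (Op-0 y (W z f) γ)) (ℤₚ.+-identityˡ _))
  where
  base : ∀ z y {f} → PI f → φW z (W y f) ≡ + 0 + - φW (ℤ.suc y) (W (ℤ.pred z) f)
  base z y {f} p = begin
    Ēz z (W y f) []
      -- Because the Ē commute, Ē_y Ē_z - Ē_{y+1} Ē_{z-1} changes sign when (z, y) is replaced by (y
      -- + 1, z - 1).
      ≡⟨ Ēz-Op φW-lin z y p [] ⟩
    Ēz y (Ēz z f) [] + - Ēz (ℤ.suc y) (Ēz (ℤ.pred z) f) []
      ≡⟨ arrange (Ēz y (Ēz z f) []) (Ēz (ℤ.suc y) (Ēz (ℤ.pred z) f) []) ⟩
    + 0 + - (Ēz (ℤ.suc y) (Ēz (ℤ.pred z) f) [] + - Ēz y (Ēz z f) [])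
      ≡⟨ cong (λ x → + 0 + - x) (cong₂ (λ u v → u + - v)
           (Ēz-comm (ℤ.suc y) (ℤ.pred z) p [])
           (trans (Ēz-comm y z p [])
                  (cong₂ (λ u v → Ēz u (Ēz v f) []) (sym (ℤₚ.suc-pred z)) (sym (ℤₚ.pred-suc y))))) ⟩
    + 0 + - (Ēz (ℤ.pred z) (Ēz (ℤ.suc y) f) [] +
             - Ēz (ℤ.suc (ℤ.pred z)) (Ēz (ℤ.pred (ℤ.suc y)) f) [])
      ≡⟨ cong (λ x → + 0 + - x) (sym (Ēz-Op φW-lin (ℤ.suc y) (ℤ.pred z) p [])) ⟩
    + 0 + - Ēz (ℤ.suc y) (W (ℤ.pred z) f) [] ∎
    where
    arrange : ∀ a b → a + - b ≡ + 0 + - (b + - a)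
    arrange = solve-∀

-- RS_a h_j = h_j RS_a - h_{j-1} RS_{a+1}, which on constant terms is `Ē-Op` for multiplication by
-- h_j.
W-T : ∀ z y {f} → PI f → ∀ γ → W z (T y f) γ ≡ T y (W z f) γ + - T (ℤ.suc y) (W (ℤ.pred z) f) γ
W-T = Op-exchange {φW} {φT} {φT} {φW} {φT} {φW} φW-lin φT-lin φT-lin (λ z y p → Ēz-Op φT-lin z y p [])

-- Products as convolutions, and `T` as multiplication by complete functions

diag : (List ℕ → List ℕ → ℤ) → Series
diag F γ = ∑ (below γ) (λ α → F α (zipWith _∸_ γ α))

diag-∷ : ∀ F c γ → diag F (c ∷ γ) ≡ C c (λ a b → diag (λ α β → F (a ∷ α) (b ∷ β)) γ)
diag-∷ F c γ = begin
  ∑ (below (c ∷ γ)) (λ α → F α (zipWith _∸_ (c ∷ γ) α))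
    ≡⟨ ∑-concatMap (λ a → map (a ∷_) (below γ)) (upTo (suc c)) _ ⟩
  ∑ (upTo (suc c)) (λ a → ∑ (map (a ∷_) (below γ)) (λ α → F α (zipWith _∸_ (c ∷ γ) α)))
    ≡⟨ ∑-cong (upTo (suc c)) (λ a → ∑-map (a ∷_) (below γ) (λ α → F α (zipWith _∸_ (c ∷ γ) α))) ⟩
  ∑ (upTo (suc c)) (λ a → diag (λ α β → F (a ∷ α) (c ∸ a ∷ β)) γ)
    ≡⟨ sym (C-upTo c (λ a b → diag (λ α β → F (a ∷ α) (b ∷ β)) γ)) ⟩
  C c (λ a b → diag (λ α β → F (a ∷ α) (b ∷ β)) γ) ∎

⊛-∷ : ∀ f g c γ → (f ⊛ g) (c ∷ γ) ≡ C c (λ a b → (∂ a f ⊛ ∂ b g) γ)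
⊛-∷ f g = diag-∷ (λ α β → f α * g β)

⊛-[] : ∀ f g → (f ⊛ g) [] ≡ f [] * g []
⊛-[] f g = ℤₚ.+-identityʳ (f [] * g [])

⊛-linʳ : ∀ f γ → Lin (λ g → (f ⊛ g) γ)
⊛-linʳ f γ = ∑-lin (below γ) (λ α → *-lin (f α) (eval-lin (zipWith _∸_ γ α)))

⊛-linˡ : ∀ g γ → Lin (λ f → (f ⊛ g) γ)
⊛-linˡ g γ = ∑-lin (below γ) (λ α → l α (g (zipWith _∸_ γ α)))
  where
  l : ∀ α k → Lin (λ f → f α * k)
  l α k .resp e = cong (_* k) (e α)
  l α k .add f h = ℤₚ.*-distribʳ-+ k (f α) (h α)
  l α k .scl c f = ℤₚ.*-assoc c (f α) k

⊛-cong : ∀ {f f′ g g′} → f ≈ f′ → g ≈ g′ → (f ⊛ g) ≈ (f′ ⊛ g′)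
⊛-cong {f} {f′} {g} {g′} e d γ = trans (resp (⊛-linˡ g γ) e) (resp (⊛-linʳ f′ γ) d)

hz : ℤ → Series
hz z γ = isZero (up z (sum γ))

suc-neg : ∀ n → ℤ.suc -[1+ n ] ≡ - + n
suc-neg zero    = refl
suc-neg (suc n) = refl

up-pos : ∀ k s → isZero (up (+ (suc k)) s) ≡ + 0
up-pos k zero    = refl
up-pos k (suc s) = up-pos (suc k) s

hS≈hz : ∀ j → hS j ≈ hz (- + j)
hS≈hz j γ = go j (sum γ)
  where
  go : ∀ j s → boolℤ (s ≡ᵇ j) ≡ isZero (up (- + j) s)
  go zero    zero    = refl
  go zero    (suc s) = sym (up-pos 0 s)
  go (suc j) zero    = refl
  go (suc j) (suc s) = trans (go j s) (cong (λ z → isZero (up z s)) (sym (suc-neg j)))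

hz⊛≈T : ∀ z f → (hz z ⊛ f) ≈ T z f
hz⊛≈T z f []      = ⊛-[] (hz z) f
hz⊛≈T z f (c ∷ γ) = trans (⊛-∷ (hz z) f c γ) (C-cong c (λ a b →
  trans (resp (⊛-linˡ (∂ b f) γ) (λ δ → cong isZero (sym (up-up z a (sum δ)))))
        (hz⊛≈T (up z a) (∂ b f) γ)))

hS⊛≈T : ∀ j f → (hS j ⊛ f) ≈ T (- + j) f
hS⊛≈T j f γ = trans (resp (⊛-linˡ f γ) (hS≈hz j)) (hz⊛≈T (- + j) f γ)

T-pos : ∀ n f → T (+ (suc n)) f ≈ zeroS
T-pos n f []      = refl
T-pos n f (c ∷ γ) = C-0 c (λ a b → trans (cong (λ z → T z (∂ b f) γ) (up-+ (+ suc n) a)) (T-pos (n ℕ.+ a) (∂ b f) γ))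

-- Jacobi-Trudi determinants as iterated RS

one : Series
one = hS 0

PI-hS : ∀ j → PI (hS j)
PI-hS j .perm r = cong (λ s → ind s j) (sum-↭ r)
PI-hS j .pad γ = refl

Ē-one : ∀ n → Ē (suc n) one ≈ zeroS
Ē-one n γ = trans (Ē-rec n one γ) (cong -_ (C-0 n (λ i j → lin-0 (Ē-lin i γ) (λ _ → refl))))

-- The difference L - x. Raising both arguments by one leaves it unchanged by computation, on which
-- `D-suc-∷ʳ0` relies.
dif : ℕ → ℕ → ℤ
dif L       zero    = + L
dif zero    (suc x) = -[1+ x ]
dif (suc L) (suc x) = dif L x

dif-suc : ∀ L x → ℤ.suc (dif L x) ≡ dif (suc L) x
dif-suc L       zero          = refl
dif-suc zero    (suc zero)    = refl
dif-suc zero    (suc (suc x)) = refl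
dif-suc (suc L) (suc x)       = dif-suc L x

dif-pred : ∀ L x → ℤ.pred (dif (suc L) x) ≡ dif L x
dif-pred L x = trans (cong ℤ.pred (sym (dif-suc L x))) (ℤₚ.pred-suc (dif L x))

dif-+ : ∀ L x → dif L (x ℕ.+ L) ≡ - + x
dif-+ L x = trans (cong (dif L) (ℕₚ.+-comm x L)) (go L x)
  where
  go : ∀ L x → dif L (L ℕ.+ x) ≡ - + x
  go zero    zero    = refl
  go zero    (suc x) = refl
  go (suc L) x       = go L x

-- D ℓ is the determinant det (h_{ℓ_i - k + j}) for ℓ of length k; it is Schur for ℓ = λ + (k-1,…,0).
D : List ℕ → Series
D []      = one
D (x ∷ ℓ) = W (dif (length ℓ) x) (D ℓ)

D-PI : ∀ ℓ → PI (D ℓ)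
D-PI []      = PI-hS 0
D-PI (x ∷ ℓ) = Op-PI φW-lin (dif (length ℓ) x) (D-PI ℓ)

Alt : (List ℕ → ℤ) → Set
Alt A = ∀ pre x y post → A (pre ++ x ∷ y ∷ post) ≡ - A (pre ++ y ∷ x ∷ post)

Alt-∷ : ∀ {A} p → Alt A → Alt (λ ℓ → A (p ∷ ℓ))
Alt-∷ p alt pre = alt (p ∷ pre)

D-Alt : ∀ γ → Alt (λ ℓ → D ℓ γ)
D-Alt γ [] x y post = begin
  W (dif (suc L) x) (W (dif L y) (D post)) γ
    ≡⟨ W-W (dif (suc L) x) (dif L y) (D-PI post) γ ⟩
  - W (ℤ.suc (dif L y)) (W (ℤ.pred (dif (suc L) x)) (D post)) γ
    ≡⟨ cong₂ (λ u v → - W u (W v (D post)) γ) (dif-suc L y) (dif-pred L x) ⟩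
  - W (dif (suc L) y) (W (dif L x) (D post)) γ ∎
  where L = length post
D-Alt γ (p ∷ pre) x y post = begin
  W (dif (length (pre ++ x ∷ y ∷ post)) p) (D (pre ++ x ∷ y ∷ post)) γ
    ≡⟨ cong (λ L → W (dif L p) (D (pre ++ x ∷ y ∷ post)) γ)
         (trans (Lₚ.length-++ pre) (sym (Lₚ.length-++ pre))) ⟩
  W z (D (pre ++ x ∷ y ∷ post)) γ
    ≡⟨ resp (W-lin z γ) (λ δ → D-Alt δ pre x y post) ⟩
  W z (neg (D (pre ++ y ∷ x ∷ post))) γ
    ≡⟨ lin-neg (W-lin z γ) (D (pre ++ y ∷ x ∷ post)) ⟩
  - W z (D (pre ++ y ∷ x ∷ post)) γ ∎
  where z = dif (length (pre ++ y ∷ x ∷ post)) p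

-- By `Ē-Op` each factor `W` uses up at most one unit of n, so a positive index reaches the constant
-- 1, where Ē vanishes.
Ē-D-0 : ∀ ℓ n → length ℓ < n → Ē n (D ℓ) ≈ zeroS
Ē-D-0 []      (suc n) l γ = Ē-one n γ
Ē-D-0 (x ∷ ℓ) (suc n) (s≤s l) γ = trans (Ē-Op φW-lin (suc n) z (D-PI ℓ) γ)
  (cong₂ (λ a b → a + - b) (lin-0 (W-lin z γ) (Ē-D-0 ℓ (suc n) (ℕₚ.m<n⇒m<1+n l)))
                           (lin-0 (W-lin (ℤ.suc z) γ) (Ē-D-0 ℓ n l)))
  where z = dif (length ℓ) x

-- All indices n + |δ| are at least n. Applied to `W (+ suc L) (D ℓ)`, which is an entry -1 in front
-- of ℓ, this allows entries to be natural numbers.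
W-pos-0 : ∀ n {f} → PI f → (∀ m → n ≤ m → Ē m f ≈ zeroS) → W (+ n) f ≈ zeroS
W-pos-0 n p v []      = v n ℕₚ.≤-refl []
W-pos-0 n {f} p v (c ∷ γ) = C-0 c (λ a b → trans (cong (λ z → W z (∂ b f) γ) (up-+ (+ n) a))
  (W-pos-0 (n ℕ.+ a) (PI-∂ b p)
    (λ m l δ → trans (sym (∂-Ē m b p δ)) (v m (ℕₚ.≤-trans (ℕₚ.m≤m+n n a) l) (b ∷ δ))) γ))

∑-below-∷ : ∀ x ℓ (F : List ℕ → ℤ) →
            ∑ (below (x ∷ ℓ)) F ≡ ∑ (upTo (suc x)) (λ a → ∑ (below ℓ) (λ m → F (a ∷ m)))
∑-below-∷ x ℓ F = trans (∑-concatMap (λ a → map (a ∷_) (below ℓ)) (upTo (suc x)) F)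
                        (∑-cong (upTo (suc x)) (λ a → ∑-map (a ∷_) (below ℓ) F))

below-All : ∀ ℓ → All (λ m → sum m ≤ sum ℓ × length m ≡ length ℓ) (below ℓ)
below-All []      = (z≤n , refl) ∷ []
below-All (x ∷ ℓ) = Allₚ.concat⁺ (Allₚ.map⁺ (Allₚ.applyUpTo⁺₁ id (suc x) (λ i<x →
  Allₚ.map⁺ (All.map (λ (s , l) → ℕₚ.+-mono-≤ (s≤s⁻¹ i<x) s , cong suc l) (below-All ℓ)))))

-- Passing h_c^⊥ through a factor RS lowers its entry by some amount and hands the rest of c to the
-- next factor.
D-∂ : ∀ ℓ c γ → ∂ c (D ℓ) γ ≡ ∑ (below ℓ) (λ m → ind (sum m ℕ.+ c) (sum ℓ) * D m γ)
D-∂ []      zero    γ = sym (trans (ℤₚ.+-identityʳ _) (ℤₚ.*-identityˡ (one γ)))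
D-∂ []      (suc c) γ = refl
D-∂ (x ∷ ℓ) c γ = trans (go x c) (sym (∑-below-∷ x ℓ _))
  where
  L = length ℓ
  R : ℕ → ℕ → ℕ → ℤ
  R x c a = ∑ (below ℓ) (λ m → ind (a ℕ.+ sum m ℕ.+ c) (x ℕ.+ sum ℓ) * D (a ∷ m) γ)
  top : ∀ x c → W (dif L x) (∂ c (D ℓ)) γ ≡ R x c x
  top x c = begin
    W (dif L x) (∂ c (D ℓ)) γ
      ≡⟨ resp (W-lin (dif L x) γ) (D-∂ ℓ c) ⟩
    W (dif L x) (λ δ → ∑ (below ℓ) (λ m → ind (sum m ℕ.+ c) (sum ℓ) * D m δ)) γ
      ≡⟨ lin-∑* (W-lin (dif L x) γ) (below ℓ) (λ m → ind (sum m ℕ.+ c) (sum ℓ)) D ⟩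
    ∑ (below ℓ) (λ m → ind (sum m ℕ.+ c) (sum ℓ) * W (dif L x) (D m) γ)
      ≡⟨ ∑-cong-All (All.map (λ {m} (_ , l) → cong₂ _*_
           (ind-cong (λ e → trans (ℕₚ.+-assoc x (sum m) c) (cong (x ℕ.+_) e))
                     (λ e → ℕₚ.+-cancelˡ-≡ x _ _ (trans (sym (ℕₚ.+-assoc x (sum m) c)) e)))
           (cong (λ k → W (dif k x) (D m) γ) (sym l))) (below-All ℓ)) ⟩
    R x c x ∎
  go : ∀ x c → ∂ c (W (dif L x) (D ℓ)) γ ≡ ∑ (upTo (suc x)) (R x c)
  go x zero = begin
    ∂ 0 (W (dif L x) (D ℓ)) γ         ≡⟨ Op-∂0 φW-lin (dif L x) (D ℓ) γ ⟩
    W (dif L x) (∂ 0 (D ℓ)) γ         ≡⟨ top x 0 ⟩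
    R x 0 x                           ≡⟨ sym (ℤₚ.+-identityˡ _) ⟩
    + 0 + R x 0 x                     ≡⟨ +ʳ (R x 0 x) (sym (∑-upTo-0 x (λ a a<x → ∑-0-All
      (All.map (λ {m} (s , _) → ind-no-* (D (a ∷ m) γ) (ℕₚ.<⇒≢ (subst (ℕ._< x ℕ.+ sum ℓ)
        (sym (ℕₚ.+-identityʳ (a ℕ.+ sum m))) (ℕₚ.+-mono-<-≤ a<x s)))) (below-All ℓ))))) ⟩
    ∑ (upTo x) (R x 0) + R x 0 x      ≡⟨ sym (∑-upTo-snoc x (R x 0)) ⟩
    ∑ (upTo (suc x)) (R x 0)          ∎
  -- Lowering an entry 0 produces the index L + 1, which exceeds the number L of factors of `D ℓ`.
  go zero (suc c) = begin
    ∂ (suc c) (W (+ L) (D ℓ)) γ                                  ≡⟨ Op-shift φW-lin c (+ L) (D ℓ) γ ⟩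
    W (+ L) (∂ (suc c) (D ℓ)) γ + ∂ c (W (+ suc L) (D ℓ)) γ      ≡⟨ cong₂ _+_ (top 0 (suc c)) (W-pos-0 (suc L) (D-PI ℓ) (λ m l → Ē-D-0 ℓ m l) (c ∷ γ)) ⟩
    ∑ (upTo 1) (R 0 (suc c))                                     ∎
  go (suc x) (suc c) = begin
    ∂ (suc c) (W (dif L (suc x)) (D ℓ)) γ
      ≡⟨ Op-shift φW-lin c (dif L (suc x)) (D ℓ) γ ⟩
    W (dif L (suc x)) (∂ (suc c) (D ℓ)) γ + ∂ c (W (ℤ.suc (dif L (suc x))) (D ℓ)) γ
      ≡⟨ cong₂ _+_ (top (suc x) (suc c)) (trans (cong (λ z → ∂ c (W z (D ℓ)) γ) (dif-suc L (suc x))) (go x c)) ⟩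
    R (suc x) (suc c) (suc x) + ∑ (upTo (suc x)) (R x c)
      ≡⟨ ℤₚ.+-comm (R (suc x) (suc c) (suc x)) _ ⟩
    ∑ (upTo (suc x)) (R x c) + R (suc x) (suc c) (suc x)
      ≡⟨ +ʳ (R (suc x) (suc c) (suc x)) (∑-cong (upTo (suc x)) (λ a → ∑-cong (below ℓ) (λ m →
           cong (λ s → ind s (suc x ℕ.+ sum ℓ) * D (a ∷ m) γ) (sym (ℕₚ.+-suc (a ℕ.+ sum m) c))))) ⟩
    ∑ (upTo (suc x)) (R (suc x) (suc c)) + R (suc x) (suc c) (suc x)
      ≡⟨ sym (∑-upTo-snoc (suc x) (R (suc x) (suc c))) ⟩
    ∑ (upTo (suc (suc x))) (R (suc x) (suc c)) ∎

-- Interlacing partitions and the Jacobi–Trudi formula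

-- Zero parts are allowed, unlike in `IsPartition`: interlacing preserves the length of the list.
Desc : List ℕ → Set
Desc = Linked _≥_

Desc-tail : ∀ {x ν} → Desc (x ∷ ν) → Desc ν
Desc-tail [-]     = []
Desc-tail (_ ∷ l) = l

Desc-head : ∀ {x ν} → Desc (x ∷ ν) → headℕ ν ≤ x
Desc-head [-]     = z≤n
Desc-head (h ∷ _) = h

Desc-∷ : ∀ {x ν} → headℕ ν ≤ x → Desc ν → Desc (x ∷ ν)
Desc-∷ {ν = []}    h l = [-]
Desc-∷ {ν = _ ∷ _} h l = h ∷ l

shift : List ℕ → List ℕ
shift []       = []
shift (x ∷ xs) = (x ℕ.+ length xs) ∷ shift xs

length-shift : ∀ ν → length (shift ν) ≡ length ν
length-shift []      = refl
length-shift (x ∷ ν) = cong suc (length-shift ν)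

triangle : ℕ → ℕ
triangle zero    = 0
triangle (suc n) = n ℕ.+ triangle n

sum-shift : ∀ ν → sum (shift ν) ≡ sum ν ℕ.+ triangle (length ν)
sum-shift []      = refl
sum-shift (x ∷ ν) = trans (cong (x ℕ.+ length ν ℕ.+_) (sum-shift ν))
                          (ℕ-interchange x (length ν) (sum ν) _)

∑-interlace-[] : ∀ x (F : List ℕ → ℤ) → ∑ (interlace (x ∷ [])) F ≡ ∑ (upTo (suc x)) (λ t → F (t ∷ []))
∑-interlace-[] x F = trans (∑-map [_] (range 0 x) F) (∑-map (0 ℕ.+_) (upTo (suc x)) (λ t → F (t ∷ [])))

∑-interlace-∷ : ∀ x y r (F : List ℕ → ℤ) → ∑ (interlace (x ∷ y ∷ r)) F ≡
                ∑ (upTo (suc (x ∸ y))) (λ t → ∑ (interlace (y ∷ r)) (λ μ → F (y ℕ.+ t ∷ μ)))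
∑-interlace-∷ x y r F = trans (∑-concatMap (λ m → map (m ∷_) (interlace (y ∷ r))) (range y x) F)
  (trans (∑-map (y ℕ.+_) (upTo (suc (x ∸ y))) (λ m → ∑ (map (m ∷_) (interlace (y ∷ r))) F))
         (∑-cong (upTo (suc (x ∸ y))) (λ t → ∑-map (y ℕ.+ t ∷_) (interlace (y ∷ r)) F)))

interlace-All-∷ : ∀ {P Q : List ℕ → Set} x y r → y ≤ x →
  (∀ m {μ} → y ≤ m → m ≤ x → P μ → Q (m ∷ μ)) →
  All P (interlace (y ∷ r)) → All Q (interlace (x ∷ y ∷ r))
interlace-All-∷ x y r y≤x f a = Allₚ.concat⁺ (Allₚ.map⁺ (Allₚ.map⁺ (Allₚ.applyUpTo⁺₁ id (suc (x ∸ y))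
  (λ {t} t<n → Allₚ.map⁺ (All.map (f (y ℕ.+ t) (ℕₚ.m≤m+n y t)
    (ℕₚ.≤-trans (ℕₚ.+-monoʳ-≤ y (s≤s⁻¹ t<n)) (ℕₚ.≤-reflexive (ℕₚ.m+[n∸m]≡n y≤x)))) a)))))

interlace-All : ∀ ν → Desc ν → All (λ μ → length μ ≡ length ν × Desc μ × headℕ μ ≤ headℕ ν) (interlace ν)
interlace-All []          d = (refl , [] , z≤n) ∷ []
interlace-All (x ∷ [])    d = Allₚ.map⁺ (Allₚ.map⁺ (Allₚ.applyUpTo⁺₁ id (suc x) (λ t<n → refl , [-] , s≤s⁻¹ t<n)))
interlace-All (x ∷ y ∷ r) (h ∷ d) = interlace-All-∷ x y r h
  (λ m y≤m m≤x (l , dμ , hμ) → cong suc l , Desc-∷ (ℕₚ.≤-trans hμ y≤m) dμ , m≤x) (interlace-All (y ∷ r) d)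

interlace-lower : ∀ x ν → Desc (x ∷ ν) → All (λ μ → sum ν ≤ sum μ) (interlace (x ∷ ν))
interlace-lower x []      d = Allₚ.map⁺ (Allₚ.map⁺ (Allₚ.applyUpTo⁺₁ id (suc x) (λ _ → z≤n)))
interlace-lower x (y ∷ r) (h ∷ d) = interlace-All-∷ x y r h (λ m y≤m _ s → ℕₚ.+-mono-≤ y≤m s) (interlace-lower y r d)

-- The smallest interlacer drops the first part and appends a zero; all others have larger sum.
interlace-min : ∀ x ν (H : List ℕ → ℤ) → Desc (x ∷ ν) → (∀ μ → sum ν < sum μ → H μ ≡ + 0) →
                ∑ (interlace (x ∷ ν)) H ≡ H (ν ∷ʳ 0)
interlace-min x [] H d v = trans (∑-interlace-[] x H)
  (∑-upTo-single (suc x) 0 {λ t → H (t ∷ [])} (s≤s z≤n) (λ { zero ne → ⊥-elim (ne refl) ; (suc t) _ → v (suc t ∷ []) (s≤s z≤n) }))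
interlace-min x (y ∷ r) H (h ∷ d) v = begin
  ∑ (interlace (x ∷ y ∷ r)) H
    ≡⟨ ∑-interlace-∷ x y r H ⟩
  ∑ (upTo (suc (x ∸ y))) (λ t → ∑ (interlace (y ∷ r)) (λ μ → H (y ℕ.+ t ∷ μ)))
    ≡⟨ ∑-upTo-single (suc (x ∸ y)) 0 (s≤s z≤n) big ⟩
  ∑ (interlace (y ∷ r)) (λ μ → H (y ℕ.+ 0 ∷ μ))
    ≡⟨ interlace-min y r (λ μ → H (y ℕ.+ 0 ∷ μ)) d (λ μ l → v (y ℕ.+ 0 ∷ μ)
         (ℕₚ.+-mono-≤-< (ℕₚ.m≤m+n y 0) l)) ⟩
  H (y ℕ.+ 0 ∷ r ∷ʳ 0)
    ≡⟨ cong (λ z → H (z ∷ r ∷ʳ 0)) (ℕₚ.+-identityʳ y) ⟩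
  H (y ∷ r ∷ʳ 0) ∎
  where
  big : ∀ t → t ≢ 0 → ∑ (interlace (y ∷ r)) (λ μ → H (y ℕ.+ t ∷ μ)) ≡ + 0
  big zero    ne = ⊥-elim (ne refl)
  big (suc t) _  = ∑-0-All (All.map (λ {μ} s → v (y ℕ.+ suc t ∷ μ)
    (ℕₚ.+-mono-<-≤ (ℕₚ.m<m+n y (s≤s z≤n)) s)) (interlace-lower y r d))

-- The terms with m₁ ≤ ℓ₂ cancel under exchanging m₁ and m₂.
∑-below-shift : ∀ {F} → Alt F → ∀ ν → Desc ν → ∑ (below (shift ν)) F ≡ ∑ (interlace ν) (F ∘ shift)
∑-below-shift alt [] d = refl
∑-below-shift {F} alt (x ∷ []) d = begin
  ∑ (below (x ℕ.+ 0 ∷ [])) F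
    ≡⟨ ∑-below-∷ (x ℕ.+ 0) [] F ⟩
  ∑ (upTo (suc (x ℕ.+ 0))) (λ a → F (a ∷ []) + + 0)
    ≡⟨ cong (λ n → ∑ (upTo (suc n)) (λ a → F (a ∷ []) + + 0)) (ℕₚ.+-identityʳ x) ⟩
  ∑ (upTo (suc x)) (λ a → F (a ∷ []) + + 0)
    ≡⟨ ∑-cong (upTo (suc x)) (λ a → trans (ℤₚ.+-identityʳ _) (cong (λ b → F (b ∷ [])) (sym (ℕₚ.+-identityʳ a)))) ⟩
  ∑ (upTo (suc x)) (λ a → F (a ℕ.+ 0 ∷ []))
    ≡⟨ sym (∑-interlace-[] x (F ∘ shift)) ⟩
  ∑ (interlace (x ∷ [])) (F ∘ shift) ∎
∑-below-shift {F} alt (x ∷ y ∷ r) (h ∷ d) = begin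
  ∑ (below (shift (x ∷ y ∷ r))) F
    ≡⟨ ∑-below-∷ (x ℕ.+ suc L) (shift (y ∷ r)) F ⟩
  ∑ (upTo (suc (x ℕ.+ suc L))) G
    ≡⟨ cong (λ n → ∑ (upTo n) G) bound ⟩
  ∑ (upTo (suc (y ℕ.+ L) ℕ.+ suc (x ∸ y))) G
    ≡⟨ ∑-upTo-+ (suc (y ℕ.+ L)) (suc (x ∸ y)) G ⟩
  ∑ (upTo (suc (y ℕ.+ L))) G + ∑ (upTo (suc (x ∸ y))) (λ t → G (suc (y ℕ.+ L) ℕ.+ t))
    ≡⟨ cong₂ _+_
         (trans (∑-cong (upTo (suc (y ℕ.+ L))) (λ a → ∑-below-∷ (y ℕ.+ L) (shift r) (λ m → F (a ∷ m))))
           (∑-antisym (upTo (suc (y ℕ.+ L))) (λ a b → ∑ (below (shift r)) (λ m → F (a ∷ b ∷ m)))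
             (λ a b → trans (∑-cong (below (shift r)) (λ m → alt [] a b m)) (∑-neg (below (shift r)) (λ m → F (b ∷ a ∷ m))))))
         (∑-cong (upTo (suc (x ∸ y))) (λ t → trans (∑-below-shift (Alt-∷ {F} (suc (y ℕ.+ L) ℕ.+ t) alt) (y ∷ r) d)
           (∑-cong-All (All.map (λ {μ} (l , _) → cong (λ n → F (n ∷ shift μ))
             (trans (first t) (cong (y ℕ.+ t ℕ.+_) (sym l)))) (interlace-All (y ∷ r) d))))) ⟩
  + 0 + ∑ (upTo (suc (x ∸ y))) (λ t → ∑ (interlace (y ∷ r)) (λ μ → F (shift (y ℕ.+ t ∷ μ))))
    ≡⟨ ℤₚ.+-identityˡ _ ⟩
  ∑ (upTo (suc (x ∸ y))) (λ t → ∑ (interlace (y ∷ r)) (λ μ → F (shift (y ℕ.+ t ∷ μ))))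
    ≡⟨ sym (∑-interlace-∷ x y r (F ∘ shift)) ⟩
  ∑ (interlace (x ∷ y ∷ r)) (F ∘ shift) ∎
  where
  L = length r
  G : ℕ → ℤ
  G a = ∑ (below (shift (y ∷ r))) (λ m → F (a ∷ m))
  first : ∀ t → suc (y ℕ.+ L) ℕ.+ t ≡ y ℕ.+ t ℕ.+ suc L
  first t = trans (cong suc (trans (ℕₚ.+-assoc y L t) (trans (cong (y ℕ.+_) (ℕₚ.+-comm L t)) (sym (ℕₚ.+-assoc y t L)))))
                  (sym (ℕₚ.+-suc (y ℕ.+ t) L))
  bound : suc (x ℕ.+ suc L) ≡ suc (y ℕ.+ L) ℕ.+ suc (x ∸ y)
  bound = sym (trans (ℕₚ.+-suc (suc (y ℕ.+ L)) (x ∸ y)) (cong suc (trans (first (x ∸ y)) (cong (ℕ._+ suc L) (ℕₚ.m+[n∸m]≡n h)))))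

Alt-graded : ∀ (A : List ℕ → ℤ) c n → Alt A → Alt (λ m → ind (sum m ℕ.+ c) n * A m)
Alt-graded A c n alt pre x y post = trans (cong₂ _*_
    (cong (λ s → ind (s ℕ.+ c) n) (sum-↭ (↭ₚ.++⁺ˡ pre (swap x y ↭-refl))))
    (alt pre x y post))
  (sym (ℤₚ.neg-distribʳ-* (ind (sum (pre ++ y ∷ x ∷ post) ℕ.+ c) n) (A (pre ++ y ∷ x ∷ post))))

ind-shift : ∀ c μ ν → length μ ≡ length ν →
            ind (sum (shift μ) ℕ.+ c) (sum (shift ν)) ≡ ind (sum ν) (c ℕ.+ sum μ)
ind-shift c μ ν l = ind-cong
  (λ e → sym (ℕₚ.+-cancelʳ-≡ (triangle (length ν)) _ _ (trans (sym eq) (trans e (sum-shift ν)))))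
  (λ e → trans eq (trans (cong (ℕ._+ triangle (length ν)) (sym e)) (sym (sum-shift ν))))
  where
  eq : sum (shift μ) ℕ.+ c ≡ c ℕ.+ sum μ ℕ.+ triangle (length ν)
  eq = trans (ℕₚ.+-comm (sum (shift μ)) c) (trans (cong (c ℕ.+_) (sum-shift μ))
    (trans (sym (ℕₚ.+-assoc c (sum μ) _)) (cong (λ n → c ℕ.+ sum μ ℕ.+ triangle n) l)))

-- `D-∂` sums over all smaller lists, and alternation leaves the shifted interlacers. The result is
-- the recursion that defines `kostkaRev`.
D-strips : ∀ ν → Desc ν → ∀ c γ →
           D (shift ν) (c ∷ γ) ≡ ∑ (interlace ν) (λ μ → ind (sum ν) (c ℕ.+ sum μ) * D (shift μ) γ)
D-strips ν d c γ = begin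
  D (shift ν) (c ∷ γ)
    ≡⟨ D-∂ (shift ν) c γ ⟩
  ∑ (below (shift ν)) (λ m → ind (sum m ℕ.+ c) (sum (shift ν)) * D m γ)
    ≡⟨ ∑-below-shift (Alt-graded (λ m → D m γ) c (sum (shift ν)) (D-Alt γ)) ν d ⟩
  ∑ (interlace ν) (λ μ → ind (sum (shift μ) ℕ.+ c) (sum (shift ν)) * D (shift μ) γ)
    ≡⟨ ∑-cong-All (All.map (λ {μ} (l , _) → cong (_* D (shift μ) γ) (ind-shift c μ ν l)) (interlace-All ν d)) ⟩
  ∑ (interlace ν) (λ μ → ind (sum ν) (c ℕ.+ sum μ) * D (shift μ) γ) ∎

D-shift-∷ : ∀ x ν → D (shift (x ∷ ν)) ≈ W (- + x) (D (shift ν))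
D-shift-∷ x ν γ = cong (λ z → W z (D (shift ν)) γ)
  (trans (cong (λ L → dif L (x ℕ.+ length ν)) (length-shift ν)) (dif-+ (length ν) x))

+-sum : ∀ {A : Set} (xs : List A) (f : A → ℕ) → + sum (map f xs) ≡ ∑ xs (λ x → + f x)
+-sum []       f = refl
+-sum (x ∷ xs) f = trans (ℤₚ.pos-+ (f x) _) (+ˡ (+ f x) (+-sum xs f))

D-const : ∀ ν → D (shift ν) [] ≡ + kostkaRev ν []
D-const []      = refl
D-const (x ∷ ν) = trans (cong (λ L → Ēz (dif L (x ℕ.+ length ν)) (D (shift ν)) []) (length-shift ν))
  (trans (cong (λ z → Ēz z (D (shift ν)) []) (dif-+ (length ν) x)) (go x))
  where
  go : ∀ x → Ēz (- + x) (D (shift ν)) [] ≡ + kostkaRev (x ∷ ν) []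
  go zero    = D-const ν
  go (suc x) = refl

D-kostka : ∀ γ ν → Desc ν → D (shift ν) γ ≡ + kostkaRev ν γ
D-kostka []      ν d = D-const ν
D-kostka (c ∷ γ) ν d = begin
  D (shift ν) (c ∷ γ)
    ≡⟨ D-strips ν d c γ ⟩
  ∑ (interlace ν) (λ μ → ind (sum ν) (c ℕ.+ sum μ) * D (shift μ) γ)
    ≡⟨ ∑-cong-All (All.map (λ {μ} (_ , dμ , _) → cong (ind (sum ν) (c ℕ.+ sum μ) *_) (D-kostka γ μ dμ)) (interlace-All ν d)) ⟩
  ∑ (interlace ν) (λ μ → ind (sum ν) (c ℕ.+ sum μ) * + kostkaRev μ γ)
    ≡⟨ sym (∑-filter (λ μ → sum ν ≟ c ℕ.+ sum μ) (interlace ν) (λ μ → + kostkaRev μ γ)) ⟩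
  ∑ (strips ν c) (λ μ → + kostkaRev μ γ)
    ≡⟨ sym (+-sum (strips ν c) (λ μ → kostkaRev μ γ)) ⟩
  + kostkaRev ν (c ∷ γ) ∎

-- `schurS` reads the content from its end, D from its beginning; since D is symmetric, the reversal
-- does no harm.
schur≈D : ∀ ν → Desc ν → schurS ν ≈ D (shift ν)
schur≈D ν d γ = trans (sym (D-kostka (reverse γ) ν d)) (perm (D-PI (shift ν)) (↭ₚ.↭-reverse γ))

D-homogeneous : ∀ γ ν → Desc ν → sum γ ≢ sum ν → D (shift ν) γ ≡ + 0
D-homogeneous [] ν d ne = trans (D-const ν) (go (sum ν) (ne ∘ sym))
  where
  go : ∀ s → s ≢ 0 → + (if s ≡ᵇ 0 then 1 else 0) ≡ + 0
  go zero    ne = ⊥-elim (ne refl)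
  go (suc s) _  = refl
D-homogeneous (c ∷ γ) ν d ne = trans (D-strips ν d c γ) (∑-0-All (All.map term (interlace-All ν d)))
  where
  term : ∀ {μ} → length μ ≡ length ν × Desc μ × headℕ μ ≤ headℕ ν → ind (sum ν) (c ℕ.+ sum μ) * D (shift μ) γ ≡ + 0
  term {μ} (_ , dμ , _) with sum ν ≟ c ℕ.+ sum μ
  ... | no  n = ind-no-* _ n
  ... | yes e = trans (cong (ind (sum ν) (c ℕ.+ sum μ) *_) (D-homogeneous γ μ dμ (λ q → ne (trans (cong (c ℕ.+_) q) (sym e)))))
                      (ℤₚ.*-zeroʳ (ind (sum ν) (c ℕ.+ sum μ)))

W-one : ∀ z → W z one ≈ hz z
W-one (+ zero)   []      = refl
W-one (+ suc n)  []      = Ē-one n []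
W-one -[1+ n ]   []      = refl
W-one z          (c ∷ γ) = begin
  C c (λ a b → W (up z a) (∂ b one) γ)  ≡⟨ C-last c (λ a b → W (up z a) (∂ b one) γ) (λ a b → lin-0 (W-lin (up z a) γ) (λ _ → refl)) ⟩
  W (up z c) one γ                      ≡⟨ W-one (up z c) γ ⟩
  isZero (up (up z c) (sum γ))          ≡⟨ cong isZero (up-up z c (sum γ)) ⟩
  hz z (c ∷ γ)                          ∎

shift-∷ʳ0 : ∀ ν → shift (ν ∷ʳ 0) ≡ map suc (shift ν) ∷ʳ 0
shift-∷ʳ0 []      = refl
shift-∷ʳ0 (x ∷ ν) = cong₂ _∷_ (trans (cong (x ℕ.+_) (trans (Lₚ.length-++ ν) (ℕₚ.+-comm (length ν) 1))) (ℕₚ.+-suc x (length ν))) (shift-∷ʳ0 ν)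

-- The new innermost factor is RS_0 1 = 1, and the indices of the others do not change.
D-suc-∷ʳ0 : ∀ ℓ → D (map suc ℓ ∷ʳ 0) ≈ D ℓ
D-suc-∷ʳ0 []      γ = trans (W-one (+ 0) γ) (sym (hS≈hz 0 γ))
D-suc-∷ʳ0 (x ∷ ℓ) γ = begin
  W (dif (length (map suc ℓ ∷ʳ 0)) (suc x)) (D (map suc ℓ ∷ʳ 0)) γ
    ≡⟨ cong (λ L → W (dif L (suc x)) (D (map suc ℓ ∷ʳ 0)) γ)
         (trans (Lₚ.length-++ (map suc ℓ)) (trans (ℕₚ.+-comm _ 1) (cong suc (Lₚ.length-map suc ℓ)))) ⟩
  W (dif (length ℓ) x) (D (map suc ℓ ∷ʳ 0)) γ
    ≡⟨ resp (W-lin (dif (length ℓ) x) γ) (D-suc-∷ʳ0 ℓ) ⟩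
  W (dif (length ℓ) x) (D ℓ) γ ∎

D-pad : ∀ ν → D (shift (ν ∷ʳ 0)) ≈ D (shift ν)
D-pad ν γ = trans (cong (λ ℓ → D ℓ γ) (shift-∷ʳ0 ν)) (D-suc-∷ʳ0 (shift ν) γ)

-- A horizontal strip in a shape with first row m has at most m cells.
∂-D-above : ∀ m ν → Desc (m ∷ ν) → ∀ c → m < c → ∂ c (D (shift (m ∷ ν))) ≈ zeroS
∂-D-above m ν d c m<c γ = trans (D-strips (m ∷ ν) d c γ)
  (∑-0-All (All.map (λ {μ} s → ind-no-* (D (shift μ) γ) (ℕₚ.<⇒≢ (ℕₚ.+-mono-<-≤ m<c s))) (interlace-lower m ν d)))

-- The only horizontal strip with m cells leaves the shape ν.
∂-D-head : ∀ m ν → Desc (m ∷ ν) → ∂ m (D (shift (m ∷ ν))) ≈ D (shift ν)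
∂-D-head m ν d γ = begin
  D (shift (m ∷ ν)) (m ∷ γ)
    ≡⟨ D-strips (m ∷ ν) d m γ ⟩
  ∑ (interlace (m ∷ ν)) (λ μ → ind (m ℕ.+ sum ν) (m ℕ.+ sum μ) * D (shift μ) γ)
    ≡⟨ interlace-min m ν _ d (λ μ l → ind-no-* (D (shift μ) γ) (ℕₚ.<⇒≢ (ℕₚ.+-monoʳ-< m l))) ⟩
  ind (m ℕ.+ sum ν) (m ℕ.+ sum (ν ∷ʳ 0)) * D (shift (ν ∷ʳ 0)) γ
    ≡⟨ ind-yes-* (D (shift (ν ∷ʳ 0)) γ) (cong (m ℕ.+_) (sym (trans (sum-++ ν (0 ∷ [])) (ℕₚ.+-identityʳ (sum ν))))) ⟩
  D (shift (ν ∷ʳ 0)) γ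
    ≡⟨ D-pad ν γ ⟩
  D (shift ν) γ ∎

-- Every symmetric function is a combination of Schur functions

data Span (G : Series → Set) : Series → Set where
  gen   : ∀ {f} → G f → Span G f
  zero  : Span G zeroS
  plus  : ∀ {f g} → Span G f → Span G g → Span G (f ⊕ g)
  scale : ∀ c {f} → Span G f → Span G (c · f)
  eq    : ∀ {f g} → f ≈ g → Span G f → Span G g

Span-map : ∀ {G H : Series → Set} → (∀ {f} → G f → H f) → ∀ {f} → Span G f → Span H f
Span-map h (gen x)     = gen (h x)
Span-map h zero        = zero
Span-map h (plus s t)  = plus (Span-map h s) (Span-map h t)
Span-map h (scale c s) = scale c (Span-map h s)
Span-map h (eq e s)    = eq e (Span-map h s)

Span-bind : ∀ {G H : Series → Set} {O : Series → Series} → (∀ γ → Lin (λ f → O f γ)) →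
            (∀ {f} → G f → Span H (O f)) → ∀ {f} → Span G f → Span H (O f)
Span-bind o h (gen x)               = h x
Span-bind o h zero                  = eq (λ γ → sym (lin-0 (o γ) (λ _ → refl))) zero
Span-bind o h (plus {f} {g} s t)    = eq (λ γ → sym (add (o γ) f g)) (plus (Span-bind o h s) (Span-bind o h t))
Span-bind o h (scale c {f} s)       = eq (λ γ → sym (scl (o γ) c f)) (scale c (Span-bind o h s))
Span-bind o h (eq e s)              = eq (λ γ → resp (o γ) e) (Span-bind o h s)

Span-ext : ∀ {G L M} → Lin L → Lin M → (∀ {f} → G f → L f ≡ M f) → ∀ {f} → Span G f → L f ≡ M f
Span-ext l m h (gen x)            = h x
Span-ext l m h zero               = trans (lin-0 l (λ _ → refl)) (sym (lin-0 m (λ _ → refl)))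
Span-ext l m h (plus {f} {g} s t) = trans (add l f g) (trans (cong₂ _+_ (Span-ext l m h s) (Span-ext l m h t)) (sym (add m f g)))
Span-ext l m h (scale c {f} s)    = trans (scl l c f) (trans (cong (c *_) (Span-ext l m h s)) (sym (scl m c f)))
Span-ext l m h (eq e s)           = trans (sym (resp l e)) (trans (Span-ext l m h s) (resp m e))

SchurGen : ℕ → ℕ → Series → Set
SchurGen d m f = ∃[ ν ] (IsPartition ν × headℕ ν ≤ m × sum ν ≤ d × f ≈ D (shift ν))

Bounded : ℕ → Series → Set
Bounded d f = ∀ γ → d < sum γ → f γ ≡ + 0

-- A preimage of g under `∂ m` that is spanned by Schur functions and has no exponent above m. It
-- arises by prepending a row of length m to each shape.
record Lift (d m : ℕ) (g : Series) : Set where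
  field
    lifted  : Series
    spanned : Span (SchurGen d m) lifted
    isPI    : PI lifted
    bounded : Bounded d lifted
    above   : ∀ c → m < c → ∂ c lifted ≈ zeroS
    lifts   : ∂ m lifted ≈ g

lift : ∀ d m → 0 < m → m ≤ d → ∀ {g} → Span (SchurGen (d ∸ m) m) g → Lift d m g
lift d m 0<m m≤d (gen (ν , (dν , pν) , h≤m , s≤ , e)) = record
  { lifted  = D (shift (m ∷ ν))
  ; spanned = gen (m ∷ ν , (dmν , 0<m ∷ pν) , ℕₚ.≤-refl , s≤d , λ _ → refl)
  ; isPI    = D-PI (shift (m ∷ ν))
  ; bounded = λ γ d<γ → D-homogeneous γ (m ∷ ν) dmν (λ q → ℕₚ.<⇒≱ d<γ (ℕₚ.≤-trans (ℕₚ.≤-reflexive q) s≤d))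
  ; above   = ∂-D-above m ν dmν
  ; lifts   = λ γ → trans (∂-D-head m ν dmν γ) (sym (e γ))
  }
  where
  dmν : Desc (m ∷ ν)
  dmν = Desc-∷ h≤m dν
  s≤d : m ℕ.+ sum ν ≤ d
  s≤d = ℕₚ.≤-trans (ℕₚ.+-monoʳ-≤ m s≤) (ℕₚ.≤-reflexive (ℕₚ.m+[n∸m]≡n m≤d))
lift d m 0<m m≤d zero = record
  { lifted = zeroS ; spanned = zero ; isPI = record { perm = λ _ → refl ; pad = λ _ → refl }
  ; bounded = λ _ _ → refl ; above = λ _ _ _ → refl ; lifts = λ _ → refl }
lift d m 0<m m≤d (plus s t) = record
  { lifted  = L.lifted ⊕ M.lifted
  ; spanned = plus L.spanned M.spanned
  ; isPI    = PI-⊕ L.isPI M.isPI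
  ; bounded = λ γ l → cong₂ _+_ (L.bounded γ l) (M.bounded γ l)
  ; above   = λ c l γ → cong₂ _+_ (L.above c l γ) (M.above c l γ)
  ; lifts   = λ γ → cong₂ _+_ (L.lifts γ) (M.lifts γ) }
  where module L = Lift (lift d m 0<m m≤d s)
        module M = Lift (lift d m 0<m m≤d t)
lift d m 0<m m≤d (scale c s) = record
  { lifted  = c · L.lifted
  ; spanned = scale c L.spanned
  ; isPI    = PI-· c L.isPI
  ; bounded = λ γ l → trans (cong (c *_) (L.bounded γ l)) (ℤₚ.*-zeroʳ c)
  ; above   = λ k l γ → trans (cong (c *_) (L.above k l γ)) (ℤₚ.*-zeroʳ c)
  ; lifts   = λ γ → cong (c *_) (L.lifts γ) }
  where module L = Lift (lift d m 0<m m≤d s)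
lift d m 0<m m≤d (eq e s) = record
  { lifted = L.lifted ; spanned = L.spanned ; isPI = L.isPI ; bounded = L.bounded
  ; above = L.above ; lifts = λ γ → trans (L.lifts γ) (e γ) }
  where module L = Lift (lift d m 0<m m≤d s)

Spanned : ℕ → ℕ → Set
Spanned d m = ∀ {f} → PI f → Bounded d f → (∀ c → m < c → ∂ c f ≈ zeroS) → Span (SchurGen d m) f

SchurGen-suc : ∀ {d m f} → SchurGen d m f → SchurGen d (suc m) f
SchurGen-suc (ν , a , h , r) = ν , a , ℕₚ.m≤n⇒m≤1+n h , r

spanned-zero : ∀ d → Spanned d 0
spanned-zero d {f} p b v = eq const (scale (f []) (gen ([] , ([] , []) , z≤n , z≤n , λ _ → refl)))
  where
  const : (f [] · one) ≈ f
  const []          = ℤₚ.*-identityʳ (f [])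
  const (zero ∷ γ)  = trans (const γ) (sym (pad p γ))
  const (suc c ∷ γ) = trans (ℤₚ.*-zeroʳ (f [])) (sym (v (suc c) (s≤s z≤n) γ))

spanned-skip : ∀ d m → d < suc m → Spanned d m → Spanned d (suc m)
spanned-skip d m d<m IH {f} p b v = Span-map SchurGen-suc (IH p b (λ c m<c γ →
  b (c ∷ γ) (ℕₚ.<-≤-trans d<m (ℕₚ.≤-trans m<c (ℕₚ.m≤m+n c (sum γ))))))

-- Subtract a lift of ∂ (suc m) f from f.
spanned-step : ∀ d m → suc m ≤ d → Spanned (d ∸ suc m) (suc m) → Spanned d m → Spanned d (suc m)
spanned-step d m m≤d IH₁ IH₂ {f} p b v = eq sumEq (plus L.spanned rest)
  where
  top : Span (SchurGen (d ∸ suc m) (suc m)) (∂ (suc m) f)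
  top = IH₁ (PI-∂ (suc m) p)
    (λ γ l → b (suc m ∷ γ) (subst (_< suc m ℕ.+ sum γ) (ℕₚ.m+[n∸m]≡n m≤d) (ℕₚ.+-monoʳ-< (suc m) l)))
    (λ c l γ → trans (PI-∂∂ p c (suc m) γ) (v c l (suc m ∷ γ)))
  module L = Lift (lift d (suc m) (s≤s z≤n) m≤d top)
  g : Series
  g = f ⊕ neg L.lifted
  v′ : ∀ c → m < c → ∂ c g ≈ zeroS
  v′ c m<c γ with suc m ≟ c
  ... | yes refl = trans (cong (λ x → f (suc m ∷ γ) + - x) (L.lifts γ)) (ℤₚ.+-inverseʳ (f (suc m ∷ γ)))
  ... | no  ne   = cong₂ (λ x y → x + - y) (v c (ℕₚ.≤∧≢⇒< m<c ne) γ) (L.above c (ℕₚ.≤∧≢⇒< m<c ne) γ)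
  rest : Span (SchurGen d (suc m)) g
  rest = Span-map SchurGen-suc (IH₂ (PI-⊕ p (PI-neg L.isPI))
    (λ γ l → cong₂ (λ x y → x + - y) (b γ l) (L.bounded γ l)) v′)
  sumEq : (L.lifted ⊕ g) ≈ f
  sumEq γ = arrange (L.lifted γ) (f γ)
    where
    arrange : ∀ a b → a + (b + - a) ≡ b
    arrange = solve-∀

-- Induction on the degree d and the largest exponent m. `fuel` bounds d, since `d ∸ suc m` is
-- smaller but not structurally so.
schur-span : ∀ fuel d m → d ≤ fuel → Spanned d m
schur-span fuel d zero _ = spanned-zero d
schur-span fuel d (suc m) d≤ with suc m ℕ.≤? d
schur-span fuel       d    (suc m) d≤ | no m≰d  = spanned-skip d m (ℕₚ.≰⇒> m≰d) (schur-span fuel d m d≤)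
schur-span zero       zero (suc m) d≤ | yes ()
schur-span (suc fuel) d    (suc m) d≤ | yes m≤d = spanned-step d m m≤d
  (schur-span fuel (d ∸ suc m) (suc m) (ℕₚ.≤-trans (ℕₚ.∸-monoˡ-≤ (suc m) d≤) (ℕₚ.m∸n≤m fuel m)))
  (schur-span (suc fuel) d m d≤)

Schur : Series → Set
Schur f = ∃[ ν ] (IsPartition ν × f ≈ D (shift ν))

Sym⇒PI : ∀ {f} → Sym f → PI f
Sym⇒PI s .perm = Sym.permInv s
Sym⇒PI s .pad γ = trans (Sym.permInv s (↭ₚ.∷↭∷ʳ 0 γ)) (Sym.padInv s γ)

PI⇒Sym : ∀ {f d} → PI f → Bounded d f → Sym f
PI⇒Sym {f} {d} p b = record
  { padInv  = λ γ → trans (perm p (↭-sym (↭ₚ.∷↭∷ʳ 0 γ))) (pad p γ)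
  ; permInv = perm p
  ; bounded = d , b }

Sym⇒Schur-span : ∀ {f} → Sym f → Span Schur f
Sym⇒Schur-span {f} s with Sym.bounded s
... | d , b = Span-map (λ (ν , p , _ , _ , e) → ν , p , e)
  (schur-span d d d ℕₚ.≤-refl (Sym⇒PI s) b (λ c d<c γ → b (c ∷ γ) (ℕₚ.<-≤-trans d<c (ℕₚ.m≤m+n c (sum γ)))))

-- Products of symmetric functions

⊛-perm : ∀ {f g} → PI f → PI g → ∀ {γ δ} → γ ↭ δ → (f ⊛ g) γ ≡ (f ⊛ g) δ
⊛-perm p q _↭_.refl = refl
⊛-perm {f} {g} p q (prep {γ} {δ} c r) = trans (⊛-∷ f g c γ)
  (trans (C-cong c (λ a b → ⊛-perm (PI-∂ a p) (PI-∂ b q) r)) (sym (⊛-∷ f g c δ)))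
⊛-perm {f} {g} p q (swap {γ} {δ} x y r) = begin
  (f ⊛ g) (x ∷ y ∷ γ)
    ≡⟨ trans (⊛-∷ f g x (y ∷ γ)) (C-cong x (λ a b → ⊛-∷ (∂ a f) (∂ b g) y γ)) ⟩
  C x (λ a b → C y (λ a′ b′ → (∂ a′ (∂ a f) ⊛ ∂ b′ (∂ b g)) γ))
    ≡⟨ C-swap x y (λ a b a′ b′ → (∂ a′ (∂ a f) ⊛ ∂ b′ (∂ b g)) γ) ⟩
  C y (λ a′ b′ → C x (λ a b → (∂ a′ (∂ a f) ⊛ ∂ b′ (∂ b g)) γ))
    ≡⟨ C-cong y (λ a′ b′ → C-cong x (λ a b → trans (⊛-cong (PI-∂∂ p a′ a) (PI-∂∂ q b′ b) γ)
         (⊛-perm (PI-∂ a (PI-∂ a′ p)) (PI-∂ b (PI-∂ b′ q)) r))) ⟩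
  C y (λ a′ b′ → C x (λ a b → (∂ a (∂ a′ f) ⊛ ∂ b (∂ b′ g)) δ))
    ≡⟨ sym (trans (⊛-∷ f g y (x ∷ δ)) (C-cong y (λ a′ b′ → ⊛-∷ (∂ a′ f) (∂ b′ g) x δ))) ⟩
  (f ⊛ g) (y ∷ x ∷ δ) ∎
⊛-perm p q (_↭_.trans r s) = trans (⊛-perm p q r) (⊛-perm p q s)

⊛-PI : ∀ {f g} → PI f → PI g → PI (f ⊛ g)
⊛-PI p q .perm = ⊛-perm p q
⊛-PI {f} {g} p q .pad γ = trans (⊛-∷ f g 0 γ) (trans (C-zero (λ a b → (∂ a f ⊛ ∂ b g) γ)) (⊛-cong (pad p) (pad q) γ))

below-split : ∀ γ → All (λ α → sum α ℕ.+ sum (zipWith _∸_ γ α) ≡ sum γ) (below γ)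
below-split []      = refl ∷ []
below-split (x ∷ γ) = Allₚ.concat⁺ (Allₚ.map⁺ (Allₚ.applyUpTo⁺₁ id (suc x) (λ {i} i<x →
  Allₚ.map⁺ (All.map (λ {α} e → trans (ℕ-interchange i (sum α) (x ∸ i) _)
    (cong₂ ℕ._+_ (ℕₚ.m+[n∸m]≡n (s≤s⁻¹ i<x)) e)) (below-split γ)))))

⊛-homogeneous : ∀ {p q f g} → Homogeneous p f → Homogeneous q g → Homogeneous (p ℕ.+ q) (f ⊛ g)
⊛-homogeneous {p} {q} {f} {g} hf hg γ ne = ∑-0-All (All.map term (below-split γ))
  where
  term : ∀ {α} → sum α ℕ.+ sum (zipWith _∸_ γ α) ≡ sum γ → f α * g (zipWith _∸_ γ α) ≡ + 0
  term {α} e with sum α ≟ p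
  ... | no  n    = cong (_* g (zipWith _∸_ γ α)) (hf α n)
  ... | yes refl = trans (cong (f α *_) (hg _ (λ r → ne (trans (sym e) (cong (sum α ℕ.+_) r))))) (ℤₚ.*-zeroʳ (f α))

Homogeneous-Sym : ∀ {d f} → PI f → Homogeneous d f → Sym f
Homogeneous-Sym p h = PI⇒Sym p (λ γ l → h γ (ℕₚ.<⇒≢ l ∘ sym))

⊛-one : ∀ f → (f ⊛ one) ≈ f
⊛-one f []      = trans (⊛-[] f one) (ℤₚ.*-identityʳ (f []))
⊛-one f (c ∷ γ) = trans (⊛-∷ f one c γ)
  (trans (C-last c (λ a b → (∂ a f ⊛ ∂ b one) γ) (λ a b → lin-0 (⊛-linʳ (∂ a f) γ) (λ _ → refl))) (⊛-one (∂ c f) γ))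

hS-homogeneous : ∀ j → Homogeneous j (hS j)
hS-homogeneous j γ = ind-no

hProd-PI : ∀ ρ → PI (hProd ρ)
hProd-PI []      = PI-hS 0
hProd-PI (j ∷ ρ) = ⊛-PI (PI-hS j) (hProd-PI ρ)

hProd-homogeneous : ∀ ρ → Homogeneous (sum ρ) (hProd ρ)
hProd-homogeneous []      = hS-homogeneous 0
hProd-homogeneous (j ∷ ρ) = ⊛-homogeneous {j} {sum ρ} (hS-homogeneous j) (hProd-homogeneous ρ)

hProd-Sym : ∀ ρ → Sym (hProd ρ)
hProd-Sym ρ = Homogeneous-Sym (hProd-PI ρ) (hProd-homogeneous ρ)

-- Spanning by products of complete functions

H : Series → Set
H f = ∃[ ρ ] (f ≈ hProd ρ)

T-H : ∀ y {f} → Span H f → Span H (T y f)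
T-H y = Span-bind (T-lin y) (λ {f} (ρ , e) → eq (λ γ → sym (resp (T-lin y γ) e)) (go y ρ))
  where
  go : ∀ y ρ → Span H (T y (hProd ρ))
  go (+ zero)   ρ = gen (0 ∷ ρ , λ γ → sym (hS⊛≈T 0 (hProd ρ) γ))
  go (+ suc n)  ρ = eq (λ γ → sym (T-pos n (hProd ρ) γ)) zero
  go -[1+ n ]   ρ = gen (suc n ∷ ρ , λ γ → sym (hS⊛≈T (suc n) (hProd ρ) γ))

-- `W-T` moves RS past one complete function after another until it meets 1, and RS_a 1 = h_a.
W-hProd : ∀ ρ z → Span H (W z (hProd ρ))
W-hProd [] z = eq (λ γ → sym (W-one z γ)) (go z)
  where
  go : ∀ z → Span H (hz z)
  go (+ zero)  = gen ([] , λ γ → sym (hS≈hz 0 γ))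
  go (+ suc n) = eq (λ γ → sym (up-pos n (sum γ))) zero
  go -[1+ n ]  = gen (suc n ∷ [] , λ γ → sym (trans (⊛-one (hS (suc n)) γ) (hS≈hz (suc n) γ)))
W-hProd (j ∷ ρ) z = eq (λ γ → sym (trans (resp (W-lin z γ) (hS⊛≈T j (hProd ρ))) (W-T z (- + j) (hProd-PI ρ) γ)))
  (plus (T-H (- + j) (W-hProd ρ z)) (eq (λ γ → ℤₚ.-1*i≡-i _)
    (scale (- + 1) (T-H (ℤ.suc (- + j)) (W-hProd ρ (ℤ.pred z))))))

W-H : ∀ z {f} → Span H f → Span H (W z f)
W-H z = Span-bind (W-lin z) (λ (ρ , e) → eq (λ γ → sym (resp (W-lin z γ) e)) (W-hProd ρ z))

D-H : ∀ ℓ → Span H (D ℓ)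
D-H []      = gen ([] , λ _ → refl)
D-H (x ∷ ℓ) = W-H (dif (length ℓ) x) (D-H ℓ)

Sym⇒H-span : ∀ {f} → Sym f → Span H f
Sym⇒H-span s = Span-bind eval-lin (λ (ν , _ , e) → eq (λ γ → sym (e γ)) (D-H (shift ν))) (Sym⇒Schur-span s)

H-span-Sym : ∀ {f} → Span H f → Sym f
H-span-Sym s = PI⇒Sym (pi s) (proj₂ (bound s))
  where
  pi : ∀ {f} → Span H f → PI f
  pi (gen (ρ , e))   = PI-resp (λ γ → sym (e γ)) (hProd-PI ρ)
  pi zero            = record { perm = λ _ → refl ; pad = λ _ → refl }
  pi (plus s t)      = PI-⊕ (pi s) (pi t)
  pi (scale c s)     = PI-· c (pi s)
  pi (eq e s)        = PI-resp e (pi s)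
  bound : ∀ {f} → Span H f → ∃[ d ] Bounded d f
  bound (gen (ρ , e)) = sum ρ , λ γ l → trans (e γ) (hProd-homogeneous ρ γ (ℕₚ.<⇒≢ l ∘ sym))
  bound zero          = 0 , λ _ _ → refl
  bound (plus s t)    with bound s | bound t
  ... | d , b | d′ , b′ = d ℕ.⊔ d′ , λ γ l → cong₂ _+_ (b γ (ℕₚ.≤-<-trans (ℕₚ.m≤m⊔n d d′) l)) (b′ γ (ℕₚ.≤-<-trans (ℕₚ.m≤n⊔m d d′) l))
  bound (scale c s)   with bound s
  ... | d , b = d , λ γ l → trans (cong (c *_) (b γ l)) (ℤₚ.*-zeroʳ c)
  bound (eq e s)      with bound s
  ... | d , b = d , λ γ l → trans (sym (e γ)) (b γ l)

-- The coefficient of x^γ in h_ρ counts nonnegative integer matrices with row sums ρ and column sums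
-- γ; β is the first column.
hProd-∂ : ∀ ρ c γ → hProd ρ (c ∷ γ) ≡ ∑ (below ρ) (λ β → ind (sum β) c * hProd (zipWith _∸_ ρ β) γ)
hProd-∂ []      zero    γ = sym (trans (ℤₚ.+-identityʳ _) (ℤₚ.*-identityˡ (one γ)))
hProd-∂ []      (suc c) γ = refl
hProd-∂ (j ∷ ρ) c γ = trans (hS⊛≈T j (hProd ρ) (c ∷ γ)) (trans (go j c) (sym (∑-below-∷ j ρ _)))
  where
  R : ℕ → ℕ → ℕ → ℤ
  R j c a = ∑ (below ρ) (λ β → ind (a ℕ.+ sum β) c * hProd (j ∸ a ∷ zipWith _∸_ ρ β) γ)
  top : ∀ j c → T (- + j) (∂ c (hProd ρ)) γ ≡ R j c 0
  top j c = begin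
    T (- + j) (∂ c (hProd ρ)) γ
      ≡⟨ resp (T-lin (- + j) γ) (hProd-∂ ρ c) ⟩
    T (- + j) (λ δ → ∑ (below ρ) (λ β → ind (sum β) c * hProd (zipWith _∸_ ρ β) δ)) γ
      ≡⟨ lin-∑* (T-lin (- + j) γ) (below ρ) (λ β → ind (sum β) c) (λ β → hProd (zipWith _∸_ ρ β)) ⟩
    ∑ (below ρ) (λ β → ind (sum β) c * T (- + j) (hProd (zipWith _∸_ ρ β)) γ)
      ≡⟨ ∑-cong (below ρ) (λ β → cong (ind (sum β) c *_) (sym (hS⊛≈T j (hProd (zipWith _∸_ ρ β)) γ))) ⟩
    R j c 0 ∎
  single : ∀ j c → (∀ a → R j c (suc a) ≡ + 0) → R j c 0 ≡ ∑ (upTo (suc j)) (R j c)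
  single j c v = sym (trans (∑-upTo-suc j (R j c)) (trans (+ˡ (R j c 0) (∑-0 (upTo j) v)) (ℤₚ.+-identityʳ _)))
  go : ∀ j c → ∂ c (T (- + j) (hProd ρ)) γ ≡ ∑ (upTo (suc j)) (R j c)
  go j zero = trans (Op-∂0 φT-lin (- + j) (hProd ρ) γ) (trans (top j 0)
    (single j 0 (λ a → ∑-0 (below ρ) (λ β → refl))))
  go zero (suc c) = begin
    ∂ (suc c) (T (+ 0) (hProd ρ)) γ                                       ≡⟨ Op-shift φT-lin c (+ 0) (hProd ρ) γ ⟩
    T (+ 0) (∂ (suc c) (hProd ρ)) γ + ∂ c (T (+ 1) (hProd ρ)) γ           ≡⟨ cong₂ _+_ (top 0 (suc c)) (T-pos 0 (hProd ρ) (c ∷ γ)) ⟩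
    ∑ (upTo 1) (R 0 (suc c))                                              ∎
  go (suc j) (suc c) = begin
    ∂ (suc c) (T (- + suc j) (hProd ρ)) γ
      ≡⟨ Op-shift φT-lin c (- + suc j) (hProd ρ) γ ⟩
    T (- + suc j) (∂ (suc c) (hProd ρ)) γ + ∂ c (T (ℤ.suc (- + suc j)) (hProd ρ)) γ
      ≡⟨ cong₂ _+_ (top (suc j) (suc c)) (trans (cong (λ z → ∂ c (T z (hProd ρ)) γ) (suc-neg j)) (go j c)) ⟩
    R (suc j) (suc c) 0 + ∑ (upTo (suc j)) (R j c)
      ≡⟨ sym (∑-upTo-suc (suc j) (R (suc j) (suc c))) ⟩
    ∑ (upTo (suc (suc j))) (R (suc j) (suc c)) ∎

-- Transposition of these matrices: the product on the left and `hProd-∂` on the right peel off the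
-- same line β.
hProd-transpose : ∀ γ ρ → hProd γ ρ ≡ hProd ρ γ
hProd-transpose []      ρ = sym (const ρ)
  where
  const : ∀ ρ → hProd ρ [] ≡ ind (sum ρ) 0
  const []          = refl
  const (zero ∷ ρ)  = trans (⊛-[] (hS 0) (hProd ρ)) (trans (ℤₚ.*-identityˡ (hProd ρ [])) (const ρ))
  const (suc j ∷ ρ) = ⊛-[] (hS (suc j)) (hProd ρ)
hProd-transpose (c ∷ γ) ρ = trans
  (∑-cong (below ρ) (λ β → cong (ind (sum β) c *_) (hProd-transpose γ (zipWith _∸_ ρ β))))
  (sym (hProd-∂ ρ c γ))

-- Monomial symmetric functions

insertDesc-↭ : ∀ x l → insertDesc x l ↭ x ∷ l
insertDesc-↭ x [] = ↭-refl
insertDesc-↭ x (y ∷ ys) with y ≤ᵇ x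
... | true  = ↭-refl
... | false = ↭-trans (prep y (insertDesc-↭ x ys)) (swap y x ↭-refl)

insertDesc-head : ∀ x l {m} → x ≤ m → headℕ l ≤ m → headℕ (insertDesc x l) ≤ m
insertDesc-head x [] p q = p
insertDesc-head x (y ∷ ys) p q with y ≤ᵇ x
... | true  = p
... | false = q

insertDesc-Desc : ∀ x l → Desc l → Desc (insertDesc x l)
insertDesc-Desc x [] d = [-]
insertDesc-Desc x (y ∷ ys) d with y ≤ᵇ x in e
... | true  = ℕₚ.≤ᵇ⇒≤ y x (subst Data.Bool.T (sym e) _) ∷ d
... | false = Desc-∷ (insertDesc-head x ys (ℕₚ.≰⇒≥ (λ le → subst Data.Bool.T e (ℕₚ.≤⇒≤ᵇ le))) (Desc-head d))
                     (insertDesc-Desc x ys (Desc-tail d))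

insertDesc-∷ : ∀ x l → headℕ l ≤ x → insertDesc x l ≡ x ∷ l
insertDesc-∷ x []       h = refl
insertDesc-∷ x (y ∷ ys) h with y ≤ᵇ x in e
... | true  = refl
... | false = ⊥-elim (subst Data.Bool.T e (ℕₚ.≤⇒≤ᵇ h))

partitionOf : List ℕ → List ℕ
partitionOf γ = sortDesc (filter (λ x → 0 <? x) γ)

PI-partitionOf : ∀ γ {f} → PI f → f (partitionOf γ) ≡ f γ
PI-partitionOf []          p = refl
PI-partitionOf (zero ∷ γ)  p = trans (PI-partitionOf γ p) (sym (pad p γ))
PI-partitionOf (suc x ∷ γ) p = trans (perm p (insertDesc-↭ (suc x) (partitionOf γ)))
                                     (PI-partitionOf γ (PI-∂ (suc x) p))

partitionOf-partition : ∀ γ → IsPartition (partitionOf γ)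
partitionOf-partition []          = [] , []
partitionOf-partition (zero ∷ γ)  = partitionOf-partition γ
partitionOf-partition (suc x ∷ γ) with partitionOf-partition γ
... | d , p = insertDesc-Desc (suc x) _ d , ↭ₚ.All-resp-↭ (↭-sym (insertDesc-↭ (suc x) _)) (s≤s z≤n ∷ p)

partitionOf-id : ∀ ν → IsPartition ν → partitionOf ν ≡ ν
partitionOf-id []          _             = refl
partitionOf-id (suc x ∷ ν) (d , _ ∷ p) = trans (cong (insertDesc (suc x)) (partitionOf-id ν (Desc-tail d , p)))
                                                 (insertDesc-∷ (suc x) ν (Desc-head d))

δ : List ℕ → List ℕ → ℤ
δ ν μ = boolℤ (does (Lₚ.≡-dec _≟_ ν μ))

boolℤ-∧ : ∀ b c → boolℤ (b ∧ c) ≡ boolℤ b * boolℤ c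
boolℤ-∧ true  true  = refl
boolℤ-∧ true  false = refl
boolℤ-∧ false c     = refl

δ-∷ : ∀ x ν y μ → δ (x ∷ ν) (y ∷ μ) ≡ ind x y * δ ν μ
δ-∷ x ν y μ = boolℤ-∧ (x ≡ᵇ y) _

-- Summing against `δ ν` expresses that the enumeration meets ν exactly once, or never if its degree
-- is wrong. Only the branch whose first part is that of ν contributes.
∑-partsFuel : ∀ fuel n m ν (G : List ℕ → ℤ) → n ≤ fuel → IsPartition ν → headℕ ν ≤ m →
              ∑ (partsFuel fuel n m) (λ μ → δ ν μ * G μ) ≡ ind (sum ν) n * G ν
∑-partsFuel fuel zero m []          G l p h = ℤₚ.+-identityʳ _
∑-partsFuel fuel zero m (suc x ∷ ν) G l p h = refl
∑-partsFuel fuel zero m (zero ∷ ν)  G l (_ , () ∷ _) h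
∑-partsFuel (suc fuel) (suc n) m ν G l p h = begin
  ∑ (partsFuel (suc fuel) (suc n) m) (λ μ → δ ν μ * G μ)
    ≡⟨ ∑-concatMap (λ j → map (j ∷_) (partsFuel fuel (suc n ∸ j) j)) (map suc (upTo (m ⊓ suc n))) _ ⟩
  ∑ (map suc (upTo (m ⊓ suc n))) (λ j → ∑ (map (j ∷_) (partsFuel fuel (suc n ∸ j) j)) (λ μ → δ ν μ * G μ))
    ≡⟨ ∑-map suc (upTo (m ⊓ suc n)) _ ⟩
  ∑ (upTo (m ⊓ suc n)) (λ i → ∑ (map (suc i ∷_) (partsFuel fuel (n ∸ i) (suc i))) (λ μ → δ ν μ * G μ))
    ≡⟨ ∑-cong (upTo (m ⊓ suc n)) (λ i → ∑-map (suc i ∷_) (partsFuel fuel (n ∸ i) (suc i)) (λ μ → δ ν μ * G μ)) ⟩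
  ∑ (upTo (m ⊓ suc n)) (λ i → ∑ (partsFuel fuel (n ∸ i) (suc i)) (λ μ → δ ν (suc i ∷ μ) * G (suc i ∷ μ)))
    ≡⟨ go ν p h ⟩
  ind (sum ν) (suc n) * G ν ∎
  where
  go : ∀ ν → IsPartition ν → headℕ ν ≤ m →
       ∑ (upTo (m ⊓ suc n)) (λ i → ∑ (partsFuel fuel (n ∸ i) (suc i)) (λ μ → δ ν (suc i ∷ μ) * G (suc i ∷ μ)))
         ≡ ind (sum ν) (suc n) * G ν
  go [] p h = ∑-0 (upTo (m ⊓ suc n)) (λ i → ∑-zero (partsFuel fuel (n ∸ i) (suc i)))
  go (zero ∷ ν) (_ , () ∷ _) h
  go (suc y ∷ ν) (d , _ ∷ pν) h = trans (∑-cong (upTo (m ⊓ suc n)) inner) (cases (y <? m ⊓ suc n))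
    where
    Z : ℕ → ℤ
    Z i = ∑ (partsFuel fuel (n ∸ i) (suc i)) (λ μ → δ ν μ * G (suc i ∷ μ))
    inner : ∀ i → ∑ (partsFuel fuel (n ∸ i) (suc i)) (λ μ → δ (suc y ∷ ν) (suc i ∷ μ) * G (suc i ∷ μ)) ≡ ind y i * Z i
    inner i = trans (∑-cong (partsFuel fuel (n ∸ i) (suc i)) (λ μ →
        trans (cong (_* G (suc i ∷ μ)) (δ-∷ (suc y) ν (suc i) μ)) (ℤₚ.*-assoc (ind y i) (δ ν μ) (G (suc i ∷ μ)))))
      (∑-*ˡ (ind y i) (partsFuel fuel (n ∸ i) (suc i)) (λ μ → δ ν μ * G (suc i ∷ μ)))
    cases : Dec (y < m ⊓ suc n) →
            ∑ (upTo (m ⊓ suc n)) (λ i → ind y i * Z i) ≡ ind (suc y ℕ.+ sum ν) (suc n) * G (suc y ∷ ν)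
    cases (yes y<) = begin
      ∑ (upTo (m ⊓ suc n)) (λ i → ind y i * Z i)
        ≡⟨ ∑-upTo-single (m ⊓ suc n) y y< (λ i ne → ind-no-* (Z i) (ne ∘ sym)) ⟩
      ind y y * Z y
        ≡⟨ ind-yes-* (Z y) (refl {x = y}) ⟩
      Z y
        ≡⟨ ∑-partsFuel fuel (n ∸ y) (suc y) ν (λ μ → G (suc y ∷ μ)) (ℕₚ.≤-trans (ℕₚ.m∸n≤m n y) (s≤s⁻¹ l))
             (Desc-tail d , pν) (Desc-head d) ⟩
      ind (sum ν) (n ∸ y) * G (suc y ∷ ν)
        ≡⟨ cong (_* G (suc y ∷ ν)) (ind-cong
             (λ e → trans (cong (y ℕ.+_) e) (ℕₚ.m+[n∸m]≡n y≤n))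
             (λ e → trans (sym (ℕₚ.m+n∸m≡n y (sum ν))) (cong (_∸ y) e))) ⟩
      ind (y ℕ.+ sum ν) n * G (suc y ∷ ν) ∎
      where
      y≤n : y ≤ n
      y≤n = s≤s⁻¹ (ℕₚ.≤-trans y< (ℕₚ.m⊓n≤n m (suc n)))
    cases (no y≮) = trans
      (∑-upTo-0 (m ⊓ suc n) (λ i i< → ind-no-* (Z i) (λ e → y≮ (subst (_< m ⊓ suc n) (sym e) i<))))
      (sym (ind-no-* (G (suc y ∷ ν)) (λ e → y≮ (ℕₚ.⊓-glb h
        (s≤s (subst (y ≤_) (ℕₚ.suc-injective e) (ℕₚ.m≤m+n y (sum ν))))))))

partsFuel-All : ∀ fuel n m → n ≤ fuel → All (λ μ → IsPartition μ × sum μ ≡ n × headℕ μ ≤ m) (partsFuel fuel n m)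
partsFuel-All fuel zero m l = (([] , []) , refl , z≤n) ∷ []
partsFuel-All (suc fuel) (suc n) m l = Allₚ.concat⁺ (Allₚ.map⁺ (Allₚ.map⁺ (Allₚ.applyUpTo⁺₁ id (m ⊓ suc n) (λ {i} i< →
  Allₚ.map⁺ (All.map (λ ((d , p) , s , h) →
      (Desc-∷ h d , s≤s z≤n ∷ p)
    , cong suc (trans (cong (i ℕ.+_) s) (ℕₚ.m+[n∸m]≡n (s≤s⁻¹ (ℕₚ.≤-trans i< (ℕₚ.m⊓n≤n m (suc n))))))
    , ℕₚ.≤-trans i< (ℕₚ.m⊓n≤m m (suc n)))
    (partsFuel-All fuel (n ∸ i) (suc i) (ℕₚ.≤-trans (ℕₚ.m∸n≤m n i) (s≤s⁻¹ l))))))))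

partitionsOf-All : ∀ n → All (λ μ → IsPartition μ × sum μ ≡ n) (partitionsOf n)
partitionsOf-All n = All.map (λ (p , s , _) → p , s) (partsFuel-All n n n ℕₚ.≤-refl)

δ-no : ∀ {ν μ} → ν ≢ μ → δ ν μ ≡ + 0
δ-no {ν} {μ} ne = cong boolℤ (dec-false (Lₚ.≡-dec _≟_ ν μ) ne)

∑-partitionsOf : ∀ n ν (G : List ℕ → ℤ) → IsPartition ν →
                 ∑ (partitionsOf n) (λ μ → δ ν μ * G μ) ≡ ind (sum ν) n * G ν
∑-partitionsOf n ν G p with headℕ ν ℕ.≤? n
... | yes h = ∑-partsFuel n n n ν G ℕₚ.≤-refl p h
... | no  h = trans
  (∑-0-All (All.map (λ {μ} (_ , s) → cong (_* G μ) (δ-no {ν} {μ} (λ e → sum≢n (trans (cong sum e) s)))) (partitionsOf-All n)))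
  (sym (ind-no-* (G ν) sum≢n))
  where
  head≤sum : ∀ ν → headℕ ν ≤ sum ν
  head≤sum []      = z≤n
  head≤sum (x ∷ ν) = ℕₚ.m≤m+n x (sum ν)
  sum≢n : sum ν ≢ n
  sum≢n e = h (subst (headℕ ν ≤_) e (head≤sum ν))

partitionsUpTo : ℕ → List (List ℕ)
partitionsUpTo d = concatMap partitionsOf (upTo (suc d))

partitionsUpTo-All : ∀ d → All IsPartition (partitionsUpTo d)
partitionsUpTo-All d = Allₚ.concat⁺ (Allₚ.map⁺
  (All.universal (λ n → All.map proj₁ (partitionsOf-All n)) (upTo (suc d))))

monomial-expansion : ∀ d {f} → PI f → Bounded d f → ∀ γ →
                     f γ ≡ ∑ (partitionsUpTo d) (λ μ → f μ * monS μ γ)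
monomial-expansion d {f} p b γ = sym (begin
  ∑ (partitionsUpTo d) (λ μ → f μ * δ ν μ)
    ≡⟨ ∑-concatMap partitionsOf (upTo (suc d)) (λ μ → f μ * δ ν μ) ⟩
  ∑ (upTo (suc d)) (λ n → ∑ (partitionsOf n) (λ μ → f μ * δ ν μ))
    ≡⟨ ∑-cong (upTo (suc d)) (λ n → trans
         (∑-cong (partitionsOf n) (λ μ → ℤₚ.*-comm (f μ) (δ ν μ)))
         (∑-partitionsOf n ν f (partitionOf-partition γ))) ⟩
  ∑ (upTo (suc d)) (λ n → ind (sum ν) n * f ν)
    ≡⟨ cases (sum ν ℕ.≤? d) ⟩
  f ν
    ≡⟨ PI-partitionOf γ p ⟩
  f γ ∎)
  where
  ν = partitionOf γ
  cases : Dec (sum ν ≤ d) → ∑ (upTo (suc d)) (λ n → ind (sum ν) n * f ν) ≡ f ν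
  cases (yes l) = trans (∑-upTo-single (suc d) (sum ν) {λ n → ind (sum ν) n * f ν} (s≤s l) (λ i ne → ind-no-* (f ν) (ne ∘ sym)))
                        (ind-yes-* (f ν) (refl {x = sum ν}))
  cases (no  g) = trans (∑-0 (upTo (suc d)) (λ n → trans (cong (ind (sum ν) n *_) fν≡0) (ℤₚ.*-zeroʳ (ind (sum ν) n)))) (sym fν≡0)
    where
    fν≡0 : f ν ≡ + 0
    fν≡0 = b ν (ℕₚ.≰⇒> g)

-- The Hall pairing

-- An additive map to the integers is linear over them; the pairing is specified by additivity.
additive⇒Lin : ∀ {L : Series → ℤ} → (∀ {f g} → f ≈ g → L f ≡ L g) → (∀ f g → L (f ⊕ g) ≡ L f + L g) → Lin L
additive⇒Lin {L} r a = record { resp = r ; add = a ; scl = scale-ℤ }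
  where
  L0 : L zeroS ≡ + 0
  L0 = trans (sym (arrange (L zeroS))) (trans (cong (_+ - L zeroS) (sym (a zeroS zeroS))) (ℤₚ.+-inverseʳ (L zeroS)))
    where
    arrange : ∀ x → x + x + - x ≡ x
    arrange = solve-∀
  scale-ℕ : ∀ n f → L ((+ n) · f) ≡ + n * L f
  scale-ℕ zero    f = L0
  scale-ℕ (suc n) f = begin
    L ((+ suc n) · f)       ≡⟨ r (λ γ → dist (+ n) (f γ)) ⟩
    L (f ⊕ ((+ n) · f))     ≡⟨ a f ((+ n) · f) ⟩
    L f + L ((+ n) · f)     ≡⟨ +ˡ (L f) (scale-ℕ n f) ⟩
    L f + + n * L f       ≡⟨ sym (dist (+ n) (L f)) ⟩
    + suc n * L f         ∎
    where
    dist : ∀ m x → (+ 1 + m) * x ≡ x + m * x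
    dist = solve-∀
  scale-ℤ : ∀ c f → L (c · f) ≡ c * L f
  scale-ℤ (+ n)    f = scale-ℕ n f
  scale-ℤ -[1+ n ] f = begin
    L (-[1+ n ] · f)                                          ≡⟨ sym (arrange (L (-[1+ n ] · f)) (L ((+ suc n) · f))) ⟩
    L (-[1+ n ] · f) + L ((+ suc n) · f) + - L ((+ suc n) · f)    ≡⟨ cong₂ (λ x y → x + - y) cancel (scale-ℕ (suc n) f) ⟩
    + 0 + - (+ suc n * L f)                                   ≡⟨ ℤₚ.+-identityˡ _ ⟩
    - (+ suc n * L f)                                         ≡⟨ ℤₚ.neg-distribˡ-* (+ suc n) (L f) ⟩
    -[1+ n ] * L f                                            ∎
    where
    arrange : ∀ x y → x + y + - y ≡ x
    arrange = solve-∀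
    cancel : L (-[1+ n ] · f) + L ((+ suc n) · f) ≡ + 0
    cancel = trans (sym (a (-[1+ n ] · f) ((+ suc n) · f)))
      (trans (r (λ γ → trans (sym (ℤₚ.*-distribʳ-+ (f γ) -[1+ n ] (+ suc n)))
                             (cong (_* f γ) (ℤₚ.+-inverseˡ (+ suc n))))) L0)

module Hall (ip : ℕ → Series → Series → ℤ) (hall : IsHallPairing ip) where
  open IsHallPairing hall

  ip-linˡ : ∀ n g → Lin (λ f → ip n f g)
  ip-linˡ n g = additive⇒Lin (λ e → respects n e (λ _ → refl)) (λ f f′ → addˡ n f f′ g)

  ip-linʳ : ∀ n f → Lin (ip n f)
  ip-linʳ n f = additive⇒Lin (λ e → respects n (λ _ → refl) e) (addʳ n f)

  -- Expanding f in monomial functions, the defining duality picks out the coefficient at ν.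
  ip-partition : ∀ n ν → IsPartition ν → ∀ {f} → Sym f → ip n (hProd ν) f ≡ ind (sum ν) n * f ν
  ip-partition n ν p {f} s with Sym.bounded s
  ... | d , b = begin
    ip n (hProd ν) f
      ≡⟨ resp (ip-linʳ n (hProd ν)) expand ⟩
    ip n (hProd ν) (λ γ → ∑ (partitionsUpTo d) (λ μ → f μ * monS μ γ))
      ≡⟨ lin-∑* (ip-linʳ n (hProd ν)) (partitionsUpTo d) f monS ⟩
    ∑ (partitionsUpTo d) (λ μ → f μ * ip n (hProd ν) (monS μ))
      ≡⟨ ∑-cong-All (All.map (λ {μ} q → trans (cong (f μ *_) (trans (basis n ν μ p q) (boolℤ-∧ _ (sum ν ≡ᵇ n))))
           (arrange (f μ) (δ ν μ) (ind (sum ν) n))) (partitionsUpTo-All d)) ⟩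
    ∑ (partitionsUpTo d) (λ μ → ind (sum ν) n * (f μ * δ ν μ))
      ≡⟨ ∑-*ˡ (ind (sum ν) n) (partitionsUpTo d) (λ μ → f μ * δ ν μ) ⟩
    ind (sum ν) n * ∑ (partitionsUpTo d) (λ μ → f μ * δ ν μ)
      ≡⟨ cong (λ κ → ind (sum ν) n * ∑ (partitionsUpTo d) (λ μ → f μ * δ κ μ)) (sym (partitionOf-id ν p)) ⟩
    ind (sum ν) n * ∑ (partitionsUpTo d) (λ μ → f μ * monS μ ν)
      ≡⟨ cong (ind (sum ν) n *_) (sym (expand ν)) ⟩
    ind (sum ν) n * f ν ∎
    where
    expand = monomial-expansion d (Sym⇒PI s) b
    arrange : ∀ a b c → a * (b * c) ≡ c * (a * b)
    arrange = solve-∀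

  ip-hˡ : ∀ n ρ {f} → Sym f → ip n (hProd ρ) f ≡ ind (sum ρ) n * f ρ
  ip-hˡ n ρ {f} s = begin
    ip n (hProd ρ) f
      -- The coefficient of h_ρ at γ is that of the symmetric function h_γ at ρ, so zeros and order
      -- in ρ do not matter.
      ≡⟨ resp (ip-linˡ n f) (λ γ → trans (sym (hProd-transpose γ ρ))
           (trans (sym (PI-partitionOf ρ (hProd-PI γ))) (hProd-transpose γ (partitionOf ρ)))) ⟩
    ip n (hProd (partitionOf ρ)) f
      ≡⟨ ip-partition n (partitionOf ρ) (partitionOf-partition ρ) s ⟩
    ind (sum (partitionOf ρ)) n * f (partitionOf ρ)
      ≡⟨ cong₂ (λ k x → ind k n * x) (sum-partitionOf ρ) (PI-partitionOf ρ (Sym⇒PI s)) ⟩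
    ind (sum ρ) n * f ρ ∎
    where
    sum-partitionOf : ∀ ρ → sum (partitionOf ρ) ≡ sum ρ
    sum-partitionOf []          = refl
    sum-partitionOf (zero ∷ ρ)  = sum-partitionOf ρ
    sum-partitionOf (suc x ∷ ρ) = trans (sum-↭ (insertDesc-↭ (suc x) (partitionOf ρ))) (cong (suc x ℕ.+_) (sum-partitionOf ρ))

  -- Symmetry of the pairing is derived here: on the spanning products it is the matrix symmetry
  -- `hProd-transpose`.
  ip-h : ∀ n ρ {f} → Sym f → ip n f (hProd ρ) ≡ ind (sum ρ) n * f ρ
  ip-h n ρ s = Span-ext (ip-linˡ n (hProd ρ)) (*-lin (ind (sum ρ) n) (eval-lin ρ)) onH (Sym⇒H-span s)
    where
    onH : ∀ {f} → H f → ip n f (hProd ρ) ≡ ind (sum ρ) n * f ρ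
    onH {f} (κ , e) = begin
      ip n f (hProd ρ)               ≡⟨ resp (ip-linˡ n (hProd ρ)) e ⟩
      ip n (hProd κ) (hProd ρ)       ≡⟨ ip-hˡ n κ (hProd-Sym ρ) ⟩
      ind (sum κ) n * hProd ρ κ      ≡⟨ cong (ind (sum κ) n *_) (hProd-transpose ρ κ) ⟩
      ind (sum κ) n * hProd κ ρ      ≡⟨ degrees (sum ρ ≟ sum κ) ⟩
      ind (sum ρ) n * hProd κ ρ      ≡⟨ cong (ind (sum ρ) n *_) (sym (e ρ)) ⟩
      ind (sum ρ) n * f ρ            ∎
      where
      degrees : Dec (sum ρ ≡ sum κ) → ind (sum κ) n * hProd κ ρ ≡ ind (sum ρ) n * hProd κ ρ
      degrees (yes q) = cong (λ k → ind k n * hProd κ ρ) (sym q)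
      degrees (no  q) = trans (cong (ind (sum κ) n *_) v) (trans (ℤₚ.*-zeroʳ (ind (sum κ) n))
        (sym (trans (cong (ind (sum ρ) n *_) v) (ℤₚ.*-zeroʳ (ind (sum ρ) n)))))
        where v = hProd-homogeneous κ ρ q

  ip-sym : ∀ n {f g} → Sym f → Sym g → ip n f g ≡ ip n g f
  ip-sym n {f} {g} s t = Span-ext (ip-linʳ n f) (ip-linˡ n f)
    (λ (ρ , e) → trans (resp (ip-linʳ n f) e) (trans (ip-h n ρ s)
      (trans (sym (ip-hˡ n ρ s)) (sym (resp (ip-linˡ n f) e))))) (Sym⇒H-span t)

  ip-degree : ∀ n d {f g} → Sym f → Homogeneous d f → Sym g → d ≢ n → ip n f g ≡ + 0
  ip-degree n d {f} s h t ne = Span-ext (ip-linʳ n f) zero-lin (λ (ρ , e) →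
    trans (resp (ip-linʳ n f) e) (trans (ip-h n ρ s) (go ρ (sum ρ ≟ n)))) (Sym⇒H-span t)
    where
    go : ∀ ρ → Dec (sum ρ ≡ n) → ind (sum ρ) n * f ρ ≡ + 0
    go ρ (yes q) = trans (cong (ind (sum ρ) n *_) (h ρ (λ r → ne (trans (sym r) q)))) (ℤₚ.*-zeroʳ (ind (sum ρ) n))
    go ρ (no  q) = ind-no-* (f ρ) q

  ∂-Sym : ∀ c {f} → Sym f → Sym (∂ c f)
  ∂-Sym c s = PI⇒Sym (PI-∂ c (Sym⇒PI s)) (λ γ l → proj₂ (Sym.bounded s) (c ∷ γ) (ℕₚ.≤-trans l (ℕₚ.m≤n+m (sum γ) c)))

  -- The pairing of all degrees < N together; it is the full Hall pairing as soon as one argument is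
  -- bounded by degree < N.
  pair : ℕ → Series → Series → ℤ
  pair N f g = ∑ (upTo N) (λ n → ip n f g)

  pair-linˡ : ∀ N g → Lin (λ f → pair N f g)
  pair-linˡ N g = ∑-lin (upTo N) (λ n → ip-linˡ n g)

  pair-linʳ : ∀ N f → Lin (pair N f)
  pair-linʳ N f = ∑-lin (upTo N) (λ n → ip-linʳ n f)

  pair-sym : ∀ N {f g} → Sym f → Sym g → pair N f g ≡ pair N g f
  pair-sym N s t = ∑-cong (upTo N) (λ n → ip-sym n s t)

  record Below (N : ℕ) (u : Series) : Set where
    field
      sym⁺  : Sym u
      vanish : ∀ γ → N ≤ sum γ → u γ ≡ + 0
  open Below

  ∂-Below : ∀ j {N u} → Below N u → Below N (∂ j u)
  ∂-Below j b = record
    { sym⁺ = ∂-Sym j (sym⁺ b) ; vanish = λ γ l → vanish b (j ∷ γ) (ℕₚ.≤-trans l (ℕₚ.m≤n+m (sum γ) j)) }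

  pair-h : ∀ N ρ {u} → Below N u → pair N (hProd ρ) u ≡ u ρ
  pair-h N ρ {u} b = trans (∑-cong (upTo N) (λ n → ip-hˡ n ρ (sym⁺ b))) (cases (sum ρ <? N))
    where
    cases : Dec (sum ρ < N) → ∑ (upTo N) (λ n → ind (sum ρ) n * u ρ) ≡ u ρ
    cases (yes l) = trans (∑-upTo-single N (sum ρ) {λ n → ind (sum ρ) n * u ρ} l (λ i ne → ind-no-* (u ρ) (ne ∘ sym)))
                          (ind-yes-* (u ρ) (refl {x = sum ρ}))
    cases (no  g) = trans (∑-0 (upTo N) (λ n → trans (cong (ind (sum ρ) n *_) v) (ℤₚ.*-zeroʳ (ind (sum ρ) n)))) (sym v)
      where v = vanish b ρ (ℕₚ.≮⇒≥ g)

  hS-adjoint : ∀ N j {g u} → Sym g → Below N u → pair N (hS j ⊛ g) u ≡ pair N g (∂ j u)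
  hS-adjoint N j {g} {u} s b = Span-ext
    (∘-lin (pair-linˡ N u) (⊛-linʳ (hS j))) (pair-linˡ N (∂ j u)) (λ {f} (ρ , e) → begin
      pair N (hS j ⊛ f) u           ≡⟨ resp (pair-linˡ N u) (λ γ → resp (⊛-linʳ (hS j) γ) e) ⟩
      pair N (hProd (j ∷ ρ)) u      ≡⟨ pair-h N (j ∷ ρ) b ⟩
      u (j ∷ ρ)                     ≡⟨ sym (pair-h N ρ (∂-Below j b)) ⟩
      pair N (hProd ρ) (∂ j u)      ≡⟨ sym (resp (pair-linˡ N (∂ j u)) e) ⟩
      pair N f (∂ j u)              ∎) (Sym⇒H-span s)

  -- RS_x is adjoint to Σ_i (-1)^i e_i h_{x+i}^⊥; on u with ∂ c u = 0 for c > x only i = 0 contributes.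
  W-adjoint : ∀ N x {g u} → Sym g → Below N u → (∀ c → x < c → ∂ c u ≈ zeroS) →
              pair N (W (- + x) g) u ≡ pair N g (∂ x u)
  W-adjoint N x {g} {u} s b v = Span-ext
    (∘-lin (pair-linˡ N u) (W-lin (- + x))) (pair-linˡ N (∂ x u))
    (λ {f} (ρ , e) → trans (resp (pair-linˡ N u) (λ γ → resp (W-lin (- + x) γ) e))
                       (trans (go ρ x b v) (sym (resp (pair-linˡ N (∂ x u)) e))))
    (Sym⇒H-span s)
    where
    neg-pred : ∀ x → ℤ.pred (- + x) ≡ - + suc x
    neg-pred zero    = refl
    neg-pred (suc x) = refl
    adjT : ∀ j {g u} → Span H g → Below N u → pair N (T (- + j) g) u ≡ pair N g (∂ j u)
    adjT j {g} {u} s b = trans (resp (pair-linˡ N u) (λ γ → sym (hS⊛≈T j g γ))) (hS-adjoint N j (H-span-Sym s) b)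
    go : ∀ ρ x {u} → Below N u → (∀ c → x < c → ∂ c u ≈ zeroS) →
         pair N (W (- + x) (hProd ρ)) u ≡ pair N (hProd ρ) (∂ x u)
    -- The second term of `W-T`. Once h_{j-1} is moved to the other side, RS_{x+1} becomes
    -- `∂ (suc x)`, which annihilates u.
    lower : ∀ j ρ x {u} → Below N u → (∀ c → x < c → ∂ c u ≈ zeroS) →
            pair N (T (ℤ.suc (- + j)) (W (ℤ.pred (- + x)) (hProd ρ))) u ≡ + 0
    lower zero    ρ x {u} b v = lin-0 (pair-linˡ N u) (T-pos 0 (W (ℤ.pred (- + x)) (hProd ρ)))
    lower (suc j) ρ x {u} b v = begin
      pair N (T (ℤ.suc (- + suc j)) (W (ℤ.pred (- + x)) (hProd ρ))) u
        ≡⟨ cong₂ (λ y z → pair N (T y (W z (hProd ρ))) u) (suc-neg j) (neg-pred x) ⟩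
      pair N (T (- + j) (W (- + suc x) (hProd ρ))) u
        ≡⟨ adjT j (W-hProd ρ (- + suc x)) b ⟩
      pair N (W (- + suc x) (hProd ρ)) (∂ j u)
        ≡⟨ go ρ (suc x) (∂-Below j b) (λ c l γ → trans (PI-∂∂ (Sym⇒PI (sym⁺ b)) c j γ) (v c (ℕₚ.<-trans (ℕₚ.n<1+n x) l) (j ∷ γ))) ⟩
      pair N (hProd ρ) (∂ (suc x) (∂ j u))
        ≡⟨ lin-0 (pair-linʳ N (hProd ρ)) (λ γ → trans (PI-∂∂ (Sym⇒PI (sym⁺ b)) (suc x) j γ) (v (suc x) ℕₚ.≤-refl (j ∷ γ))) ⟩
      + 0 ∎
    go [] x {u} b v = begin
      pair N (W (- + x) one) u   ≡⟨ resp (pair-linˡ N u) (λ γ → trans (W-one (- + x) γ)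
                                      (trans (sym (hS≈hz x γ)) (sym (⊛-one (hS x) γ)))) ⟩
      pair N (hS x ⊛ one) u      ≡⟨ hS-adjoint N x (hProd-Sym []) b ⟩
      pair N one (∂ x u)         ∎
    go (j ∷ ρ) x {u} b v = begin
      pair N (W (- + x) (hS j ⊛ hProd ρ)) u
        ≡⟨ resp (pair-linˡ N u) (λ γ → trans (resp (W-lin (- + x) γ) (hS⊛≈T j (hProd ρ))) (W-T (- + x) (- + j) (hProd-PI ρ) γ)) ⟩
      pair N (T (- + j) (W (- + x) (hProd ρ)) ⊕ neg (T (ℤ.suc (- + j)) (W (ℤ.pred (- + x)) (hProd ρ)))) u
        ≡⟨ trans (add (pair-linˡ N u) _ _) (+ˡ (pair N (T (- + j) (W (- + x) (hProd ρ))) u) (lin-neg (pair-linˡ N u) _)) ⟩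
      pair N (T (- + j) (W (- + x) (hProd ρ))) u + - pair N (T (ℤ.suc (- + j)) (W (ℤ.pred (- + x)) (hProd ρ))) u
        ≡⟨ cong₂ (λ p q → p + - q) (adjT j (W-hProd ρ (- + x)) b) (lower j ρ x b v) ⟩
      pair N (W (- + x) (hProd ρ)) (∂ j u) + + 0
        ≡⟨ ℤₚ.+-identityʳ _ ⟩
      pair N (W (- + x) (hProd ρ)) (∂ j u)
        ≡⟨ go ρ x (∂-Below j b) (λ c l γ → trans (PI-∂∂ (Sym⇒PI (sym⁺ b)) c j γ) (v c l (j ∷ γ))) ⟩
      pair N (hProd ρ) (∂ x (∂ j u))
        ≡⟨ resp (pair-linʳ N (hProd ρ)) (PI-∂∂ (Sym⇒PI (sym⁺ b)) x j) ⟩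
      pair N (hProd ρ) (∂ j (∂ x u))
        ≡⟨ sym (hS-adjoint N j (hProd-Sym ρ) (∂-Below x b)) ⟩
      pair N (hS j ⊛ hProd ρ) (∂ x u) ∎

  D-Sym : ∀ ν → Desc ν → Sym (D (shift ν))
  D-Sym ν d = Homogeneous-Sym (D-PI (shift ν)) (λ γ → D-homogeneous γ ν d)

  D-Below : ∀ {N} ν → Desc ν → sum ν < N → Below N (D (shift ν))
  D-Below ν d l = record { sym⁺ = D-Sym ν d ; vanish = λ γ N≤ → D-homogeneous γ ν d (λ e → ℕₚ.<⇒≱ l (subst (_ ≤_) e N≤)) }

  -- `W-adjoint` turns the first row x of μ into `∂ x` on s_ν, provided x is at least the first part
  -- of ν; otherwise symmetry of the pairing exchanges the roles. `∂ x` then strips an equal first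
  -- row or gives zero.
  orthonormal : ∀ N μ ν → IsPartition μ → IsPartition ν → sum μ < N → sum ν < N →
                pair N (D (shift μ)) (D (shift ν)) ≡ δ μ ν
  orthonormal N [] ν _ (dν , pν) _ lν = trans (pair-h N [] (D-Below ν dν lν)) (trans (D-const ν) (const ν pν))
    where
    const : ∀ ν → All (0 <_) ν → + kostkaRev ν [] ≡ δ [] ν
    const []          _        = refl
    const (suc x ∷ ν) _        = refl
    const (zero ∷ ν)  (() ∷ _)
  orthonormal N (x ∷ μ) [] pμ pν lμ lν = trans (pair-sym N (D-Sym (x ∷ μ) (proj₁ pμ)) (D-Sym [] []))
    (trans (pair-h N [] (D-Below (x ∷ μ) (proj₁ pμ) lμ)) (trans (D-const (x ∷ μ)) (const x (proj₂ pμ))))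
    where
    const : ∀ x → All (0 <_) (x ∷ μ) → + kostkaRev (x ∷ μ) [] ≡ + 0
    const (suc x) _        = refl
    const zero    (() ∷ _)
  orthonormal N (x ∷ μ) (y ∷ ν) (dμ , x>0 ∷ pμ) (dν , y>0 ∷ pν) lμ lν with ℕₚ.<-cmp x y
  ... | tri≈ _ refl _ = begin
    pair N (D (shift (x ∷ μ))) (D (shift (x ∷ ν)))  ≡⟨ resp (pair-linˡ N _) (D-shift-∷ x μ) ⟩
    pair N (W (- + x) (D (shift μ))) (D (shift (x ∷ ν)))
      ≡⟨ W-adjoint N x (D-Sym μ (Desc-tail dμ)) (D-Below (x ∷ ν) dν lν) (∂-D-above x ν dν) ⟩
    pair N (D (shift μ)) (∂ x (D (shift (x ∷ ν))))  ≡⟨ resp (pair-linʳ N (D (shift μ))) (∂-D-head x ν dν) ⟩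
    pair N (D (shift μ)) (D (shift ν))
      ≡⟨ orthonormal N μ ν (Desc-tail dμ , pμ) (Desc-tail dν , pν)
           (ℕₚ.≤-<-trans (ℕₚ.m≤n+m (sum μ) x) lμ) (ℕₚ.≤-<-trans (ℕₚ.m≤n+m (sum ν) x) lν) ⟩
    δ μ ν                                           ≡⟨ sym (ind-yes-* (δ μ ν) (refl {x = x})) ⟩
    ind x x * δ μ ν                                 ≡⟨ sym (δ-∷ x μ x ν) ⟩
    δ (x ∷ μ) (x ∷ ν)                               ∎
  ... | tri> _ x≢y y<x = begin
    pair N (D (shift (x ∷ μ))) (D (shift (y ∷ ν)))  ≡⟨ resp (pair-linˡ N _) (D-shift-∷ x μ) ⟩
    pair N (W (- + x) (D (shift μ))) (D (shift (y ∷ ν)))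
      ≡⟨ W-adjoint N x (D-Sym μ (Desc-tail dμ)) (D-Below (y ∷ ν) dν lν) (λ c l → ∂-D-above y ν dν c (ℕₚ.<-trans y<x l)) ⟩
    pair N (D (shift μ)) (∂ x (D (shift (y ∷ ν))))  ≡⟨ lin-0 (pair-linʳ N (D (shift μ))) (∂-D-above y ν dν x y<x) ⟩
    + 0                                             ≡⟨ sym (trans (δ-∷ x μ y ν) (ind-no-* (δ μ ν) x≢y)) ⟩
    δ (x ∷ μ) (y ∷ ν)                               ∎
  ... | tri< x<y x≢y _ = begin
    pair N (D (shift (x ∷ μ))) (D (shift (y ∷ ν)))  ≡⟨ pair-sym N (D-Sym (x ∷ μ) dμ) (D-Sym (y ∷ ν) dν) ⟩
    pair N (D (shift (y ∷ ν))) (D (shift (x ∷ μ)))  ≡⟨ resp (pair-linˡ N _) (D-shift-∷ y ν) ⟩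
    pair N (W (- + y) (D (shift ν))) (D (shift (x ∷ μ)))
      ≡⟨ W-adjoint N y (D-Sym ν (Desc-tail dν)) (D-Below (x ∷ μ) dμ lμ) (λ c l → ∂-D-above x μ dμ c (ℕₚ.<-trans x<y l)) ⟩
    pair N (D (shift ν)) (∂ y (D (shift (x ∷ μ))))  ≡⟨ lin-0 (pair-linʳ N (D (shift ν))) (∂-D-above x μ dμ y x<y) ⟩
    + 0                                             ≡⟨ sym (trans (δ-∷ x μ y ν) (ind-no-* (δ μ ν) x≢y)) ⟩
    δ (x ∷ μ) (y ∷ ν)                               ∎

  orthonormal′ : ∀ N μ ν → IsPartition μ → IsPartition ν → sum ν < N → pair N (D (shift μ)) (D (shift ν)) ≡ δ μ ν
  orthonormal′ N μ ν pμ pν l with sum μ <? N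
  ... | yes lμ = orthonormal N μ ν pμ pν lμ l
  ... | no  g  = trans (∑-upTo-0 N (λ n n<N → ip-degree n (sum μ) (D-Sym μ (proj₁ pμ)) (λ γ → D-homogeneous γ μ (proj₁ pμ))
                         (D-Sym ν (proj₁ pν)) (λ e → g (subst (_< N) (sym e) n<N))))
                       (sym (δ-no {μ} {ν} (λ e → g (subst (λ κ → sum κ < N) (sym e) l))))

  -- By orthonormality the coefficient of s_ν is its pairing with h_α, which reads off the
  -- coefficient of s_ν at α.
  h-schur-expansion : ∀ α γ → hProd α γ ≡ ∑ (partitionsOf (sum α)) (λ ν → D (shift ν) α * D (shift ν) γ)
  h-schur-expansion α γ with sum γ ≟ sum α
  ... | no  ne = trans (hProd-homogeneous α γ ne) (sym (∑-0-All (All.map (λ {ν} ((d , _) , s) →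
      trans (cong (D (shift ν) α *_) (D-homogeneous γ ν d (λ e → ne (trans e s)))) (ℤₚ.*-zeroʳ (D (shift ν) α)))
    (partitionsOf-All (sum α)))))
  ... | yes γ≡ = trans
    -- At a fixed γ of degree n both sides are linear in the expanded function, so Schur functions
    -- suffice.
    (Span-ext (eval-lin γ) (∑-lin (partitionsOf n) (λ ν → l ν)) onSchur (Sym⇒Schur-span (hProd-Sym α)))
    (∑-cong-All (All.map (λ {ν} ((d , _) , s) → trans
        (cong (D (shift ν) γ *_) (pair-h N α (D-Below ν d (s≤s (ℕₚ.≤-reflexive s)))))
        (ℤₚ.*-comm (D (shift ν) γ) (D (shift ν) α)))
      (partitionsOf-All n)))
    where
    n = sum α
    N = suc n
    l : ∀ ν → Lin (λ f → D (shift ν) γ * pair N f (D (shift ν)))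
    l ν = *-lin (D (shift ν) γ) (pair-linˡ N (D (shift ν)))
    onSchur : ∀ {f} → Schur f → f γ ≡ ∑ (partitionsOf n) (λ ν → D (shift ν) γ * pair N f (D (shift ν)))
    onSchur {f} (μ , p , e) = sym (begin
      ∑ (partitionsOf n) (λ ν → D (shift ν) γ * pair N f (D (shift ν)))
        ≡⟨ ∑-cong-All (All.map (λ {ν} (q , s) → trans
             (cong (D (shift ν) γ *_) (trans (resp (pair-linˡ N (D (shift ν))) e)
               (orthonormal′ N μ ν p q (s≤s (ℕₚ.≤-reflexive s)))))
             (ℤₚ.*-comm (D (shift ν) γ) (δ μ ν))) (partitionsOf-All n)) ⟩
      ∑ (partitionsOf n) (λ ν → δ μ ν * D (shift ν) γ)
        ≡⟨ ∑-partitionsOf n μ (λ ν → D (shift ν) γ) p ⟩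
      ind (sum μ) n * D (shift μ) γ
        ≡⟨ cases (sum μ ≟ n) ⟩
      D (shift μ) γ
        ≡⟨ sym (e γ) ⟩
      f γ ∎)
      where
      cases : Dec (sum μ ≡ n) → ind (sum μ) n * D (shift μ) γ ≡ D (shift μ) γ
      cases (yes q) = ind-yes-* (D (shift μ) γ) q
      cases (no  q) = trans (ind-no-* (D (shift μ) γ) q)
        (sym (D-homogeneous γ μ (proj₁ p) (λ r → q (trans (sym r) γ≡))))

-- Elementary symmetric functions

eS-ind : ∀ i γ → eS i γ ≡ ind (sum γ) i * boolℤ (squarefree γ)
eS-ind i γ = boolℤ-∧ (sum γ ≡ᵇ i) (squarefree γ)

squarefree-↭ : ∀ {γ δ} → γ ↭ δ → squarefree γ ≡ squarefree δ
squarefree-↭ _↭_.refl = refl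
squarefree-↭ (prep x r) = cong ((x ≤ᵇ 1) ∧_) (squarefree-↭ r)
squarefree-↭ (swap x y r) = trans (cong (λ b → (x ≤ᵇ 1) ∧ (y ≤ᵇ 1) ∧ b) (squarefree-↭ r)) (exchange (x ≤ᵇ 1) (y ≤ᵇ 1) _)
  where
  exchange : ∀ a b c → a ∧ b ∧ c ≡ b ∧ a ∧ c
  exchange true  b     c = refl
  exchange false true  c = refl
  exchange false false c = refl
squarefree-↭ (_↭_.trans r s) = trans (squarefree-↭ r) (squarefree-↭ s)

eS-PI : ∀ i → PI (eS i)
eS-PI i .perm r = cong₂ (λ s b → boolℤ ((s ≡ᵇ i) ∧ b)) (sum-↭ r) (squarefree-↭ r)
eS-PI i .pad γ = refl

eS-homogeneous : ∀ i → Homogeneous i (eS i)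
eS-homogeneous i γ ne = trans (eS-ind i γ) (ind-no-* (boolℤ (squarefree γ)) ne)

eS-Sym : ∀ i → Sym (eS i)
eS-Sym i = Homogeneous-Sym (eS-PI i) (eS-homogeneous i)

eSpred : ℕ → Series
eSpred zero    = zeroS
eSpred (suc i) = eS i

∂1-eS : ∀ i → ∂ 1 (eS i) ≈ eSpred i
∂1-eS zero    γ = refl
∂1-eS (suc i) γ = refl

∂2-eS : ∀ c i → ∂ (suc (suc c)) (eS i) ≈ zeroS
∂2-eS c i γ = trans (eS-ind i (suc (suc c) ∷ γ)) (ℤₚ.*-zeroʳ (ind (suc (suc c) ℕ.+ sum γ) i))

eS⊛-suc : ∀ i g c γ → (eS i ⊛ g) (suc c ∷ γ) ≡ (eS i ⊛ ∂ (suc c) g) γ + (eSpred i ⊛ ∂ c g) γ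
eS⊛-suc i g c γ = begin
  (eS i ⊛ g) (suc c ∷ γ)
    ≡⟨ trans (⊛-∷ (eS i) g (suc c) γ) (C-suc c (λ a b → (∂ a (eS i) ⊛ ∂ b g) γ)) ⟩
  (eS i ⊛ ∂ (suc c) g) γ + C c (λ a b → (∂ (suc a) (eS i) ⊛ ∂ b g) γ)
    ≡⟨ +ˡ ((eS i ⊛ ∂ (suc c) g) γ) (trans
         (C-first c (λ a b → (∂ (suc a) (eS i) ⊛ ∂ b g) γ) (λ a b → lin-0 (⊛-linˡ (∂ b g) γ) (∂2-eS a i)))
         (resp (⊛-linˡ (∂ c g) γ) (∂1-eS i))) ⟩
  (eS i ⊛ ∂ (suc c) g) γ + (eSpred i ⊛ ∂ c g) γ ∎

hSpred : ℕ → Series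
hSpred zero    = zeroS
hSpred (suc j) = hS j

hSpred⊛≈T : ∀ j f → T (ℤ.suc (- + j)) f ≈ (hSpred j ⊛ f)
hSpred⊛≈T zero    f γ = trans (T-pos 0 f γ) (sym (lin-0 (⊛-linˡ f γ) (λ _ → refl)))
hSpred⊛≈T (suc j) f γ = trans (cong (λ z → T z f γ) (suc-neg j)) (sym (hS⊛≈T j f γ))

hS⊛-suc : ∀ j g c → ∂ (suc c) (hS j ⊛ g) ≈ ((hS j ⊛ ∂ (suc c) g) ⊕ ∂ c (hSpred j ⊛ g))
hS⊛-suc j g c γ = begin
  (hS j ⊛ g) (suc c ∷ γ)                                             ≡⟨ hS⊛≈T j g (suc c ∷ γ) ⟩
  T (- + j) g (suc c ∷ γ)                                            ≡⟨ Op-shift φT-lin c (- + j) g γ ⟩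
  T (- + j) (∂ (suc c) g) γ + T (ℤ.suc (- + j)) g (c ∷ γ)            ≡⟨ cong₂ _+_ (sym (hS⊛≈T j (∂ (suc c) g) γ)) (hSpred⊛≈T j g (c ∷ γ)) ⟩
  (hS j ⊛ ∂ (suc c) g) γ + (hSpred j ⊛ g) (c ∷ γ)                    ∎

sign-suc : ∀ n → sign (suc n) ≡ - sign n
sign-suc n = ℤₚ.-1*i≡-i (sign n)

sign² : ∀ n → sign n * sign n ≡ + 1
sign² zero    = refl
sign² (suc n) = trans (cong₂ _*_ (sign-suc n) (sign-suc n)) (trans (arrange (sign n)) (sign² n))
  where
  arrange : ∀ x → - x * - x ≡ x * x
  arrange = solve-∀

sign-+ : ∀ m n → sign (m ℕ.+ n) ≡ sign m * sign n
sign-+ m n = ℤₚ.^-distribˡ-+-* -[1+ 0 ] m n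

-- Exponents in e_i are 0 or 1, and the two correction sums cancel after i is shifted by one, which
-- flips the sign. The factor g is carried because the induction replaces it by `∂ (suc c) g`.
e-h-inverse : ∀ γ n {g} → PI g → C n (λ i j → sign i * (eS i ⊛ (hS j ⊛ g)) γ) ≡ ind n 0 * g γ
e-h-inverse [] n {g} p = trans (C-cong n (λ i j → cong (sign i *_)
    (trans (⊛-[] (eS i) (hS j ⊛ g)) (cong (eS i [] *_) (⊛-[] (hS j) g))))) (go n)
  where
  term : ℕ → ℕ → ℤ
  term i j = sign i * (eS i [] * (hS j [] * g []))
  arrange : ∀ x → + 1 * (+ 1 * (+ 1 * x)) ≡ + 1 * x
  arrange = solve-∀
  go : ∀ n → C n term ≡ ind n 0 * g []
  go zero    = trans (C-zero term) (arrange (g []))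
  go (suc n) = trans (C-cong-≤ (suc n) v) (C-0 (suc n) (λ i j → refl))
    where
    v : ∀ i j → i ℕ.+ j ≡ suc n → term i j ≡ + 0
    v zero    (suc j) e = refl
    v (suc i) j       e = ℤₚ.*-zeroʳ (sign (suc i))
e-h-inverse (zero ∷ γ) n {g} p = begin
  C n (λ i j → sign i * (eS i ⊛ (hS j ⊛ g)) (0 ∷ γ))
    ≡⟨ C-cong n (λ i j → cong (sign i *_) (pad (⊛-PI (eS-PI i) (⊛-PI (PI-hS j) p)) γ)) ⟩
  C n (λ i j → sign i * (eS i ⊛ (hS j ⊛ g)) γ)
    ≡⟨ e-h-inverse γ n p ⟩
  ind n 0 * g γ
    ≡⟨ cong (ind n 0 *_) (sym (pad p γ)) ⟩
  ind n 0 * g (0 ∷ γ) ∎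
e-h-inverse (suc c ∷ γ) n {g} p = begin
  C n (λ i j → sign i * (eS i ⊛ (hS j ⊛ g)) (suc c ∷ γ))
    ≡⟨ C-cong n (λ i j → trans (cong (sign i *_) (expand i j)) (distrib (sign i) _ _ _)) ⟩
  C n (λ i j → (A i j + B i j) + B′ i j)
    ≡⟨ trans (C-+ n (λ i j → A i j + B i j) B′) (+ʳ (C n B′) (C-+ n A B)) ⟩
  C n A + C n B + C n B′
    ≡⟨ trans (ℤₚ.+-assoc (C n A) (C n B) (C n B′)) (cong₂ _+_ (e-h-inverse γ n (PI-∂ (suc c) p)) (cancel n)) ⟩
  ind n 0 * g (suc c ∷ γ) + + 0
    ≡⟨ ℤₚ.+-identityʳ _ ⟩
  ind n 0 * g (suc c ∷ γ) ∎
  where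
  A B B′ : ℕ → ℕ → ℤ
  A i j = sign i * (eS i ⊛ (hS j ⊛ ∂ (suc c) g)) γ
  B i j = sign i * (eS i ⊛ ∂ c (hSpred j ⊛ g)) γ
  B′ i j = sign i * (eSpred i ⊛ ∂ c (hS j ⊛ g)) γ
  distrib : ∀ s x y z → s * (x + y + z) ≡ s * x + s * y + s * z
  distrib = solve-∀
  expand : ∀ i j → (eS i ⊛ (hS j ⊛ g)) (suc c ∷ γ) ≡
    (eS i ⊛ (hS j ⊛ ∂ (suc c) g)) γ + (eS i ⊛ ∂ c (hSpred j ⊛ g)) γ + (eSpred i ⊛ ∂ c (hS j ⊛ g)) γ
  expand i j = trans (eS⊛-suc i (hS j ⊛ g) c γ) (+ʳ ((eSpred i ⊛ ∂ c (hS j ⊛ g)) γ)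
    (trans (resp (⊛-linʳ (eS i) γ) (hS⊛-suc j g c)) (add (⊛-linʳ (eS i) γ) (hS j ⊛ ∂ (suc c) g) (∂ c (hSpred j ⊛ g)))))
  B-0 : ∀ i → B i 0 ≡ + 0
  B-0 i = trans (cong (sign i *_) (lin-0 (⊛-linʳ (eS i) γ) (λ δ → lin-0 (⊛-linˡ g (c ∷ δ)) (λ _ → refl)))) (ℤₚ.*-zeroʳ (sign i))
  B′-0 : ∀ j → B′ 0 j ≡ + 0
  B′-0 j = trans (ℤₚ.*-identityˡ _) (lin-0 (⊛-linˡ (∂ c (hS j ⊛ g)) γ) (λ _ → refl))
  cancel : ∀ n → C n B + C n B′ ≡ + 0
  cancel zero    = cong₂ _+_ (trans (C-zero B) (B-0 0)) (trans (C-zero B′) (B′-0 0))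
  cancel (suc n) = begin
    C (suc n) B + C (suc n) B′
      ≡⟨ cong₂ _+_ (trans (C-snoc n B) (trans (+ˡ (C n (λ i j → B i (suc j))) (B-0 (suc n))) (ℤₚ.+-identityʳ (C n (λ i j → B i (suc j))))))
                   (trans (C-suc n B′) (trans (+ʳ (C n (λ i j → B′ (suc i) j)) (B′-0 (suc n))) (ℤₚ.+-identityˡ (C n (λ i j → B′ (suc i) j))))) ⟩
    C n (λ i j → B i (suc j)) + C n (λ i j → B′ (suc i) j)
      ≡⟨ +ˡ (C n (λ i j → B i (suc j))) (trans (C-cong n (λ i j → trans
           (cong (_* (eS i ⊛ ∂ c (hS j ⊛ g)) γ) (sign-suc i)) (sym (ℤₚ.neg-distribˡ-* (sign i) _))))
           (C-neg n (λ i j → B i (suc j)))) ⟩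
    C n (λ i j → B i (suc j)) + - C n (λ i j → B i (suc j))
      ≡⟨ ℤₚ.+-inverseʳ (C n (λ i j → B i (suc j))) ⟩
    + 0 ∎

isZero-no : ∀ z → z ≢ + 0 → isZero z ≡ + 0
isZero-no (+ zero)  ne = ⊥-elim (ne refl)
isZero-no (+ suc n) ne = refl
isZero-no -[1+ n ]  ne = refl

-- W_z = Σ_i h_{i-z} Ē_i, where only i ≤ z + |γ| matters for the coefficient of γ.
W-expand : ∀ N γ z {f} → PI f → (∀ s → s ≤ sum γ → ∀ m → up z s ≡ + m → m < N) →
           ∑ (upTo N) (λ i → T (z + - + i) (Ē i f) γ) ≡ W z f γ
W-expand N [] z {f} p cond = base z (cond 0 z≤n)
  where
  base : ∀ z → (∀ m → z ≡ + m → m < N) → ∑ (upTo N) (λ i → isZero (z + - + i) * Ē i f []) ≡ Ēz z f []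
  base (+ m) c = begin
    ∑ (upTo N) (λ i → isZero (+ m + - + i) * Ē i f [])
      ≡⟨ ∑-upTo-single N m (c m refl) (λ i ne → cong (_* Ē i f []) (isZero-no (+ m + - + i)
           (λ e → ne (sym (ℤₚ.+-injective (ℤₚ.i-j≡0⇒i≡j (+ m) (+ i) e)))))) ⟩
    isZero (+ m + - + m) * Ē m f []   ≡⟨ cong (λ z → isZero z * Ē m f []) (ℤₚ.+-inverseʳ (+ m)) ⟩
    + 1 * Ē m f []                    ≡⟨ ℤₚ.*-identityˡ (Ē m f []) ⟩
    Ē m f []                          ∎
  base -[1+ n ] c = ∑-0 (upTo N) (λ i → cong (_* Ē i f []) (isZero-no (-[1+ n ] + - + i)
    (λ e → neg≢pos (ℤₚ.i-j≡0⇒i≡j -[1+ n ] (+ i) e))))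
    where
    neg≢pos : ∀ {n i} → -[1+ n ] ≢ + i
    neg≢pos ()
W-expand N (c ∷ γ) z {f} p cond = begin
  ∑ (upTo N) (λ i → C c (λ a b → T (up (z + - + i) a) (∂ b (Ē i f)) γ))
    ≡⟨ ∑-swap (upTo N) (splits c) _ ⟩
  C c (λ a b → ∑ (upTo N) (λ i → T (up (z + - + i) a) (∂ b (Ē i f)) γ))
    ≡⟨ C-cong-≤ c (λ a b a+b≡c → trans
         (∑-cong (upTo N) (λ i → trans (cong (λ y → T y (∂ b (Ē i f)) γ) (up-sub i a))
                                       (resp (T-lin (up z a + - + i) γ) (∂-Ē i b p))))
         (W-expand N γ (up z a) (PI-∂ b p) (λ s s≤ m e → cond (a ℕ.+ s)
           (ℕₚ.+-mono-≤ (subst (a ≤_) a+b≡c (ℕₚ.m≤m+n a b)) s≤) m (trans (sym (up-up z a s)) e)))) ⟩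
  C c (λ a b → W (up z a) (∂ b f) γ) ∎
  where
  up-sub : ∀ i a → up (z + - + i) a ≡ up z a + - + i
  up-sub i a = trans (up-+ (z + - + i) a) (trans (arrange z (+ i) (+ a)) (cong (_+ - + i) (sym (up-+ z a))))
    where
    arrange : ∀ z i a → z + - i + a ≡ z + a + - i
    arrange = solve-∀

up-neg-≤ : ∀ a t m → up (- + a) t ≡ + m → m ≤ t
up-neg-≤ a t m e = ℤₚ.drop‿+≤+ (subst (ℤ._≤ + t) (trans (sym (up-+ (- + a) t)) e)
  (ℤₚ.≤-trans (ℤₚ.+-monoˡ-≤ (+ t) (ℤₚ.neg-≤-pos {a} {0})) (ℤₚ.≤-reflexive (ℤₚ.+-identityˡ (+ t)))))

-- Skewing by elementary functions, and RS as `W`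

module Skewing (ip : ℕ → Series → Series → ℤ) (hall : IsHallPairing ip)
               (perp : Series → Series → Series) (skew : IsSkewing ip perp) where
  open Hall ip hall

  -- A coefficient is a pairing with a product of complete functions, to which adjointness applies.
  perp-coefficient : ∀ {g} d → Sym g → Homogeneous d g → ∀ {f} → Sym f → ∀ γ →
                     perp g f γ ≡ ip (sum γ ℕ.+ d) f (g ⊛ hProd γ)
  perp-coefficient {g} d sg hg {f} sf γ with skew g d sg hg f sf
  ... | sp , adj = begin
    perp g f γ                             ≡⟨ sym (ind-yes-* (perp g f γ) (refl {x = sum γ})) ⟩
    ind (sum γ) (sum γ) * perp g f γ       ≡⟨ sym (ip-h (sum γ) γ sp) ⟩
    ip (sum γ) (perp g f) (hProd γ)        ≡⟨ adj (sum γ) (hProd γ) (hProd-Sym γ) ⟩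
    ip (sum γ ℕ.+ d) f (g ⊛ hProd γ)       ∎

  perp-e-inverse : ∀ n {f} → Sym f → ∀ γ → C n (λ i j → sign i * perp (eS i) f (j ∷ γ)) ≡ ind n 0 * ip (sum γ ℕ.+ n) f (hProd γ)
  perp-e-inverse n {f} s γ = begin
    C n (λ i j → sign i * perp (eS i) f (j ∷ γ))
      ≡⟨ C-cong-≤ n (λ i j i+j≡n → cong (sign i *_) (trans (perp-coefficient i (eS-Sym i) (eS-homogeneous i) s (j ∷ γ))
           (cong (λ k → ip k f (eS i ⊛ hProd (j ∷ γ))) (degree i j i+j≡n)))) ⟩
    C n (λ i j → sign i * ip (sum γ ℕ.+ n) f (eS i ⊛ hProd (j ∷ γ)))
      ≡⟨ sym (lin-∑* (ip-linʳ (sum γ ℕ.+ n) f) (splits n) (λ p → sign (proj₁ p)) (λ p → eS (proj₁ p) ⊛ hProd (proj₂ p ∷ γ))) ⟩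
    ip (sum γ ℕ.+ n) f (λ δ → C n (λ i j → sign i * (eS i ⊛ (hS j ⊛ hProd γ)) δ))
      ≡⟨ resp (ip-linʳ (sum γ ℕ.+ n) f) (λ δ → e-h-inverse δ n (hProd-PI γ)) ⟩
    ip (sum γ ℕ.+ n) f (ind n 0 · hProd γ)
      ≡⟨ scl (ip-linʳ (sum γ ℕ.+ n) f) (ind n 0) (hProd γ) ⟩
    ind n 0 * ip (sum γ ℕ.+ n) f (hProd γ) ∎
    where
    degree : ∀ i j → i ℕ.+ j ≡ n → j ℕ.+ sum γ ℕ.+ i ≡ sum γ ℕ.+ n
    degree i j e = trans (arrange i j (sum γ)) (cong (sum γ ℕ.+_) e)
      where
      arrange : ∀ i j s → j ℕ.+ s ℕ.+ i ≡ s ℕ.+ (i ℕ.+ j)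
      arrange = ℕ-solve-∀

  perp-PI : ∀ {g} d → Sym g → Homogeneous d g → ∀ {f} → Sym f → PI (perp g f)
  perp-PI d sg hg {f} sf = Sym⇒PI (proj₁ (skew _ d sg hg f sf))

  -- Both families are inverse to the series of the ∂ j, and the recursion determines the inverse. A
  -- zero put in front of γ supplies the term `∂ 0`.
  signed-perp-e : ∀ i {f} → Sym f → ∀ γ → sign i * perp (eS i) f γ ≡ Ē i f γ
  signed-perp-e = <-rec (λ i → ∀ {f} → Sym f → ∀ γ → sign i * perp (eS i) f γ ≡ Ē i f γ) go
    where
    padded : ∀ i {f} → Sym f → ∀ γ → sign i * perp (eS i) f (0 ∷ γ) ≡ sign i * perp (eS i) f γ
    padded i s γ = cong (sign i *_) (pad (perp-PI i (eS-Sym i) (eS-homogeneous i) s) γ)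
    go : ∀ i → _ → _
    go zero IH {f} s γ = begin
      sign 0 * perp (eS 0) f γ                            ≡⟨ sym (padded 0 s γ) ⟩
      sign 0 * perp (eS 0) f (0 ∷ γ)                      ≡⟨ sym (C-zero (λ i j → sign i * perp (eS i) f (j ∷ γ))) ⟩
      C 0 (λ i j → sign i * perp (eS i) f (j ∷ γ))        ≡⟨ perp-e-inverse 0 s γ ⟩
      + 1 * ip (sum γ ℕ.+ 0) f (hProd γ)                  ≡⟨ ℤₚ.*-identityˡ _ ⟩
      ip (sum γ ℕ.+ 0) f (hProd γ)                        ≡⟨ ip-h (sum γ ℕ.+ 0) γ s ⟩
      ind (sum γ) (sum γ ℕ.+ 0) * f γ                     ≡⟨ ind-yes-* (f γ) (sym (ℕₚ.+-identityʳ (sum γ))) ⟩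
      f γ                                                 ∎
    go (suc m) IH {f} s γ = begin
      P (suc m) γ
        ≡⟨ sym (padded (suc m) s γ) ⟩
      P (suc m) (0 ∷ γ)
        ≡⟨ sym (arrange (C m (λ i j → P i (suc j ∷ γ))) _) ⟩
      - C m (λ i j → P i (suc j ∷ γ)) + (C m (λ i j → P i (suc j ∷ γ)) + P (suc m) (0 ∷ γ))
        ≡⟨ cong₂ (λ x y → - x + y)
             (C-cong-≤ m (λ i j e → trans (IH (s≤s (subst (i ≤_) e (ℕₚ.m≤m+n i j))) s (suc j ∷ γ)) (∂-Ē i (suc j) (Sym⇒PI s) γ)))
             (trans (sym (C-snoc m (λ i j → P i (j ∷ γ)))) (perp-e-inverse (suc m) s γ)) ⟩
      - C m (λ i j → Ē i (∂ (suc j) f) γ) + + 0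
        ≡⟨ ℤₚ.+-identityʳ _ ⟩
      - C m (λ i j → Ē i (∂ (suc j) f) γ)
        ≡⟨ sym (Ē-rec m f γ) ⟩
      Ē (suc m) f γ ∎
      where
      P : ℕ → List ℕ → ℤ
      P i γ = sign i * perp (eS i) f γ
      arrange : ∀ x y → - x + (x + y) ≡ y
      arrange = solve-∀

  perp-e : ∀ i {f} → Sym f → perp (eS i) f ≈ (sign i · Ē i f)
  perp-e i {f} s γ = begin
    perp (eS i) f γ                          ≡⟨ sym (ℤₚ.*-identityˡ _) ⟩
    + 1 * perp (eS i) f γ                    ≡⟨ cong (_* perp (eS i) f γ) (sym (sign² i)) ⟩
    sign i * sign i * perp (eS i) f γ        ≡⟨ ℤₚ.*-assoc (sign i) (sign i) (perp (eS i) f γ) ⟩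
    sign i * (sign i * perp (eS i) f γ)      ≡⟨ cong (sign i *_) (signed-perp-e i s γ) ⟩
    sign i * Ē i f γ                         ∎

  RS≈W : ∀ a {f} → Sym f → RS perp a f ≈ W (- + a) f
  RS≈W a {f} s γ = begin
    ∑ (upTo (suc (sum γ))) (λ i → sign i * (hS (a ℕ.+ i) ⊛ perp (eS i) f) γ)
      ≡⟨ ∑-cong (upTo (suc (sum γ))) (λ i → trans (sym (scl (⊛-linʳ (hS (a ℕ.+ i)) γ) (sign i) (perp (eS i) f)))
           (trans (resp (⊛-linʳ (hS (a ℕ.+ i)) γ) (signed-perp-e i s))
             (trans (hS⊛≈T (a ℕ.+ i) (Ē i f) γ) (cong (λ z → T z (Ē i f) γ) (ℤₚ.neg-distrib-+ (+ a) (+ i)))))) ⟩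
    ∑ (upTo (suc (sum γ))) (λ i → T (- + a + - + i) (Ē i f) γ)
      ≡⟨ W-expand (suc (sum γ)) γ (- + a) (Sym⇒PI s) cond ⟩
    W (- + a) f γ ∎
    where
    -- The indices that occur are t - a with t ≤ |γ|, hence at most |γ|, where `RS` is cut.
    cond : ∀ t → t ≤ sum γ → ∀ m → up (- + a) t ≡ + m → m < suc (sum γ)
    cond t t≤ m e = s≤s (ℕₚ.≤-trans (up-neg-≤ a t m e) t≤)

  W-Sym : ∀ z {f} → Sym f → Sym (W z f)
  W-Sym z s = H-span-Sym (W-H z (Sym⇒H-span s))

  Sym-resp : ∀ {f g} → f ≈ g → Sym f → Sym g
  Sym-resp e s = H-span-Sym (eq e (Sym⇒H-span s))

  -- Symmetry is proved along with the equation, since `perp` is specified on symmetric functions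
  -- and is applied again.
  iter-RS : ∀ a k {f} → Sym f → iter k (RS perp a) f ≈ iter k (W (- + a)) f × Sym (iter k (RS perp a) f)
  iter-RS a zero    s = (λ _ → refl) , s
  iter-RS a (suc k) s with iter-RS a k s
  ... | e , t = (λ γ → trans (RS≈W a t γ) (resp (W-lin (- + a) γ) e)) , Sym-resp (λ γ → sym (RS≈W a t γ)) (W-Sym (- + a) t)

-- The series M f ε = Σ_α (Ē_{α₁} Ē_{α₂} ⋯ f)(ε) x^α, i.e. Σ_ν (-1)^{|ν|} (s_{ν'}^⊥ f)(ε) s_ν

M : Series → List ℕ → Series
M f ε []      = f ε
M f ε (j ∷ α) = M (Ē j f) ε α

M-lin : ∀ ε α → Lin (λ f → M f ε α)
M-lin ε []      = eval-lin ε
M-lin ε (j ∷ α) = ∘-lin (M-lin ε α) (Ē-lin j)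

M-perm : ∀ ε {f} → PI f → ∀ {α β} → α ↭ β → M f ε α ≡ M f ε β
M-perm ε p _↭_.refl = refl
M-perm ε p (prep j r) = M-perm ε (Ē-PI j p) r
M-perm ε p (swap {ys = β} i j r) = trans (M-perm ε (Ē-PI j (Ē-PI i p)) r) (resp (M-lin ε β) (Ē-comm j i p))
M-perm ε p (_↭_.trans r s) = trans (M-perm ε p r) (M-perm ε p s)

M-PI : ∀ ε {f} → PI f → PI (M f ε)
M-PI ε p .perm = M-perm ε p
M-PI ε p .pad α = refl

∂-Ē-inverse : ∀ n {f} → PI f → ∀ γ → C (suc n) (λ i j → ∂ i (Ē j f) γ) ≡ + 0
∂-Ē-inverse n {f} p γ = trans (C-comm (suc n) (λ i j → ∂ i (Ē j f) γ))
  (trans (C-cong (suc n) (λ j i → ∂-Ē j i p γ)) (Ē-∂-inverse n p γ))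

-- On `M f ε` the operator ∂ j acts as Ē j on f, so the series inverse to the ∂ acts as the series
-- inverse to the Ē, which is that of the ∂.
Ē-M : ∀ i ε {f} → PI f → ∀ α → Ē i (M f ε) α ≡ M (∂ i f) ε α
Ē-M = <-rec (λ i → ∀ ε {f} → PI f → ∀ α → Ē i (M f ε) α ≡ M (∂ i f) ε α) go
  where
  go : ∀ i → _ → _
  go zero IH ε p α = sym (resp (M-lin ε α) (pad p))
  go (suc m) IH ε {f} p α = begin
    Ē (suc m) (M f ε) α
      ≡⟨ Ē-rec m (M f ε) α ⟩
    - C m (λ i j → Ē i (M (Ē (suc j) f) ε) α)
      ≡⟨ cong -_ (C-cong-≤ m (λ i j e → IH (s≤s (subst (i ≤_) e (ℕₚ.m≤m+n i j))) ε (Ē-PI (suc j) p) α)) ⟩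
    - C m (λ i j → M (∂ i (Ē (suc j) f)) ε α)
      ≡⟨ cong -_ (sym (lin-C (M-lin ε α) m (λ i j → ∂ i (Ē (suc j) f)))) ⟩
    - M (λ γ → C m (λ i j → ∂ i (Ē (suc j) f) γ)) ε α
      ≡⟨ sym (lin-neg (M-lin ε α) _) ⟩
    M (neg (λ γ → C m (λ i j → ∂ i (Ē (suc j) f) γ))) ε α
      ≡⟨ resp (M-lin ε α) (λ γ → trans (sym (ℤₚ.+-identityʳ _))
           (trans (+ˡ (- C m (λ i j → ∂ i (Ē (suc j) f) γ)) (trans (sym (∂-Ē-inverse m p γ)) (C-snoc m (λ i j → ∂ i (Ē j f) γ))))
                  (arrange (C m (λ i j → ∂ i (Ē (suc j) f) γ)) (f (suc m ∷ γ))))) ⟩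
    M (∂ (suc m) f) ε α ∎
    where
    arrange : ∀ x y → - x + (x + y) ≡ y
    arrange = solve-∀

-- The involution ω

-- For symmetric f this coefficient is ⟨f, e_γ⟩, as it should be for ω, since e_c^⊥ is (-1)^c Ē c.
ω : Series → Series
ω f γ = sign (sum γ) * M f [] γ

ω-lin : ∀ γ → Lin (λ f → ω f γ)
ω-lin γ = *-lin (sign (sum γ)) (M-lin [] γ)

E : ℕ → Series → Series
E c f = sign c · Ē c f

ω-∷ : ∀ f c γ → ω f (c ∷ γ) ≡ ω (E c f) γ
ω-∷ f c γ = begin
  sign (c ℕ.+ sum γ) * M (Ē c f) [] γ          ≡⟨ cong (_* M (Ē c f) [] γ) (sign-+ c (sum γ)) ⟩
  sign c * sign (sum γ) * M (Ē c f) [] γ       ≡⟨ ℤₚ.*-assoc (sign c) (sign (sum γ)) _ ⟩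
  sign c * ω (Ē c f) γ                         ≡⟨ sym (scl (ω-lin γ) (sign c) (Ē c f)) ⟩
  ω (E c f) γ                                  ∎

E-PI : ∀ c {f} → PI f → PI (E c f)
E-PI c p = PI-· (sign c) (Ē-PI c p)

E-0 : ∀ f → E 0 f ≈ f
E-0 f γ = ℤₚ.*-identityˡ (f γ)

E-suc-Op : ∀ {φ} (φ-lin : ∀ z → Lin (φ z)) c z {f} → PI f →
           E (suc c) (Op φ z f) ≈ (Op φ z (E (suc c) f) ⊕ Op φ (ℤ.suc z) (E c f))
E-suc-Op {φ} φ-lin c z {f} p γ = begin
  sign (suc c) * Ē (suc c) (Op φ z f) γ
    ≡⟨ cong (sign (suc c) *_) (Ē-Op φ-lin (suc c) z p γ) ⟩
  sign (suc c) * (Op φ z (Ē (suc c) f) γ + - Op φ (ℤ.suc z) (Ē c f) γ)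
    ≡⟨ ℤₚ.*-distribˡ-+ (sign (suc c)) (Op φ z (Ē (suc c) f) γ) (- Op φ (ℤ.suc z) (Ē c f) γ) ⟩
  sign (suc c) * Op φ z (Ē (suc c) f) γ + sign (suc c) * - Op φ (ℤ.suc z) (Ē c f) γ
    ≡⟨ cong₂ _+_ (sym (scl (Op-lin φ-lin z γ) (sign (suc c)) (Ē (suc c) f)))
         (trans (trans (cong (_* - Op φ (ℤ.suc z) (Ē c f) γ) (sign-suc c)) (arrange (sign c) (Op φ (ℤ.suc z) (Ē c f) γ)))
                (sym (scl (Op-lin φ-lin (ℤ.suc z) γ) (sign c) (Ē c f)))) ⟩
  Op φ z (E (suc c) f) γ + Op φ (ℤ.suc z) (E c f) γ ∎
  where
  arrange : ∀ s x → - s * - x ≡ s * x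
  arrange = solve-∀

-- Peeling off an exponent c, the rule for e_c^⊥ on h_j g and the exponents 0 and 1 in e_j give the
-- same two-term recursion.
ω-h⊛ : ∀ γ j {g} → PI g → ω (hS j ⊛ g) γ ≡ (eS j ⊛ ω g) γ
ω-h⊛ [] j {g} p = trans (cong (+ 1 *_) (⊛-[] (hS j) g)) (trans (go j (g [])) (sym (⊛-[] (eS j) (ω g))))
  where
  go : ∀ j x → + 1 * (hS j [] * x) ≡ eS j [] * (+ 1 * x)
  go zero    x = refl
  go (suc j) x = refl
ω-h⊛ (zero ∷ γ) j {g} p = begin
  ω (hS j ⊛ g) (0 ∷ γ)      ≡⟨ trans (ω-∷ (hS j ⊛ g) 0 γ) (resp (ω-lin γ) (E-0 (hS j ⊛ g))) ⟩
  ω (hS j ⊛ g) γ            ≡⟨ ω-h⊛ γ j p ⟩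
  (eS j ⊛ ω g) γ            ≡⟨ sym (trans (⊛-∷ (eS j) (ω g) 0 γ) (C-zero (λ a b → (∂ a (eS j) ⊛ ∂ b (ω g)) γ))) ⟩
  (eS j ⊛ ω g) (0 ∷ γ)      ∎
ω-h⊛ (suc c ∷ γ) j {g} p = begin
  ω (hS j ⊛ g) (suc c ∷ γ)
    ≡⟨ trans (ω-∷ (hS j ⊛ g) (suc c) γ) (resp (ω-lin γ) expand) ⟩
  ω ((hS j ⊛ E (suc c) g) ⊕ (hSpred j ⊛ E c g)) γ
    ≡⟨ add (ω-lin γ) (hS j ⊛ E (suc c) g) (hSpred j ⊛ E c g) ⟩
  ω (hS j ⊛ E (suc c) g) γ + ω (hSpred j ⊛ E c g) γ
    ≡⟨ cong₂ _+_ (ω-h⊛ γ j (E-PI (suc c) p)) (pred j) ⟩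
  (eS j ⊛ ω (E (suc c) g)) γ + (eSpred j ⊛ ω (E c g)) γ
    ≡⟨ cong₂ _+_ (resp (⊛-linʳ (eS j) γ) (λ δ → sym (ω-∷ g (suc c) δ))) (resp (⊛-linʳ (eSpred j) γ) (λ δ → sym (ω-∷ g c δ))) ⟩
  (eS j ⊛ ∂ (suc c) (ω g)) γ + (eSpred j ⊛ ∂ c (ω g)) γ
    ≡⟨ sym (eS⊛-suc j (ω g) c γ) ⟩
  (eS j ⊛ ω g) (suc c ∷ γ) ∎
  where
  expand : E (suc c) (hS j ⊛ g) ≈ ((hS j ⊛ E (suc c) g) ⊕ (hSpred j ⊛ E c g))
  expand δ = trans (cong (sign (suc c) *_) (resp (Ē-lin (suc c) δ) (hS⊛≈T j g)))
    (trans (E-suc-Op φT-lin c (- + j) p δ)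
           (cong₂ _+_ (sym (hS⊛≈T j (E (suc c) g) δ)) (hSpred⊛≈T j (E c g) δ)))
  pred : ∀ j → ω (hSpred j ⊛ E c g) γ ≡ (eSpred j ⊛ ω (E c g)) γ
  pred zero    = trans (lin-0 (ω-lin γ) (λ δ → lin-0 (⊛-linˡ (E c g) δ) (λ _ → refl)))
                       (sym (lin-0 (⊛-linˡ (ω (E c g)) γ) (λ _ → refl)))
  pred (suc j) = ω-h⊛ γ j (E-PI c p)

eProd : List ℕ → Series
eProd = foldr (λ j acc → eS j ⊛ acc) one

ω-one : ω one ≈ one
ω-one []          = refl
ω-one (zero ∷ γ)  = trans (ω-∷ one 0 γ) (trans (resp (ω-lin γ) (E-0 one)) (ω-one γ))
ω-one (suc c ∷ γ) = trans (ω-∷ one (suc c) γ)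
  (lin-0 (ω-lin γ) (λ δ → trans (cong (sign (suc c) *_) (Ē-one c δ)) (ℤₚ.*-zeroʳ (sign (suc c)))))

ω-hProd : ∀ ρ → ω (hProd ρ) ≈ eProd ρ
ω-hProd []      = ω-one
ω-hProd (j ∷ ρ) γ = trans (ω-h⊛ γ j (hProd-PI ρ)) (resp (⊛-linʳ (eS j) γ) (ω-hProd ρ))

-- Vertical strips

decrements : List ℕ → List (List ℕ)
decrements []          = [ [] ]
decrements (zero ∷ ℓ)  = map (0 ∷_) (decrements ℓ)
decrements (suc x ∷ ℓ) = map (suc x ∷_) (decrements ℓ) ++ map (x ∷_) (decrements ℓ)

∑-decrements-suc : ∀ x ℓ (F : List ℕ → ℤ) → ∑ (decrements (suc x ∷ ℓ)) F ≡
  ∑ (decrements ℓ) (λ m → F (suc x ∷ m)) + ∑ (decrements ℓ) (λ m → F (x ∷ m))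
∑-decrements-suc x ℓ F = trans (∑-++ (map (suc x ∷_) (decrements ℓ)) (map (x ∷_) (decrements ℓ)) F)
  (cong₂ _+_ (∑-map (suc x ∷_) (decrements ℓ) F) (∑-map (x ∷_) (decrements ℓ) F))

decrements-All : ∀ ℓ → All (λ m → sum m ≤ sum ℓ × length m ≡ length ℓ) (decrements ℓ)
decrements-All []          = (z≤n , refl) ∷ []
decrements-All (zero ∷ ℓ)  = Allₚ.map⁺ (All.map (λ (s , l) → s , cong suc l) (decrements-All ℓ))
decrements-All (suc x ∷ ℓ) = Allₚ.++⁺
  (Allₚ.map⁺ (All.map (λ (s , l) → ℕₚ.+-monoʳ-≤ (suc x) s , cong suc l) (decrements-All ℓ)))
  (Allₚ.map⁺ (All.map (λ (s , l) → ℕₚ.m≤n⇒m≤1+n (ℕₚ.+-monoʳ-≤ x s) , cong suc l) (decrements-All ℓ)))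

-- The analogue of `D-∂` for e_c^⊥, which lowers each entry by at most one.
D-E : ∀ ℓ c γ → E c (D ℓ) γ ≡ ∑ (decrements ℓ) (λ m → ind (sum m ℕ.+ c) (sum ℓ) * D m γ)
D-E []      zero    γ = sym (ℤₚ.+-identityʳ _)
D-E []      (suc c) γ = trans (cong (sign (suc c) *_) (Ē-one c γ)) (ℤₚ.*-zeroʳ (sign (suc c)))
D-E (x ∷ ℓ) c γ = go x c
  where
  L = length ℓ
  term : ℕ → ℕ → List ℕ → ℤ
  term x c m = ind (sum m ℕ.+ c) (x ℕ.+ sum ℓ) * D m γ
  R : ℕ → ℕ → ℕ → ℤ
  R x c a = ∑ (decrements ℓ) (λ m → term x c (a ∷ m))
  top : ∀ x c → W (dif L x) (E c (D ℓ)) γ ≡ R x c x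
  top x c = begin
    W (dif L x) (E c (D ℓ)) γ
      ≡⟨ resp (W-lin (dif L x) γ) (D-E ℓ c) ⟩
    W (dif L x) (λ δ → ∑ (decrements ℓ) (λ m → ind (sum m ℕ.+ c) (sum ℓ) * D m δ)) γ
      ≡⟨ lin-∑* (W-lin (dif L x) γ) (decrements ℓ) (λ m → ind (sum m ℕ.+ c) (sum ℓ)) D ⟩
    ∑ (decrements ℓ) (λ m → ind (sum m ℕ.+ c) (sum ℓ) * W (dif L x) (D m) γ)
      ≡⟨ ∑-cong-All (All.map (λ {m} (_ , l) → cong₂ _*_
           (ind-cong (λ e → trans (ℕₚ.+-assoc x (sum m) c) (cong (x ℕ.+_) e))
                     (λ e → ℕₚ.+-cancelˡ-≡ x _ _ (trans (sym (ℕₚ.+-assoc x (sum m) c)) e)))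
           (cong (λ k → W (dif k x) (D m) γ) (sym l))) (decrements-All ℓ)) ⟩
    R x c x ∎
  R-0 : ∀ x → R (suc x) 0 x ≡ + 0
  R-0 x = ∑-0-All (All.map (λ {m} (s , _) → ind-no-* (D (x ∷ m) γ)
    (ℕₚ.<⇒≢ (s≤s (subst (ℕ._≤ x ℕ.+ sum ℓ) (sym (ℕₚ.+-identityʳ (x ℕ.+ sum m))) (ℕₚ.+-monoʳ-≤ x s))))) (decrements-All ℓ))
  E-0-W : ∀ x → E 0 (W (dif L x) (D ℓ)) γ ≡ R x 0 x
  E-0-W x = trans (E-0 (W (dif L x) (D ℓ)) γ)
    (trans (resp (W-lin (dif L x) γ) (λ δ → sym (E-0 (D ℓ) δ))) (top x 0))
  go : ∀ x c → E c (W (dif L x) (D ℓ)) γ ≡ ∑ (decrements (x ∷ ℓ)) (term x c)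
  go zero zero = trans (E-0-W 0) (sym (∑-map (0 ∷_) (decrements ℓ) (term 0 0)))
  go (suc x) zero = trans (E-0-W (suc x)) (trans (sym (ℤₚ.+-identityʳ (R (suc x) 0 (suc x))))
    (trans (+ˡ (R (suc x) 0 (suc x)) (sym (R-0 x))) (sym (∑-decrements-suc x ℓ (term (suc x) 0)))))
  go zero (suc c) = begin
    E (suc c) (W (+ L) (D ℓ)) γ                                   ≡⟨ E-suc-Op φW-lin c (+ L) (D-PI ℓ) γ ⟩
    W (+ L) (E (suc c) (D ℓ)) γ + W (+ suc L) (E c (D ℓ)) γ       ≡⟨ cong₂ _+_ (top 0 (suc c)) (W-pos-0 (suc L) (E-PI c (D-PI ℓ)) vanish γ) ⟩
    R 0 (suc c) 0 + + 0                                           ≡⟨ ℤₚ.+-identityʳ (R 0 (suc c) 0) ⟩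
    R 0 (suc c) 0                                                 ≡⟨ sym (∑-map (0 ∷_) (decrements ℓ) (term 0 (suc c))) ⟩
    ∑ (decrements (0 ∷ ℓ)) (term 0 (suc c))                       ∎
    where
    vanish : ∀ m → suc L ≤ m → Ē m (E c (D ℓ)) ≈ zeroS
    vanish m l δ = trans (scl (Ē-lin m δ) (sign c) (Ē c (D ℓ)))
      (trans (cong (sign c *_) (trans (Ē-comm m c (D-PI ℓ) δ) (lin-0 (Ē-lin c δ) (Ē-D-0 ℓ m l)))) (ℤₚ.*-zeroʳ (sign c)))
  go (suc x) (suc c) = begin
    E (suc c) (W (dif L (suc x)) (D ℓ)) γ
      ≡⟨ E-suc-Op φW-lin c (dif L (suc x)) (D-PI ℓ) γ ⟩
    W (dif L (suc x)) (E (suc c) (D ℓ)) γ + W (ℤ.suc (dif L (suc x))) (E c (D ℓ)) γ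
      ≡⟨ cong₂ _+_ (top (suc x) (suc c)) (trans (cong (λ z → W z (E c (D ℓ)) γ) (dif-suc L (suc x))) (trans (top x c)
           (∑-cong (decrements ℓ) (λ m → cong (λ s → ind s (suc x ℕ.+ sum ℓ) * D (x ∷ m) γ) (sym (ℕₚ.+-suc (x ℕ.+ sum m) c)))))) ⟩
    R (suc x) (suc c) (suc x) + R (suc x) (suc c) x
      ≡⟨ sym (∑-decrements-suc x ℓ (term (suc x) (suc c))) ⟩
    ∑ (decrements (suc x ∷ ℓ)) (term (suc x) (suc c)) ∎

vstrips : List ℕ → List (List ℕ)
vstrips []          = [ [] ]
vstrips (zero ∷ ν)  = map (0 ∷_) (vstrips ν)
vstrips (suc x ∷ ν) = map (suc x ∷_) (vstrips ν) ++ map (x ∷_) (filter (λ μ → headℕ μ ℕ.≤? x) (vstrips ν))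

∑-vstrips-suc : ∀ x ν (F : List ℕ → ℤ) → ∑ (vstrips (suc x ∷ ν)) F ≡
  ∑ (vstrips ν) (λ μ → F (suc x ∷ μ)) + ∑ (vstrips ν) (λ μ → boolℤ (does (headℕ μ ℕ.≤? x)) * F (x ∷ μ))
∑-vstrips-suc x ν F = trans (∑-++ (map (suc x ∷_) (vstrips ν)) _ F)
  (cong₂ _+_ (∑-map (suc x ∷_) (vstrips ν) F)
    (trans (∑-map (x ∷_) (filter (λ μ → headℕ μ ℕ.≤? x) (vstrips ν)) F)
           (∑-filter (λ μ → headℕ μ ℕ.≤? x) (vstrips ν) (λ μ → F (x ∷ μ)))))

vstrips-All : ∀ ν → Desc ν → All (λ μ → length μ ≡ length ν × Desc μ × headℕ μ ≤ headℕ ν) (vstrips ν)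
vstrips-All []          d = (refl , [] , z≤n) ∷ []
vstrips-All (zero ∷ ν)  d = Allₚ.map⁺ (All.map (λ (l , dμ , h) → cong suc l , Desc-∷ (ℕₚ.≤-trans h (Desc-head d)) dμ , z≤n)
  (vstrips-All ν (Desc-tail d)))
vstrips-All (suc x ∷ ν) d = Allₚ.++⁺
  (Allₚ.map⁺ (All.map (λ (l , dμ , h) → cong suc l , Desc-∷ (ℕₚ.≤-trans h (Desc-head d)) dμ , ℕₚ.≤-refl) IH))
  (Allₚ.map⁺ (All.zipWith (λ (h , l , dμ , _) → cong suc l , Desc-∷ h dμ , ℕₚ.n≤1+n x)
    (Allₚ.all-filter (λ μ → headℕ μ ℕ.≤? x) (vstrips ν) , Allₚ.filter⁺ (λ μ → headℕ μ ℕ.≤? x) IH)))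
  where IH = vstrips-All ν (Desc-tail d)

Alt-equal : ∀ {F} → Alt F → ∀ x ℓ → F (x ∷ x ∷ ℓ) ≡ + 0
Alt-equal alt x ℓ = self-neg⇒0 _ (alt [] x x ℓ)

-- Decrements of shift ν that are not strictly decreasing have two equal adjacent entries.
∑-decrements-shift : ∀ {F} → Alt F → ∀ ν → Desc ν → ∑ (decrements (shift ν)) F ≡ ∑ (vstrips ν) (F ∘ shift)
∑-decrements-shift alt [] d = refl
∑-decrements-shift {F} alt (x ∷ ν) d = go x (length ν) refl d
  where
  IH : ∀ p → ∑ (decrements (shift ν)) (λ m → F (p ∷ m)) ≡ ∑ (vstrips ν) (λ μ → F (p ∷ shift μ))
  IH p = ∑-decrements-shift (Alt-∷ {F} p alt) ν (Desc-tail d)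
  keep : ∀ x → ∑ (vstrips ν) (λ μ → F (x ℕ.+ length ν ∷ shift μ)) ≡ ∑ (vstrips ν) (λ μ → F (shift (x ∷ μ)))
  keep x = ∑-cong-All (All.map (λ {μ} (l , _) → cong (λ L → F (x ℕ.+ L ∷ shift μ)) (sym l)) (vstrips-All ν (Desc-tail d)))
  go : ∀ x L → L ≡ length ν → Desc (x ∷ ν) →
       ∑ (decrements (x ℕ.+ length ν ∷ shift ν)) F ≡ ∑ (vstrips (x ∷ ν)) (F ∘ shift)
  go zero L e d with length ν in eqL
  ... | zero = trans (∑-map (0 ∷_) (decrements (shift ν)) F)
    (trans (IH 0) (trans (trans (cong (λ L → ∑ (vstrips ν) (λ μ → F (L ∷ shift μ))) (sym eqL)) (keep 0))
                         (sym (∑-map (0 ∷_) (vstrips ν) (F ∘ shift)))))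
  ... | suc L′ = begin
    ∑ (decrements (suc L′ ∷ shift ν)) F
      ≡⟨ ∑-decrements-suc L′ (shift ν) F ⟩
    ∑ (decrements (shift ν)) (λ m → F (suc L′ ∷ m)) + ∑ (decrements (shift ν)) (λ m → F (L′ ∷ m))
      ≡⟨ cong₂ _+_ (trans (IH (suc L′)) (trans (cong (λ L → ∑ (vstrips ν) (λ μ → F (L ∷ shift μ))) (sym eqL)) (keep 0)))
                   (trans (IH L′) (∑-0-All (All.map vanish (vstrips-All ν (Desc-tail d))))) ⟩
    ∑ (vstrips ν) (λ μ → F (shift (0 ∷ μ))) + + 0
      ≡⟨ ℤₚ.+-identityʳ _ ⟩
    ∑ (vstrips ν) (λ μ → F (shift (0 ∷ μ)))
      ≡⟨ sym (∑-map (0 ∷_) (vstrips ν) (F ∘ shift)) ⟩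
    ∑ (vstrips (0 ∷ ν)) (F ∘ shift) ∎
    where
    -- All parts are zero, so the lowered first entry equals the second.
    vanish : ∀ {μ} → length μ ≡ length ν × Desc μ × headℕ μ ≤ headℕ ν → F (L′ ∷ shift μ) ≡ + 0
    vanish {[]}    (l , _)     = case trans l eqL of λ ()
    vanish {y ∷ μ} (l , _ , h) with ℕₚ.n≤0⇒n≡0 (ℕₚ.≤-trans h (Desc-head d)) | ℕₚ.suc-injective (trans l eqL)
    ... | refl | refl = Alt-equal {F} alt (length μ) (shift μ)
  go (suc x) L e d = begin
    ∑ (decrements (suc (x ℕ.+ length ν) ∷ shift ν)) F
      ≡⟨ ∑-decrements-suc (x ℕ.+ length ν) (shift ν) F ⟩
    ∑ (decrements (shift ν)) (λ m → F (suc (x ℕ.+ length ν) ∷ m)) + ∑ (decrements (shift ν)) (λ m → F (x ℕ.+ length ν ∷ m))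
      ≡⟨ cong₂ _+_ (trans (IH (suc (x ℕ.+ length ν))) (keep (suc x)))
           (trans (IH (x ℕ.+ length ν)) (∑-cong-All (All.map select (vstrips-All ν (Desc-tail d))))) ⟩
    ∑ (vstrips ν) (λ μ → F (shift (suc x ∷ μ))) +
      ∑ (vstrips ν) (λ μ → boolℤ (does (headℕ μ ℕ.≤? x)) * F (shift (x ∷ μ)))
      ≡⟨ sym (∑-vstrips-suc x ν (F ∘ shift)) ⟩
    ∑ (vstrips (suc x ∷ ν)) (F ∘ shift) ∎
    where
    select′ : ∀ {μ} (h? : Dec (headℕ μ ≤ x)) → length μ ≡ length ν × Desc μ × headℕ μ ≤ headℕ ν →
              F (x ℕ.+ length ν ∷ shift μ) ≡ boolℤ (does h?) * F (shift (x ∷ μ))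
    select′ {μ} (yes h≤x) (l , _ , h) = trans (cong (λ L → F (x ℕ.+ L ∷ shift μ)) (sym l)) (sym (ℤₚ.*-identityˡ _))
    select′ {[]}    (no h≰x) (l , _ , h) = ⊥-elim (h≰x z≤n)
    -- Here the first part of μ is x + 1, so the lowered first entry repeats the next one.
    select′ {y ∷ μ} (no h≰x) (l , _ , h) with ℕₚ.≤-antisym (ℕₚ.≤-trans h (Desc-head d)) (ℕₚ.≰⇒> h≰x)
    ... | refl = trans (cong (λ p → F (p ∷ shift (suc x ∷ μ))) (trans (cong (x ℕ.+_) (sym l)) (ℕₚ.+-suc x (length μ))))
                       (Alt-equal {F} alt (suc (x ℕ.+ length μ)) (shift μ))
    select : ∀ {μ} → length μ ≡ length ν × Desc μ × headℕ μ ≤ headℕ ν →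
             F (x ℕ.+ length ν ∷ shift μ) ≡ boolℤ (does (headℕ μ ℕ.≤? x)) * F (shift (x ∷ μ))
    select {μ} = select′ (headℕ μ ℕ.≤? x)

-- Conjugation

-- Adding a row of x cells makes the first x columns longer by one.
inc : ℕ → List ℕ → List ℕ
inc zero    κ       = κ
inc (suc x) []      = []
inc (suc x) (k ∷ κ) = suc k ∷ inc x κ

-- the conjugate partition, padded with zeros to length N
conjugate : ℕ → List ℕ → List ℕ
conjugate N []      = replicate N 0
conjugate N (x ∷ ν) = inc x (conjugate N ν)

-- Trades the columnwise definition for recursion on rows, where N can stay fixed while strips are
-- removed.
conj≡conjugate : ∀ ν → conj ν ≡ conjugate (headℕ ν) ν
conj≡conjugate ν = trans (Lₚ.map-upTo (column ν) (headℕ ν)) (go (headℕ ν) ν)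
  where
  column : List ℕ → ℕ → ℕ
  column ν j = length (filter (λ x → j <? x) ν)
  zeros : ∀ N → applyUpTo (λ _ → 0) N ≡ replicate N 0
  zeros zero    = refl
  zeros (suc N) = cong (0 ∷_) (zeros N)
  applyUpTo-cong : ∀ {f g : ℕ → ℕ} N → (∀ i → f i ≡ g i) → applyUpTo f N ≡ applyUpTo g N
  applyUpTo-cong zero    e = refl
  applyUpTo-cong (suc N) e = cong₂ _∷_ (e 0) (applyUpTo-cong N (e ∘ suc))
  step : ∀ x N c → applyUpTo (λ j → if does (j <? x) then suc (c j) else c j) N ≡ inc x (applyUpTo c N)
  step zero    N       c = refl
  step (suc x) zero    c = refl
  step (suc x) (suc N) c = cong (suc (c 0) ∷_) (step x N (c ∘ suc))
  column-∷ : ∀ x ν j → column (x ∷ ν) j ≡ (if does (j <? x) then suc (column ν j) else column ν j)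
  column-∷ x ν j with does (j <? x)
  ... | true  = refl
  ... | false = refl
  go : ∀ N ν → applyUpTo (column ν) N ≡ conjugate N ν
  go N []      = zeros N
  go N (x ∷ ν) = trans (applyUpTo-cong N (column-∷ x ν)) (trans (step x N (column ν)) (cong (inc x) (go N ν)))

ZeroFrom : ℕ → List ℕ → Set
ZeroFrom zero    κ       = All (_≡ 0) κ
ZeroFrom (suc x) []      = ⊤
ZeroFrom (suc x) (k ∷ κ) = ZeroFrom x κ

ZeroFrom-≤ : ∀ x y κ → x ≤ y → ZeroFrom x κ → ZeroFrom y κ
ZeroFrom-≤ zero    zero    κ       l z       = z
ZeroFrom-≤ zero    (suc y) []      l z       = tt
ZeroFrom-≤ zero    (suc y) (k ∷ κ) l (_ ∷ z) = ZeroFrom-≤ 0 y κ z≤n z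
ZeroFrom-≤ (suc x) (suc y) []      l z       = tt
ZeroFrom-≤ (suc x) (suc y) (k ∷ κ) (s≤s l) z = ZeroFrom-≤ x y κ l z

ZeroFrom-inc : ∀ x κ → ZeroFrom x κ → ZeroFrom x (inc x κ)
ZeroFrom-inc zero    κ       z = z
ZeroFrom-inc (suc x) []      z = z
ZeroFrom-inc (suc x) (k ∷ κ) z = ZeroFrom-inc x κ z

conjugate-ZeroFrom : ∀ N ν x → Desc ν → headℕ ν ≤ x → ZeroFrom x (conjugate N ν)
conjugate-ZeroFrom N []      x d h = ZeroFrom-≤ 0 x (replicate N 0) z≤n (Allₚ.replicate⁺ N refl)
conjugate-ZeroFrom N (y ∷ ν) x d h = ZeroFrom-≤ y x (inc y (conjugate N ν)) h
  (ZeroFrom-inc y (conjugate N ν) (conjugate-ZeroFrom N ν y (Desc-tail d) (Desc-head d)))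

length-inc : ∀ x κ → length (inc x κ) ≡ length κ
length-inc zero    κ       = refl
length-inc (suc x) []      = refl
length-inc (suc x) (k ∷ κ) = cong suc (length-inc x κ)

length-conjugate : ∀ N ν → length (conjugate N ν) ≡ N
length-conjugate N []      = Lₚ.length-replicate N
length-conjugate N (x ∷ ν) = trans (length-inc x _) (length-conjugate N ν)

sum-inc : ∀ x κ → x ≤ length κ → sum (inc x κ) ≡ x ℕ.+ sum κ
sum-inc zero    κ       l       = refl
sum-inc (suc x) (k ∷ κ) (s≤s l) = cong suc (trans (cong (k ℕ.+_) (sum-inc x κ l)) (arrange k x (sum κ)))
  where
  arrange : ∀ k x s → k ℕ.+ (x ℕ.+ s) ≡ x ℕ.+ (k ℕ.+ s)
  arrange = ℕ-solve-∀

sum-conjugate : ∀ N ν → Desc ν → headℕ ν ≤ N → sum (conjugate N ν) ≡ sum ν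
sum-conjugate N []      d h = zeros N
  where
  zeros : ∀ N → sum (replicate N 0) ≡ 0
  zeros zero    = refl
  zeros (suc N) = zeros N
sum-conjugate N (x ∷ ν) d h = trans
  (sum-inc x (conjugate N ν) (subst (x ≤_) (sym (length-conjugate N ν)) h))
  (cong (x ℕ.+_) (sum-conjugate N ν (Desc-tail d) (ℕₚ.≤-trans (Desc-head d) h)))

headℕ-inc-≤ : ∀ x κ {k} → headℕ κ ≤ k → headℕ (inc x κ) ≤ suc k
headℕ-inc-≤ zero    κ       h = ℕₚ.m≤n⇒m≤1+n h
headℕ-inc-≤ (suc x) []      h = z≤n
headℕ-inc-≤ (suc x) (_ ∷ _) h = s≤s h

inc-Desc : ∀ x κ → Desc κ → Desc (inc x κ)
inc-Desc zero    κ       d = d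
inc-Desc (suc x) []      d = d
inc-Desc (suc x) (k ∷ κ) d = Desc-∷ (headℕ-inc-≤ x κ (Desc-head d)) (inc-Desc x κ (Desc-tail d))

conjugate-Desc : ∀ N ν → Desc (conjugate N ν)
conjugate-Desc N (x ∷ ν) = inc-Desc x _ (conjugate-Desc N ν)
conjugate-Desc zero          [] = []
conjugate-Desc (suc zero)    [] = [-]
conjugate-Desc (suc (suc N)) [] = z≤n ∷ conjugate-Desc (suc N) []

part : ℕ → List ℕ → ℕ
part i       []      = 0
part zero    (k ∷ κ) = k
part (suc i) (k ∷ κ) = part i κ

∑-interlace-zeros : ∀ k κ → All (_≡ 0) κ → ∀ (F : List ℕ → ℤ) →
  ∑ (interlace (k ∷ κ)) F ≡ ∑ (upTo (suc k)) (λ t → ∑ (interlace κ) (λ μ → F (t ∷ μ)))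
∑-interlace-zeros k []      z          F = trans (∑-interlace-[] k F)
  (∑-cong (upTo (suc k)) (λ t → sym (ℤₚ.+-identityʳ (F (t ∷ [])))))
∑-interlace-zeros k (_ ∷ κ) (refl ∷ z) F = ∑-interlace-∷ k 0 κ F

-- An interlacer of inc (suc x) κ is inc (suc x) m or, when m_x = 0, inc x m for an interlacer m of κ.
∑-interlace-inc : ∀ x κ → ZeroFrom (suc x) κ → x < length κ → ∀ (F : List ℕ → ℤ) →
  ∑ (interlace (inc (suc x) κ)) F ≡
  ∑ (interlace κ) (λ m → F (inc (suc x) m)) + ∑ (interlace κ) (λ m → ind (part x m) 0 * F (inc x m))
∑-interlace-inc zero (k ∷ κ) z l F = begin
  ∑ (interlace (suc k ∷ κ)) F
    ≡⟨ ∑-interlace-zeros (suc k) κ z F ⟩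
  ∑ (upTo (suc (suc k))) I
    ≡⟨ trans (∑-upTo-suc (suc k) I) (ℤₚ.+-comm (I 0) (∑ (upTo (suc k)) (I ∘ suc))) ⟩
  ∑ (upTo (suc k)) (I ∘ suc) + I 0
    ≡⟨ cong₂ _+_ (sym (∑-interlace-zeros k κ z (λ m → F (inc 1 m)))) (sym (begin
         ∑ (interlace (k ∷ κ)) (λ m → ind (part 0 m) 0 * F m)
           ≡⟨ ∑-interlace-zeros k κ z (λ m → ind (part 0 m) 0 * F m) ⟩
         ∑ (upTo (suc k)) (λ t → ∑ (interlace κ) (λ μ → ind t 0 * F (t ∷ μ)))
           ≡⟨ ∑-upTo-single (suc k) 0 {λ t → ∑ (interlace κ) (λ μ → ind t 0 * F (t ∷ μ))} (s≤s z≤n)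
                (λ t ne → ∑-0 (interlace κ) (λ μ → ind-no-* (F (t ∷ μ)) ne)) ⟩
         ∑ (interlace κ) (λ μ → + 1 * F (0 ∷ μ))
           ≡⟨ ∑-cong (interlace κ) (λ μ → ℤₚ.*-identityˡ (F (0 ∷ μ))) ⟩
         I 0 ∎)) ⟩
  ∑ (interlace (k ∷ κ)) (λ m → F (inc 1 m)) + ∑ (interlace (k ∷ κ)) (λ m → ind (part 0 m) 0 * F m) ∎
  where
  I : ℕ → ℤ
  I t = ∑ (interlace κ) (λ μ → F (t ∷ μ))
∑-interlace-inc (suc x) (k ∷ []) z (s≤s ()) F
∑-interlace-inc (suc x) (k ∷ k′ ∷ κ) z (s≤s l) F = begin
  ∑ (interlace (suc k ∷ suc k′ ∷ inc x κ)) F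
    ≡⟨ ∑-interlace-∷ (suc k) (suc k′) (inc x κ) F ⟩
  ∑ ts (λ t → ∑ (interlace (inc (suc x) (k′ ∷ κ))) (λ μ → F (suc k′ ℕ.+ t ∷ μ)))
    ≡⟨ ∑-cong ts (λ t → ∑-interlace-inc x (k′ ∷ κ) z l (λ μ → F (suc k′ ℕ.+ t ∷ μ))) ⟩
  ∑ ts (λ t → ∑ (interlace (k′ ∷ κ)) (λ m → F (suc k′ ℕ.+ t ∷ inc (suc x) m)) +
              ∑ (interlace (k′ ∷ κ)) (λ m → ind (part x m) 0 * F (suc k′ ℕ.+ t ∷ inc x m)))
    ≡⟨ ∑-+ ts (λ t → ∑ (interlace (k′ ∷ κ)) (λ m → F (suc k′ ℕ.+ t ∷ inc (suc x) m))) _ ⟩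
  ∑ ts (λ t → ∑ (interlace (k′ ∷ κ)) (λ m → F (suc k′ ℕ.+ t ∷ inc (suc x) m))) +
  ∑ ts (λ t → ∑ (interlace (k′ ∷ κ)) (λ m → ind (part x m) 0 * F (suc k′ ℕ.+ t ∷ inc x m)))
    ≡⟨ sym (cong₂ _+_ (∑-interlace-∷ k k′ κ (λ m → F (inc (suc (suc x)) m)))
                      (∑-interlace-∷ k k′ κ (λ m → ind (part (suc x) m) 0 * F (inc (suc x) m)))) ⟩
  ∑ (interlace (k ∷ k′ ∷ κ)) (λ m → F (inc (suc (suc x)) m)) +
  ∑ (interlace (k ∷ k′ ∷ κ)) (λ m → ind (part (suc x) m) 0 * F (inc (suc x) m)) ∎
  where ts = upTo (suc (k ∸ k′))

part-ZeroFrom : ∀ x κ → ZeroFrom x κ → part x κ ≡ 0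
part-ZeroFrom x       []      z       = refl
part-ZeroFrom zero    (k ∷ κ) (e ∷ _) = e
part-ZeroFrom (suc x) (k ∷ κ) z       = part-ZeroFrom x κ z

part-inc : ∀ x y κ → x < y → x < length κ → part x (inc y κ) ≢ 0
part-inc zero    (suc y) (k ∷ κ) l       m       = λ ()
part-inc (suc x) (suc y) (k ∷ κ) (s≤s l) (s≤s m) = part-inc x y κ l m

-- Conjugation exchanges horizontal and vertical strips. The column of μ with index x is empty
-- exactly if the first row is at most x, which is the condition in `vstrips`.
∑-interlace-conjugate : ∀ N ν → Desc ν → headℕ ν ≤ N → ∀ (F : List ℕ → ℤ) →
  ∑ (interlace (conjugate N ν)) F ≡ ∑ (vstrips ν) (λ μ → F (conjugate N μ))
∑-interlace-conjugate N [] d h F = zeros N F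
  where
  zeros : ∀ N (F : List ℕ → ℤ) → ∑ (interlace (replicate N 0)) F ≡ F (replicate N 0) + + 0
  zeros zero    F = refl
  zeros (suc N) F = trans (∑-interlace-zeros 0 (replicate N 0) (Allₚ.replicate⁺ N refl) F)
    (trans (ℤₚ.+-identityʳ _) (zeros N (λ μ → F (0 ∷ μ))))
∑-interlace-conjugate N (zero ∷ ν) d h F = trans
  (∑-interlace-conjugate N ν (Desc-tail d) (ℕₚ.≤-trans (Desc-head d) z≤n) F)
  (sym (∑-map (0 ∷_) (vstrips ν) (λ μ → F (conjugate N μ))))
∑-interlace-conjugate N (suc x ∷ ν) d h F = begin
  ∑ (interlace (inc (suc x) κ)) F
    ≡⟨ ∑-interlace-inc x κ (conjugate-ZeroFrom N ν (suc x) (Desc-tail d) (Desc-head d)) (subst (x <_) (sym (length-conjugate N ν)) h) F ⟩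
  ∑ (interlace κ) (λ m → F (inc (suc x) m)) + ∑ (interlace κ) (λ m → ind (part x m) 0 * F (inc x m))
    ≡⟨ cong₂ _+_ (IH (λ m → F (inc (suc x) m))) (trans (IH (λ m → ind (part x m) 0 * F (inc x m)))
         (∑-cong-All (All.map (λ {μ} (_ , dμ , _) → cong (_* F (inc x (conjugate N μ))) (test μ dμ (headℕ μ ℕ.≤? x)))
           (vstrips-All ν (Desc-tail d))))) ⟩
  ∑ (vstrips ν) (λ μ → F (conjugate N (suc x ∷ μ))) +
  ∑ (vstrips ν) (λ μ → boolℤ (does (headℕ μ ℕ.≤? x)) * F (conjugate N (x ∷ μ)))
    ≡⟨ sym (∑-vstrips-suc x ν (λ μ → F (conjugate N μ))) ⟩
  ∑ (vstrips (suc x ∷ ν)) (λ μ → F (conjugate N μ)) ∎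
  where
  κ = conjugate N ν
  IH = ∑-interlace-conjugate N ν (Desc-tail d) (ℕₚ.≤-trans (Desc-head d) h)
  test : ∀ μ → Desc μ → (h? : Dec (headℕ μ ≤ x)) → ind (part x (conjugate N μ)) 0 ≡ boolℤ (does h?)
  test μ       dμ (yes h≤x) = ind-yes (part-ZeroFrom x (conjugate N μ) (conjugate-ZeroFrom N μ x dμ h≤x))
  test []      dμ (no  h≰x) = ⊥-elim (h≰x z≤n)
  test (y ∷ μ) dμ (no  h≰x) = ind-no (part-inc x y (conjugate N μ) (ℕₚ.≰⇒> h≰x) (subst (x <_) (sym (length-conjugate N μ)) h))

-- Both sides obey one recursion in γ: e_c^⊥ removes vertical strips from ν, h_c^⊥ horizontal strips
-- from the conjugate.
ω-D : ∀ γ N ν → Desc ν → headℕ ν ≤ N → ω (D (shift ν)) γ ≡ D (shift (conjugate N ν)) γ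
ω-D [] N ν d h = begin
  + 1 * D (shift ν) []                        ≡⟨ trans (ℤₚ.*-identityˡ _) (D-const ν) ⟩
  + kostkaRev ν []                            ≡⟨ cong (λ s → + (if s ≡ᵇ 0 then 1 else 0)) (sym (sum-conjugate N ν d h)) ⟩
  + kostkaRev (conjugate N ν) []              ≡⟨ sym (D-const (conjugate N ν)) ⟩
  D (shift (conjugate N ν)) []                ∎
ω-D (c ∷ γ) N ν d h = begin
  ω (D (shift ν)) (c ∷ γ)
    ≡⟨ trans (ω-∷ (D (shift ν)) c γ) (resp (ω-lin γ) (D-E (shift ν) c)) ⟩
  ω (λ δ → ∑ (decrements (shift ν)) (λ m → ind (sum m ℕ.+ c) (sum (shift ν)) * D m δ)) γ
    ≡⟨ lin-∑* (ω-lin γ) (decrements (shift ν)) (λ m → ind (sum m ℕ.+ c) (sum (shift ν))) D ⟩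
  ∑ (decrements (shift ν)) (λ m → ind (sum m ℕ.+ c) (sum (shift ν)) * ω (D m) γ)
    ≡⟨ ∑-decrements-shift (Alt-graded (λ m → ω (D m) γ) c (sum (shift ν)) alt) ν d ⟩
  ∑ (vstrips ν) (λ μ → ind (sum (shift μ) ℕ.+ c) (sum (shift ν)) * ω (D (shift μ)) γ)
    ≡⟨ ∑-cong-All (All.map (λ {μ} (l , dμ , hμ) → cong₂ _*_
         (trans (ind-shift c μ ν l) (cong₂ (λ a b → ind a (c ℕ.+ b)) (sym (sum-conjugate N ν d h))
                                       (sym (sum-conjugate N μ dμ (ℕₚ.≤-trans hμ h)))))
         (ω-D γ N μ dμ (ℕₚ.≤-trans hμ h))) (vstrips-All ν d)) ⟩
  ∑ (vstrips ν) (λ μ → ind (sum (conjugate N ν)) (c ℕ.+ sum (conjugate N μ)) * D (shift (conjugate N μ)) γ)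
    ≡⟨ sym (∑-interlace-conjugate N ν d h (λ κ → ind (sum (conjugate N ν)) (c ℕ.+ sum κ) * D (shift κ) γ)) ⟩
  ∑ (interlace (conjugate N ν)) (λ κ → ind (sum (conjugate N ν)) (c ℕ.+ sum κ) * D (shift κ) γ)
    ≡⟨ sym (D-strips (conjugate N ν) (conjugate-Desc N ν) c γ) ⟩
  D (shift (conjugate N ν)) (c ∷ γ) ∎
  where
  alt : Alt (λ m → ω (D m) γ)
  alt pre x y post = trans (resp (ω-lin γ) (λ δ → D-Alt δ pre x y post)) (lin-neg (ω-lin γ) (D (pre ++ y ∷ x ∷ post)))

conj-Desc : ∀ ν → Desc (conj ν)
conj-Desc ν = subst Desc (sym (conj≡conjugate ν)) (conjugate-Desc (headℕ ν) ν)

sum-conj : ∀ ν → Desc ν → sum (conj ν) ≡ sum ν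
sum-conj ν d = trans (cong sum (conj≡conjugate ν)) (sum-conjugate (headℕ ν) ν d ℕₚ.≤-refl)

ω-D-conj : ∀ ν → Desc ν → ω (D (shift ν)) ≈ D (shift (conj ν))
ω-D-conj ν d γ = trans (ω-D γ (headℕ ν) ν d ℕₚ.≤-refl) (cong (λ κ → D (shift κ) γ) (sym (conj≡conjugate ν)))

-- Dual Cauchy kernel

⊛-assoc : ∀ γ f g h → ((f ⊛ g) ⊛ h) γ ≡ (f ⊛ (g ⊛ h)) γ
⊛-assoc [] f g h = begin
  ((f ⊛ g) ⊛ h) []      ≡⟨ trans (⊛-[] (f ⊛ g) h) (cong (_* h []) (⊛-[] f g)) ⟩
  f [] * g [] * h []    ≡⟨ ℤₚ.*-assoc (f []) (g []) (h []) ⟩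
  f [] * (g [] * h [])  ≡⟨ sym (trans (⊛-[] f (g ⊛ h)) (cong (f [] *_) (⊛-[] g h))) ⟩
  (f ⊛ (g ⊛ h)) []      ∎
⊛-assoc (c ∷ γ) f g h = begin
  ((f ⊛ g) ⊛ h) (c ∷ γ)
    ≡⟨ ⊛-∷ (f ⊛ g) h c γ ⟩
  C c (λ p k → (∂ p (f ⊛ g) ⊛ ∂ k h) γ)
    ≡⟨ C-cong c (λ p k → trans (resp (⊛-linˡ (∂ k h) γ) (⊛-∷ f g p)) (lin-C (⊛-linˡ (∂ k h) γ) p (λ a b → ∂ a f ⊛ ∂ b g))) ⟩
  C c (λ p k → C p (λ a b → ((∂ a f ⊛ ∂ b g) ⊛ ∂ k h) γ))
    ≡⟨ C-assoc c (λ a b k → ((∂ a f ⊛ ∂ b g) ⊛ ∂ k h) γ) ⟩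
  C c (λ a q → C q (λ b k → ((∂ a f ⊛ ∂ b g) ⊛ ∂ k h) γ))
    ≡⟨ C-cong c (λ a q → trans (C-cong q (λ b k → ⊛-assoc γ (∂ a f) (∂ b g) (∂ k h)))
         (sym (trans (resp (⊛-linʳ (∂ a f) γ) (⊛-∷ g h q)) (lin-C (⊛-linʳ (∂ a f) γ) q (λ b k → ∂ b g ⊛ ∂ k h))))) ⟩
  C c (λ a q → (∂ a f ⊛ ∂ q (g ⊛ h)) γ)
    ≡⟨ sym (⊛-∷ f (g ⊛ h) c γ) ⟩
  (f ⊛ (g ⊛ h)) (c ∷ γ) ∎

eProd-PI : ∀ ρ → PI (eProd ρ)
eProd-PI []      = PI-hS 0
eProd-PI (j ∷ ρ) = ⊛-PI (eS-PI j) (eProd-PI ρ)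

eProd-homogeneous : ∀ ρ → Homogeneous (sum ρ) (eProd ρ)
eProd-homogeneous []      = hS-homogeneous 0
eProd-homogeneous (j ∷ ρ) = ⊛-homogeneous {j} {sum ρ} (eS-homogeneous j) (eProd-homogeneous ρ)

module Kernel (ip : ℕ → Series → Series → ℤ) (hall : IsHallPairing ip)
              (perp : Series → Series → Series) (skew : IsSkewing ip perp) where
  open Hall ip hall
  open Skewing ip hall perp skew

  e-schur-expansion : ∀ α → eProd α ≈ λ γ → ∑ (partitionsOf (sum α)) (λ ν → D (shift ν) α * D (shift (conj ν)) γ)
  e-schur-expansion α γ = begin
    eProd α γ
      ≡⟨ sym (ω-hProd α γ) ⟩
    ω (hProd α) γ
      ≡⟨ resp (ω-lin γ) (h-schur-expansion α) ⟩
    ω (λ δ → ∑ (partitionsOf (sum α)) (λ ν → D (shift ν) α * D (shift ν) δ)) γ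
      ≡⟨ lin-∑* (ω-lin γ) (partitionsOf (sum α)) (λ ν → D (shift ν) α) (λ ν → D (shift ν)) ⟩
    ∑ (partitionsOf (sum α)) (λ ν → D (shift ν) α * ω (D (shift ν)) γ)
      ≡⟨ ∑-cong-All (All.map (λ {ν} ((d , _) , _) → cong (D (shift ν) α *_) (ω-D-conj ν d γ)) (partitionsOf-All (sum α))) ⟩
    ∑ (partitionsOf (sum α)) (λ ν → D (shift ν) α * D (shift (conj ν)) γ) ∎

  Ē-Sym : ∀ j {f} → Sym f → Sym (Ē j f)
  Ē-Sym j {f} s = Sym-resp (signed-perp-e j s)
    (H-span-Sym (scale (sign j) (Sym⇒H-span (proj₁ (skew (eS j) j (eS-Sym j) (eS-homogeneous j) f s)))))

  -- Each e_j moves to the other side as (-1)^j Ē j; the remaining h_γ reads off a coefficient.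
  ip-eProd : ∀ α {f} → Sym f → ∀ γ → ip (sum γ ℕ.+ sum α) f (eProd α ⊛ hProd γ) ≡ sign (sum α) * M f γ α
  ip-eProd [] {f} s γ = begin
    ip (sum γ ℕ.+ 0) f (hProd (0 ∷ γ))          ≡⟨ ip-h (sum γ ℕ.+ 0) (0 ∷ γ) s ⟩
    ind (sum γ) (sum γ ℕ.+ 0) * f (0 ∷ γ)       ≡⟨ cong₂ _*_ (ind-yes (sym (ℕₚ.+-identityʳ (sum γ)))) (pad (Sym⇒PI s) γ) ⟩
    + 1 * f γ                                   ∎
  ip-eProd (j ∷ α) {f} s γ = begin
    ip (sum γ ℕ.+ (j ℕ.+ sum α)) f ((eS j ⊛ eProd α) ⊛ hProd γ)
      ≡⟨ resp (ip-linʳ (sum γ ℕ.+ (j ℕ.+ sum α)) f) (λ δ → ⊛-assoc δ (eS j) (eProd α) (hProd γ)) ⟩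
    ip (sum γ ℕ.+ (j ℕ.+ sum α)) f (eS j ⊛ u)
      ≡⟨ cong (λ n → ip n f (eS j ⊛ u)) (arrange (sum γ) j (sum α)) ⟩
    ip (sum γ ℕ.+ sum α ℕ.+ j) f (eS j ⊛ u)
      ≡⟨ sym (proj₂ (skew (eS j) j (eS-Sym j) (eS-homogeneous j) f s) (sum γ ℕ.+ sum α) u u-Sym) ⟩
    ip (sum γ ℕ.+ sum α) (perp (eS j) f) u
      ≡⟨ resp (ip-linˡ (sum γ ℕ.+ sum α) u) (perp-e j s) ⟩
    ip (sum γ ℕ.+ sum α) (sign j · Ē j f) u
      ≡⟨ scl (ip-linˡ (sum γ ℕ.+ sum α) u) (sign j) (Ē j f) ⟩
    sign j * ip (sum γ ℕ.+ sum α) (Ē j f) u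
      ≡⟨ cong (sign j *_) (ip-eProd α (Ē-Sym j s) γ) ⟩
    sign j * (sign (sum α) * M (Ē j f) γ α)
      ≡⟨ trans (sym (ℤₚ.*-assoc (sign j) (sign (sum α)) _)) (cong (_* M (Ē j f) γ α) (sym (sign-+ j (sum α)))) ⟩
    sign (j ℕ.+ sum α) * M f γ (j ∷ α) ∎
    where
    u = eProd α ⊛ hProd γ
    u-Sym : Sym u
    u-Sym = Homogeneous-Sym (⊛-PI (eProd-PI α) (hProd-PI γ))
      (⊛-homogeneous {sum α} {sum γ} (eProd-homogeneous α) (hProd-homogeneous γ))
    arrange : ∀ g j a → g ℕ.+ (j ℕ.+ a) ≡ g ℕ.+ a ℕ.+ j
    arrange = ℕ-solve-∀

  -- The coefficient of s_{ν'}^⊥ f at ε is the pairing of f with s_{ν'} h_ε, so the sum over ν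
  -- becomes the pairing with e_α h_ε.
  kernel : ∀ α {f} → Sym f → ∀ ε →
           ∑ (partitionsOf (sum α)) (λ ν → D (shift ν) α * perp (schurS (conj ν)) f ε) ≡ sign (sum α) * M f ε α
  kernel α {f} s ε = begin
    ∑ (partitionsOf n) (λ ν → D (shift ν) α * perp (schurS (conj ν)) f ε)
      ≡⟨ ∑-cong-All (All.map (λ {ν} ((d , _) , q) → cong (D (shift ν) α *_) (coefficient ν d q)) (partitionsOf-All n)) ⟩
    ∑ (partitionsOf n) (λ ν → D (shift ν) α * ip (sum ε ℕ.+ n) f (D (shift (conj ν)) ⊛ hProd ε))
      ≡⟨ sym (lin-∑* L (partitionsOf n) (λ ν → D (shift ν) α) (λ ν → D (shift (conj ν)))) ⟩
    ip (sum ε ℕ.+ n) f ((λ γ → ∑ (partitionsOf n) (λ ν → D (shift ν) α * D (shift (conj ν)) γ)) ⊛ hProd ε)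
      ≡⟨ sym (resp L (e-schur-expansion α)) ⟩
    ip (sum ε ℕ.+ n) f (eProd α ⊛ hProd ε)
      ≡⟨ ip-eProd α s ε ⟩
    sign n * M f ε α ∎
    where
    n = sum α
    L : Lin (λ g → ip (sum ε ℕ.+ n) f (g ⊛ hProd ε))
    L = ∘-lin (ip-linʳ (sum ε ℕ.+ n) f) (⊛-linˡ (hProd ε))
    coefficient : ∀ ν → Desc ν → sum ν ≡ n →
                  perp (schurS (conj ν)) f ε ≡ ip (sum ε ℕ.+ n) f (D (shift (conj ν)) ⊛ hProd ε)
    coefficient ν d q = trans
      (perp-coefficient n (Sym-resp (λ γ → sym (schur≈ γ)) (D-Sym (conj ν) (conj-Desc ν)))
        (λ γ ne → trans (schur≈ γ) (D-homogeneous γ (conj ν) (conj-Desc ν) (λ e → ne (trans e (trans (sum-conj ν d) q))))) s ε)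
      (resp L schur≈)
      where schur≈ = schur≈D (conj ν) (conj-Desc ν)

-- Cancellation of the two factors of CS

M-∂ : ∀ q ε {f} → PI f → ∀ α → M f (q ∷ ε) α ≡ M (∂ q f) ε α
M-∂ q ε p []      = refl
M-∂ q ε p (j ∷ α) = trans (M-∂ q ε (Ē-PI j p) α) (resp (M-lin ε α) (∂-Ē j q p))

-- Each exponent splits as i + b + q, with i from S, Ē b from the kernel and ∂ q from ε. For fixed i
-- the sum over b + q = r is a coefficient of a product of inverse series, so only r = 0 survives.
diag-M : ∀ γ S {f} → PI f → diag (λ δ ε → (S ⊛ M f ε) δ) γ ≡ f [] * S γ
diag-M [] S {f} p = trans (ℤₚ.+-identityʳ _) (trans (⊛-[] S (M f [])) (ℤₚ.*-comm (S []) (f [])))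
diag-M (c ∷ γ) S {f} p = begin
  diag (λ δ ε → (S ⊛ M f ε) δ) (c ∷ γ)
    ≡⟨ diag-∷ (λ δ ε → (S ⊛ M f ε) δ) c γ ⟩
  C c (λ a q → diag (λ δ ε → (S ⊛ M f (q ∷ ε)) (a ∷ δ)) γ)
    ≡⟨ C-cong c (λ a q → trans
         (∑-cong (below γ) (λ δ → trans (⊛-∷ S (M f (q ∷ zipWith _∸_ γ δ)) a δ)
           (C-cong a (λ i b → resp (⊛-linʳ (∂ i S) δ) (λ α → trans (M-∂ q (zipWith _∸_ γ δ) (Ē-PI b p) α) refl)))))
         (∑-swap (below γ) (splits a) (λ δ x → (∂ (proj₁ x) S ⊛ M (∂ q (Ē (proj₂ x) f)) (zipWith _∸_ γ δ)) δ))) ⟩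
  C c (λ a q → C a (λ i b → diag (λ δ ε → (∂ i S ⊛ M (∂ q (Ē b f)) ε) δ) γ))
    ≡⟨ C-cong c (λ a q → C-cong a (λ i b → diag-M γ (∂ i S) (PI-∂ q (Ē-PI b p)))) ⟩
  C c (λ a q → C a (λ i b → Ē b f (q ∷ []) * S (i ∷ γ)))
    ≡⟨ C-assoc c (λ i b q → Ē b f (q ∷ []) * S (i ∷ γ)) ⟩
  C c (λ i r → C r (λ b q → Ē b f (q ∷ []) * S (i ∷ γ)))
    ≡⟨ C-last c (λ i r → C r (λ b q → Ē b f (q ∷ []) * S (i ∷ γ))) vanish ⟩
  C 0 (λ b q → Ē b f (q ∷ []) * S (c ∷ γ))
    ≡⟨ trans (C-zero (λ b q → Ē b f (q ∷ []) * S (c ∷ γ))) (cong (_* S (c ∷ γ)) (pad p [])) ⟩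
  f [] * S (c ∷ γ) ∎
  where
  vanish : ∀ i r → C (suc r) (λ b q → Ē b f (q ∷ []) * S (i ∷ γ)) ≡ + 0
  vanish i r = begin
    C (suc r) (λ b q → Ē b f (q ∷ []) * S (i ∷ γ))     ≡⟨ C-cong (suc r) (λ b q → ℤₚ.*-comm (Ē b f (q ∷ [])) (S (i ∷ γ))) ⟩
    C (suc r) (λ b q → S (i ∷ γ) * Ē b f (q ∷ []))     ≡⟨ ∑-*ˡ (S (i ∷ γ)) (splits (suc r)) (λ x → Ē (proj₁ x) f (proj₂ x ∷ [])) ⟩
    S (i ∷ γ) * C (suc r) (λ b q → Ē b f (q ∷ []))     ≡⟨ cong (S (i ∷ γ) *_) (trans (C-comm (suc r) (λ b q → Ē b f (q ∷ []))) (∂-Ē-inverse r p [])) ⟩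
    S (i ∷ γ) * + 0                                    ≡⟨ ℤₚ.*-zeroʳ (S (i ∷ γ)) ⟩
    + 0                                                ∎

one-⊛ : ∀ f → (one ⊛ f) ≈ f
one-⊛ f []      = trans (⊛-[] one f) (ℤₚ.*-identityˡ (f []))
one-⊛ f (c ∷ γ) = trans (⊛-∷ one f c γ)
  (trans (C-first c (λ a b → (∂ a one ⊛ ∂ b f) γ) (λ a b → lin-0 (⊛-linˡ (∂ b f) γ) (λ _ → refl))) (one-⊛ (∂ c f) γ))

T-⊛ : ∀ y f g → T y (f ⊛ g) ≈ (T y f ⊛ g)
T-⊛ y f g γ = trans (sym (hz⊛≈T y (f ⊛ g) γ)) (trans (sym (⊛-assoc γ (hz y) f g)) (resp (⊛-linˡ g γ) (hz⊛≈T y f)))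

up-bound : ∀ z t m → up z t ≡ + m → m ≤ ℤ.∣ z ∣ ℕ.+ t
up-bound (+ n)    t m e = ℕₚ.≤-reflexive (sym (ℤₚ.+-injective (trans (sym (up-+ (+ n) t)) e)))
up-bound -[1+ n ] t m e = ℕₚ.≤-trans (up-neg-≤ (suc n) t m e) (ℕₚ.m≤n+m t (suc n))

Vanishing : ℕ → Series → Set
Vanishing N f = ∀ γ → N ≤ sum γ → f γ ≡ + 0

∂-Vanishing : ∀ j {N f} → Vanishing N f → Vanishing N (∂ j f)
∂-Vanishing j v γ l = v (j ∷ γ) (ℕₚ.≤-trans l (ℕₚ.m≤n+m (sum γ) j))

W-M : ∀ N z ε {g} → PI g → Vanishing N g → ∀ γ →
      W z (M g ε) γ ≡ ∑ (upTo N) (λ i → T (z + - + i) (M (∂ i g) ε) γ)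
W-M N z ε {g} p v γ = begin
  W z (M g ε) γ
    -- K terms satisfy `W-expand`; N more make it possible to cut the sum back to i < N, beyond
    -- which `∂ i g` vanishes.
    ≡⟨ sym (W-expand (N ℕ.+ K) γ z (M-PI ε p) (λ t t≤ m e → ℕₚ.≤-trans (s≤s (ℕₚ.≤-trans (up-bound z t m e) (ℕₚ.+-monoʳ-≤ ℤ.∣ z ∣ t≤))) (ℕₚ.m≤n+m K N))) ⟩
  ∑ (upTo (N ℕ.+ K)) (λ i → T (z + - + i) (Ē i (M g ε)) γ)
    ≡⟨ ∑-cong (upTo (N ℕ.+ K)) (λ i → resp (T-lin (z + - + i) γ) (Ē-M i ε p)) ⟩
  ∑ (upTo (N ℕ.+ K)) X
    ≡⟨ ∑-upTo-+ N K X ⟩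
  ∑ (upTo N) X + ∑ (upTo K) (λ i → X (N ℕ.+ i))
    ≡⟨ +ˡ (∑ (upTo N) X) (∑-0 (upTo K) (λ i → lin-0 (T-lin (z + - + (N ℕ.+ i)) γ) (λ δ → lin-0 (M-lin ε δ)
         (λ η → v (N ℕ.+ i ∷ η) (ℕₚ.≤-trans (ℕₚ.m≤m+n N i) (ℕₚ.m≤m+n (N ℕ.+ i) (sum η))))))) ⟩
  ∑ (upTo N) X + + 0
    ≡⟨ ℤₚ.+-identityʳ _ ⟩
  ∑ (upTo N) X ∎
  where
  K = suc (ℤ.∣ z ∣ ℕ.+ sum γ)
  X : ℕ → ℤ
  X i = T (z + - + i) (M (∂ i g) ε) γ

-- For S = 1 this is `W-M`. A further factor h_j of S passes through both sides by `W-T`, whose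
-- index shifts are the same for all i.
W-⊛M : ∀ N z ε {S g} → Span H S → PI g → Vanishing N g → ∀ γ →
       W z (S ⊛ M g ε) γ ≡ ∑ (upTo N) (λ i → (W (z + - + i) S ⊛ M (∂ i g) ε) γ)
W-⊛M N z ε {S} {g} s p v γ = Span-ext
  (∘-lin (W-lin z γ) (⊛-linˡ (M g ε)))
  (∑-lin (upTo N) (λ i → ∘-lin (⊛-linˡ (M (∂ i g) ε) γ) (W-lin (z + - + i))))
  (λ {f} (ρ , e) → trans (resp (W-lin z γ) (λ δ → resp (⊛-linˡ (M g ε) δ) e))
    (trans (go ρ z γ) (∑-cong (upTo N) (λ i → resp (⊛-linˡ (M (∂ i g) ε) γ) (λ δ → resp (W-lin (z + - + i) δ) (λ η → sym (e η)))))))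
  s
  where
  go : ∀ ρ z γ → W z (hProd ρ ⊛ M g ε) γ ≡ ∑ (upTo N) (λ i → (W (z + - + i) (hProd ρ) ⊛ M (∂ i g) ε) γ)
  go [] z γ = begin
    W z (one ⊛ M g ε) γ
      ≡⟨ resp (W-lin z γ) (one-⊛ (M g ε)) ⟩
    W z (M g ε) γ
      ≡⟨ W-M N z ε p v γ ⟩
    ∑ (upTo N) (λ i → T (z + - + i) (M (∂ i g) ε) γ)
      ≡⟨ ∑-cong (upTo N) (λ i → trans (sym (hz⊛≈T (z + - + i) (M (∂ i g) ε) γ))
           (resp (⊛-linˡ (M (∂ i g) ε) γ) (λ δ → sym (W-one (z + - + i) δ)))) ⟩
    ∑ (upTo N) (λ i → (W (z + - + i) one ⊛ M (∂ i g) ε) γ) ∎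
  go (j ∷ ρ) z γ = begin
    W z ((hS j ⊛ P) ⊛ X) γ
      ≡⟨ resp (W-lin z γ) (λ δ → trans (⊛-assoc δ (hS j) P X) (hS⊛≈T j (P ⊛ X) δ)) ⟩
    W z (T y (P ⊛ X)) γ
      ≡⟨ W-T z y (⊛-PI (hProd-PI ρ) (M-PI ε p)) γ ⟩
    T y (W z (P ⊛ X)) γ + - T (ℤ.suc y) (W (ℤ.pred z) (P ⊛ X)) γ
      ≡⟨ cong₂ (λ a b → a + - b) (through y z) (through (ℤ.suc y) (ℤ.pred z)) ⟩
    ∑ (upTo N) (A y z) + - ∑ (upTo N) (A (ℤ.suc y) (ℤ.pred z))
      ≡⟨ trans (+ˡ (∑ (upTo N) (A y z)) (sym (∑-neg (upTo N) (A (ℤ.suc y) (ℤ.pred z)))))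
               (sym (∑-+ (upTo N) (A y z) (λ i → - A (ℤ.suc y) (ℤ.pred z) i))) ⟩
    ∑ (upTo N) (λ i → A y z i + - A (ℤ.suc y) (ℤ.pred z) i)
      ≡⟨ ∑-cong (upTo N) collect ⟩
    ∑ (upTo N) (λ i → (W (z + - + i) (hS j ⊛ P) ⊛ M (∂ i g) ε) γ) ∎
    where
    y = - + j
    P = hProd ρ
    X = M g ε
    A : ℤ → ℤ → ℕ → ℤ
    A y z i = (T y (W (z + - + i) P) ⊛ M (∂ i g) ε) γ
    through : ∀ y z → T y (W z (P ⊛ X)) γ ≡ ∑ (upTo N) (A y z)
    through y z = trans (resp (T-lin y γ) (go ρ z))
      (trans (lin-∑ (T-lin y γ) (upTo N) (λ i → W (z + - + i) P ⊛ M (∂ i g) ε))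
             (∑-cong (upTo N) (λ i → T-⊛ y (W (z + - + i) P) (M (∂ i g) ε) γ)))
    collect : ∀ i → A y z i + - A (ℤ.suc y) (ℤ.pred z) i ≡ (W (z + - + i) (hS j ⊛ P) ⊛ M (∂ i g) ε) γ
    collect i = begin
      A y z i + - A (ℤ.suc y) (ℤ.pred z) i
        ≡⟨ cong (λ w → A y z i + - (T (ℤ.suc y) (W w P) ⊛ M (∂ i g) ε) γ) (pred-sub z (+ i)) ⟩
      A y z i + - (T (ℤ.suc y) (W (ℤ.pred (z + - + i)) P) ⊛ M (∂ i g) ε) γ
        ≡⟨ trans (+ˡ (A y z i) (sym (lin-neg L (T (ℤ.suc y) (W (ℤ.pred (z + - + i)) P)))))
                 (sym (add L (T y (W (z + - + i) P)) (neg (T (ℤ.suc y) (W (ℤ.pred (z + - + i)) P))))) ⟩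
      ((T y (W (z + - + i) P) ⊕ neg (T (ℤ.suc y) (W (ℤ.pred (z + - + i)) P))) ⊛ M (∂ i g) ε) γ
        ≡⟨ resp L (λ δ → trans (sym (W-T (z + - + i) y (hProd-PI ρ) δ)) (resp (W-lin (z + - + i) δ) (λ η → sym (hS⊛≈T j P η)))) ⟩
      (W (z + - + i) (hS j ⊛ P) ⊛ M (∂ i g) ε) γ ∎
      where
      L = ⊛-linˡ (M (∂ i g) ε) γ
      pred-sub : ∀ z i → - + 1 + z + - i ≡ - + 1 + (z + - i)
      pred-sub = solve-∀

-- Iterated RS as a sum over ℕ^k, cut off at entries below N

cube : ℕ → ℕ → List (List ℕ)
cube N zero    = [ [] ]
cube N (suc k) = concatMap (λ j → map (j ∷_) (cube N k)) (upTo N)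

∑-cube-suc : ∀ N k (F : List ℕ → ℤ) → ∑ (cube N (suc k)) F ≡ ∑ (upTo N) (λ j → ∑ (cube N k) (λ β → F (j ∷ β)))
∑-cube-suc N k F = trans (∑-concatMap (λ j → map (j ∷_) (cube N k)) (upTo N) F)
  (∑-cong (upTo N) (λ j → ∑-map (j ∷_) (cube N k) F))

cube-length : ∀ N k → All (λ β → length β ≡ k) (cube N k)
cube-length N zero    = refl ∷ []
cube-length N (suc k) = Allₚ.concat⁺ (Allₚ.map⁺ (All.universal (λ j → Allₚ.map⁺ (All.map (cong suc) (cube-length N k))) (upTo N)))

∂* : List ℕ → Series → Series
∂* []      f = f
∂* (j ∷ β) f = ∂ j (∂* β f)

∂*-PI : ∀ β {f} → PI f → PI (∂* β f)
∂*-PI []      p = p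
∂*-PI (j ∷ β) p = PI-∂ j (∂*-PI β p)

∂*-Vanishing : ∀ β {N f} → Vanishing N f → Vanishing N (∂* β f)
∂*-Vanishing []      v = v
∂*-Vanishing (j ∷ β) v = ∂-Vanishing j (∂*-Vanishing β v)

∂*-++ : ∀ β {f} → PI f → ∀ γ → ∂* β f γ ≡ f (β ++ γ)
∂*-++ []      p γ = refl
∂*-++ (j ∷ β) p γ = trans (∂*-++ β p (j ∷ γ)) (perm p (↭ₚ.shift j β γ))

iter-lin : ∀ a k γ → Lin (λ f → iter k (W (- + a)) f γ)
iter-lin a zero    γ = eval-lin γ
iter-lin a (suc k) γ = ∘-lin (W-lin (- + a) γ) (iter-lin a k)

rect : ℕ → List ℕ → Series
rect a β = D (shift (map (a ℕ.+_) β))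

iter-M : ∀ N a k ε {f} → PI f → Vanishing N f → ∀ γ →
         iter k (W (- + a)) (M f ε) γ ≡ ∑ (cube N k) (λ β → (rect a β ⊛ M (∂* β f) ε) γ)
iter-M N a zero ε {f} p v γ = sym (trans (ℤₚ.+-identityʳ _) (one-⊛ (M f ε) γ))
iter-M N a (suc k) ε {f} p v γ = begin
  W z (iter k (W z) (M f ε)) γ
    ≡⟨ resp (W-lin z γ) (iter-M N a k ε p v) ⟩
  W z (λ δ → ∑ (cube N k) (λ β → (rect a β ⊛ M (∂* β f) ε) δ)) γ
    ≡⟨ lin-∑ (W-lin z γ) (cube N k) (λ β → rect a β ⊛ M (∂* β f) ε) ⟩
  ∑ (cube N k) (λ β → W z (rect a β ⊛ M (∂* β f) ε) γ)
    ≡⟨ ∑-cong (cube N k) (λ β → W-⊛M N z ε (D-H (shift (map (a ℕ.+_) β))) (∂*-PI β p) (∂*-Vanishing β v) γ) ⟩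
  ∑ (cube N k) (λ β → ∑ (upTo N) (λ j → (W (z + - + j) (rect a β) ⊛ M (∂ j (∂* β f)) ε) γ))
    -- RS_{a+j} puts a row a + j in front of the shape.
    ≡⟨ ∑-cong (cube N k) (λ β → ∑-cong (upTo N) (λ j → resp (⊛-linˡ (M (∂ j (∂* β f)) ε) γ) (λ δ → trans
         (cong (λ w → W w (rect a β) δ) (sym (ℤₚ.neg-distrib-+ (+ a) (+ j))))
         (sym (D-shift-∷ (a ℕ.+ j) (map (a ℕ.+_) β) δ))))) ⟩
  ∑ (cube N k) (λ β → ∑ (upTo N) (λ j → (rect a (j ∷ β) ⊛ M (∂* (j ∷ β) f) ε) γ))
    ≡⟨ ∑-swap (cube N k) (upTo N) (λ β j → (rect a (j ∷ β) ⊛ M (∂* (j ∷ β) f) ε) γ) ⟩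
  ∑ (upTo N) (λ j → ∑ (cube N k) (λ β → (rect a (j ∷ β) ⊛ M (∂* (j ∷ β) f) ε) γ))
    ≡⟨ sym (∑-cube-suc N k (λ β → (rect a β ⊛ M (∂* β f) ε) γ)) ⟩
  ∑ (cube N (suc k)) (λ β → (rect a β ⊛ M (∂* β f) ε) γ) ∎
  where z = - + a

-- Locality of RS in the degree

-- s is the degree already spent on outer derivatives, b the degree up to which f and g agree; the
-- operator spends n + p more.
Ē≥-local : ∀ b s n p {f g} → (∀ α → s ℕ.+ sum α ≤ b → f α ≡ g α) →
           ∀ γ → s ℕ.+ (n ℕ.+ p ℕ.+ sum γ) ≤ b → Ē≥ n p f γ ≡ Ē≥ n p g γ
Ē≥-local b s zero    p e γ l = cong -_ (e (p ∷ γ) l)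
Ē≥-local b s (suc n) p e γ l = cong₂ (λ x y → x + - y)
  (Ē≥-local b s n (suc p) e γ (subst (_≤ b) (arrange₁ s n p (sum γ)) l))
  (Ē≥-local b (s ℕ.+ p) n 1 (λ α m → e (p ∷ α) (subst (_≤ b) (ℕₚ.+-assoc s p (sum α)) m)) γ
    (subst (_≤ b) (arrange₂ s n p (sum γ)) l))
  where
  arrange₁ : ∀ s n p t → s ℕ.+ (suc n ℕ.+ p ℕ.+ t) ≡ s ℕ.+ (n ℕ.+ suc p ℕ.+ t)
  arrange₁ = ℕ-solve-∀
  arrange₂ : ∀ s n p t → s ℕ.+ (suc n ℕ.+ p ℕ.+ t) ≡ s ℕ.+ p ℕ.+ (n ℕ.+ 1 ℕ.+ t)
  arrange₂ = ℕ-solve-∀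

W-local : ∀ b γ s z {f g} → (∀ α → s ℕ.+ sum α ≤ b → f α ≡ g α) →
          (∀ m → up z (sum γ) ≡ + m → s ℕ.+ m ≤ b) → W z f γ ≡ W z g γ
W-local b [] s (+ zero)  e c = e [] (c 0 refl)
W-local b [] s (+ suc n) e c = Ē≥-local b s n 1 e [] (subst (λ x → s ℕ.+ x ≤ b) (arrange n) (c (suc n) refl))
  where
  arrange : ∀ n → suc n ≡ n ℕ.+ 1 ℕ.+ 0
  arrange = ℕ-solve-∀
W-local b [] s -[1+ n ]  e c = refl
W-local b (x ∷ γ) s z {f} {g} e c = C-cong-≤ x (λ a q a+q≡x → W-local b γ (s ℕ.+ q) (up z a)
  (λ α l → e (q ∷ α) (subst (_≤ b) (ℕₚ.+-assoc s q (sum α)) l))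
  (λ m u → subst (_≤ b) (arrange s q m) (c (m ℕ.+ q) (begin
    up z (x ℕ.+ sum γ)               ≡⟨ cong (up z) (trans (cong (ℕ._+ sum γ) (sym a+q≡x)) (arrange₂ a q (sum γ))) ⟩
    up z (a ℕ.+ sum γ ℕ.+ q)         ≡⟨ sym (up-up z (a ℕ.+ sum γ) q) ⟩
    up (up z (a ℕ.+ sum γ)) q        ≡⟨ cong (λ y → up y q) (trans (sym (up-up z a (sum γ))) u) ⟩
    up (+ m) q                       ≡⟨ up-+ (+ m) q ⟩
    + (m ℕ.+ q)                      ∎))))
  where
  arrange : ∀ s q m → s ℕ.+ (m ℕ.+ q) ≡ s ℕ.+ q ℕ.+ m
  arrange = ℕ-solve-∀
  arrange₂ : ∀ a q t → a ℕ.+ q ℕ.+ t ≡ a ℕ.+ t ℕ.+ q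
  arrange₂ = ℕ-solve-∀

-- RS_a raises the degree by a ≥ 0. Hence the kernel may be replaced by the truncated sum over ν.
iter-local : ∀ b a k {f g} → (∀ α → sum α ≤ b → f α ≡ g α) →
             ∀ γ → sum γ ≤ b → iter k (W (- + a)) f γ ≡ iter k (W (- + a)) g γ
iter-local b a zero    e = e
iter-local b a (suc k) e γ l = W-local b γ 0 (- + a) (iter-local b a k e)
  (λ m u → ℕₚ.≤-trans (up-neg-≤ a (sum γ) m u) l)

-- Expansion of CS

module Expansion (ip : ℕ → Series → Series → ℤ) (hall : IsHallPairing ip)
                 (perp : Series → Series → Series) (skew : IsSkewing ip perp) where
  open Hall ip hall
  open Skewing ip hall perp skew
  open Kernel ip hall perp skew

  -- By homogeneity only |ν| = |α| contributes, which lies within the cut, and the two signs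
  -- (-1)^{|α|} cancel.
  truncated-kernel : ∀ n {f} → Sym f → ∀ ε α → sum α ≤ n →
    ∑ (partitionsUpTo n) (λ ν → sign (sum ν) * perp (schurS (conj ν)) f ε * D (shift ν) α) ≡ M f ε α
  truncated-kernel n {f} s ε α l = begin
    ∑ (partitionsUpTo n) X
      ≡⟨ ∑-concatMap partitionsOf (upTo (suc n)) X ⟩
    ∑ (upTo (suc n)) (λ d → ∑ (partitionsOf d) X)
      ≡⟨ ∑-upTo-single (suc n) (sum α) {λ d → ∑ (partitionsOf d) X} (s≤s l) (λ d ne → ∑-0-All (All.map (λ {ν} ((dν , _) , q) →
           trans (cong (sign (sum ν) * perp (schurS (conj ν)) f ε *_) (D-homogeneous α ν dν (λ e → ne (sym (trans e q)))))
                 (ℤₚ.*-zeroʳ (sign (sum ν) * perp (schurS (conj ν)) f ε))) (partitionsOf-All d))) ⟩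
    ∑ (partitionsOf (sum α)) X
      ≡⟨ ∑-cong-All (All.map (λ {ν} (_ , q) → trans (cong (λ m → sign m * perp (schurS (conj ν)) f ε * D (shift ν) α) q)
           (arrange (sign (sum α)) (perp (schurS (conj ν)) f ε) (D (shift ν) α))) (partitionsOf-All (sum α))) ⟩
    ∑ (partitionsOf (sum α)) (λ ν → sign (sum α) * (D (shift ν) α * perp (schurS (conj ν)) f ε))
      ≡⟨ ∑-*ˡ (sign (sum α)) (partitionsOf (sum α)) (λ ν → D (shift ν) α * perp (schurS (conj ν)) f ε) ⟩
    sign (sum α) * ∑ (partitionsOf (sum α)) (λ ν → D (shift ν) α * perp (schurS (conj ν)) f ε)
      ≡⟨ cong (sign (sum α) *_) (kernel α s ε) ⟩
    sign (sum α) * (sign (sum α) * M f ε α)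
      ≡⟨ trans (sym (ℤₚ.*-assoc (sign (sum α)) (sign (sum α)) (M f ε α))) (trans (cong (_* M f ε α) (sign² (sum α))) (ℤₚ.*-identityˡ _)) ⟩
    M f ε α ∎
    where
    X : List ℕ → ℤ
    X ν = sign (sum ν) * perp (schurS (conj ν)) f ε * D (shift ν) α
    arrange : ∀ a b c → a * b * c ≡ a * (c * b)
    arrange = solve-∀

  CS-expansion : ∀ N a k {f} → Sym f → Vanishing N f → ∀ γ →
                 CS perp a k f γ ≡ ∑ (cube N k) (λ β → f β * rect a β γ)
  CS-expansion N a k {f} s v γ = begin
    ∑ Ps (λ ν → sign (sum ν) * ∑ (below γ) (λ α → iter k (RS perp a) (schurS ν) α * Y ν α))
      ≡⟨ ∑-cong-All (All.map (λ {ν} ((d , _)) → trans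
           (cong (sign (sum ν) *_) (∑-cong (below γ) (λ α → cong (_* Y ν α) (RS-schur ν d α))))
           (sym (∑-*ˡ (sign (sum ν)) (below γ) (λ α → O (D (shift ν)) α * Y ν α)))) allPartitions) ⟩
    ∑ Ps (λ ν → ∑ (below γ) (λ α → sign (sum ν) * (O (D (shift ν)) α * Y ν α)))
      ≡⟨ ∑-swap Ps (below γ) (λ ν α → sign (sum ν) * (O (D (shift ν)) α * Y ν α)) ⟩
    ∑ (below γ) (λ α → ∑ Ps (λ ν → sign (sum ν) * (O (D (shift ν)) α * Y ν α)))
      -- With α fixed the second factor is a scalar, so the sum over ν moves inside the iterated RS
      -- and becomes the kernel.
      ≡⟨ ∑-cong-All (All.map (λ {α} (l , _) → trans
           (∑-cong Ps (λ ν → arrange (sign (sum ν)) (O (D (shift ν)) α) (Y ν α)))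
           (trans (sym (lin-∑* (iter-lin a k α) Ps (λ ν → sign (sum ν) * Y ν α) (λ ν → D (shift ν))))
                  (iter-local (sum γ) a k (truncated-kernel (sum γ) s (zipWith _∸_ γ α)) α l))) (below-All γ)) ⟩
    ∑ (below γ) (λ α → O (M f (zipWith _∸_ γ α)) α)
      ≡⟨ ∑-cong (below γ) (λ α → iter-M N a k (zipWith _∸_ γ α) p v α) ⟩
    ∑ (below γ) (λ α → ∑ (cube N k) (λ β → (rect a β ⊛ M (∂* β f) (zipWith _∸_ γ α)) α))
      ≡⟨ ∑-swap (below γ) (cube N k) (λ α β → (rect a β ⊛ M (∂* β f) (zipWith _∸_ γ α)) α) ⟩
    ∑ (cube N k) (λ β → diag (λ α ε → (rect a β ⊛ M (∂* β f) ε) α) γ)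
      ≡⟨ ∑-cong (cube N k) (λ β → trans (diag-M γ (rect a β) (∂*-PI β p))
           (cong (_* rect a β γ) (trans (∂*-++ β p []) (cong f (Lₚ.++-identityʳ β))))) ⟩
    ∑ (cube N k) (λ β → f β * rect a β γ) ∎
    where
    p = Sym⇒PI s
    Ps = partitionsUpTo (sum γ)
    O : Series → Series
    O = iter k (W (- + a))
    Y : List ℕ → List ℕ → ℤ
    Y ν α = perp (schurS (conj ν)) f (zipWith _∸_ γ α)
    RS-schur : ∀ ν → Desc ν → iter k (RS perp a) (schurS ν) ≈ O (D (shift ν))
    RS-schur ν d α = trans (proj₁ (iter-RS a k (Sym-resp (λ δ → sym (schur≈D ν d δ)) (D-Sym ν d))) α)
                           (resp (iter-lin a k α) (schur≈D ν d))
    allPartitions : All IsPartition Ps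
    allPartitions = partitionsUpTo-All (sum γ)
    arrange : ∀ a b c → a * (b * c) ≡ a * c * b
    arrange = solve-∀

-- Pairing a Schur function in k variables with an alternating function

-- At least n nonempty rows, expressed for lists that may end in zeros.
Long : ℕ → List ℕ → Set
Long zero    ν       = ⊤
Long (suc n) []      = ⊥
Long (suc n) (x ∷ ν) = 0 < x × Long n ν

positive⇒Long : ∀ n ν → All (0 <_) ν → n ≤ length ν → Long n ν
positive⇒Long zero    ν       p       l       = tt
positive⇒Long (suc n) (x ∷ ν) (q ∷ p) (s≤s l) = q , positive⇒Long n ν p l

interlace-Long : ∀ n ν → Desc ν → Long (suc n) ν → All (Long n) (interlace ν)
interlace-Long zero    ν           d       l = All.universal (λ _ → tt) (interlace ν)
interlace-Long (suc n) (x ∷ [])    d       (_ , ())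
interlace-Long (suc n) (x ∷ y ∷ r) (h ∷ d) (_ , l) = interlace-All-∷ x y r h
  (λ m y≤m _ q → ℕₚ.<-≤-trans (proj₁ l) y≤m , q) (interlace-Long n (y ∷ r) d l)

-- A horizontal strip shortens each column by at most one, so k variables cannot exhaust more than k
-- rows.
D-Long : ∀ β ν → Desc ν → Long (suc (length β)) ν → D (shift ν) β ≡ + 0
D-Long []      (suc x ∷ ν) d l = D-const (suc x ∷ ν)
D-Long []      (zero ∷ ν)  d (() , _)
D-Long (c ∷ β) ν           d l = trans (D-strips ν d c β) (∑-0-All (All.zipWith
  (λ {μ} ((_ , dμ , _) , q) → trans (cong (ind (sum ν) (c ℕ.+ sum μ) *_) (D-Long β μ dμ q)) (ℤₚ.*-zeroʳ (ind (sum ν) (c ℕ.+ sum μ))))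
  (interlace-All ν d , interlace-Long (suc (length β)) ν d l)))

-- the interlacers with last part 0, which is omitted
interlace⁻ : List ℕ → List (List ℕ)
interlace⁻ []          = [ [] ]
interlace⁻ (x ∷ [])    = [ [] ]
interlace⁻ (x ∷ y ∷ r) = concatMap (λ m → map (m ∷_) (interlace⁻ (y ∷ r))) (range y x)

∑-interlace⁻-∷ : ∀ x y r (F : List ℕ → ℤ) → ∑ (interlace⁻ (x ∷ y ∷ r)) F ≡
                 ∑ (upTo (suc (x ∸ y))) (λ t → ∑ (interlace⁻ (y ∷ r)) (λ μ → F (y ℕ.+ t ∷ μ)))
∑-interlace⁻-∷ x y r F = trans (∑-concatMap (λ m → map (m ∷_) (interlace⁻ (y ∷ r))) (range y x) F)
  (trans (∑-map (y ℕ.+_) (upTo (suc (x ∸ y))) (λ m → ∑ (map (m ∷_) (interlace⁻ (y ∷ r))) F))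
         (∑-cong (upTo (suc (x ∸ y))) (λ t → ∑-map (y ℕ.+ t ∷_) (interlace⁻ (y ∷ r)) F)))

range-≤ : ∀ {x y} → y ≤ x → ∀ t → t < suc (x ∸ y) → y ℕ.+ t ≤ x
range-≤ {x} {y} h t t< = ℕₚ.≤-trans (ℕₚ.+-monoʳ-≤ y (s≤s⁻¹ t<)) (ℕₚ.≤-reflexive (ℕₚ.m+[n∸m]≡n h))

interlace⁻-All : ∀ x ν → Desc (x ∷ ν) →
  All (λ μ → length μ ≡ length ν × Desc μ × headℕ μ ≤ x × sum ν ≤ sum μ × sum μ ≤ x ℕ.+ sum ν) (interlace⁻ (x ∷ ν))
interlace⁻-All x []      d       = (refl , [] , z≤n , z≤n , z≤n) ∷ []
interlace⁻-All x (y ∷ r) (h ∷ d) = Allₚ.concat⁺ (Allₚ.map⁺ (Allₚ.map⁺ (Allₚ.applyUpTo⁺₁ id (suc (x ∸ y)) (λ {t} t< →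
  Allₚ.map⁺ (All.map (λ (l , dμ , hμ , lo , hi) →
      cong suc l
    , Desc-∷ (ℕₚ.≤-trans hμ (ℕₚ.m≤m+n y t)) dμ
    , range-≤ h t t<
    , ℕₚ.+-mono-≤ (ℕₚ.m≤m+n y t) lo
    , ℕₚ.+-mono-≤ (range-≤ h t t<) hi) (interlace⁻-All y r d))))))

-- For a summand that vanishes on too many rows. The surviving interlacers end in zero, and dropping
-- it leaves as many parts as there are variables left.
∑-interlace-restrict : ∀ x ν → Desc (x ∷ ν) → (F : List ℕ → ℤ) →
  (∀ μ → Desc μ → headℕ μ ≤ x → Long (suc (length ν)) μ → F μ ≡ + 0) →
  ∑ (interlace (x ∷ ν)) F ≡ ∑ (interlace⁻ (x ∷ ν)) (λ μ → F (μ ∷ʳ 0))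
∑-interlace-restrict x [] d F v = trans (∑-interlace-[] x F) (trans (∑-upTo-suc x (λ t → F (t ∷ [])))
  (+ˡ (F (0 ∷ [])) (∑-upTo-0 x (λ t t<x → v (suc t ∷ []) [-] t<x (s≤s z≤n , tt)))))
∑-interlace-restrict x (y ∷ r) (h ∷ d) F v = begin
  ∑ (interlace (x ∷ y ∷ r)) F
    ≡⟨ ∑-interlace-∷ x y r F ⟩
  ∑ (upTo (suc (x ∸ y))) (λ t → ∑ (interlace (y ∷ r)) (λ μ → F (y ℕ.+ t ∷ μ)))
    ≡⟨ ∑-upTo-cong (suc (x ∸ y)) (λ t t< → ∑-interlace-restrict y r d (λ μ → F (y ℕ.+ t ∷ μ))
         (λ { (z ∷ μ) dμ hμ (z>0 , l) → v (y ℕ.+ t ∷ z ∷ μ) (ℕₚ.≤-trans hμ (ℕₚ.m≤m+n y t) ∷ dμ) (range-≤ h t t<)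
                (ℕₚ.<-≤-trans z>0 (ℕₚ.≤-trans hμ (ℕₚ.m≤m+n y t)) , z>0 , l) })) ⟩
  ∑ (upTo (suc (x ∸ y))) (λ t → ∑ (interlace⁻ (y ∷ r)) (λ μ → F (y ℕ.+ t ∷ μ ∷ʳ 0)))
    ≡⟨ sym (∑-interlace⁻-∷ x y r (λ μ → F (μ ∷ʳ 0))) ⟩
  ∑ (interlace⁻ (x ∷ y ∷ r)) (λ μ → F (μ ∷ʳ 0)) ∎

interlace⁻-min : ∀ x ν (G : List ℕ → ℤ) → Desc (x ∷ ν) → (∀ μ → sum ν < sum μ → length μ ≡ length ν → G μ ≡ + 0) →
                 ∑ (interlace⁻ (x ∷ ν)) G ≡ G ν
interlace⁻-min x [] G d v = ℤₚ.+-identityʳ (G [])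
interlace⁻-min x (y ∷ r) G (h ∷ d) v = begin
  ∑ (interlace⁻ (x ∷ y ∷ r)) G
    ≡⟨ ∑-interlace⁻-∷ x y r G ⟩
  ∑ (upTo (suc (x ∸ y))) (λ t → ∑ (interlace⁻ (y ∷ r)) (λ μ → G (y ℕ.+ t ∷ μ)))
    ≡⟨ ∑-upTo-single (suc (x ∸ y)) 0 {λ t → ∑ (interlace⁻ (y ∷ r)) (λ μ → G (y ℕ.+ t ∷ μ))} (s≤s z≤n) big ⟩
  ∑ (interlace⁻ (y ∷ r)) (λ μ → G (y ℕ.+ 0 ∷ μ))
    ≡⟨ interlace⁻-min y r (λ μ → G (y ℕ.+ 0 ∷ μ)) d (λ μ l e → v (y ℕ.+ 0 ∷ μ) (ℕₚ.+-mono-≤-< (ℕₚ.m≤m+n y 0) l) (cong suc e)) ⟩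
  G (y ℕ.+ 0 ∷ r)
    ≡⟨ cong (λ z → G (z ∷ r)) (ℕₚ.+-identityʳ y) ⟩
  G (y ∷ r) ∎
  where
  big : ∀ t → t ≢ 0 → ∑ (interlace⁻ (y ∷ r)) (λ μ → G (y ℕ.+ t ∷ μ)) ≡ + 0
  big zero    ne = ⊥-elim (ne refl)
  big (suc t) _  = ∑-0-All (All.map (λ {μ} (e , _ , _ , lo , _) → v (y ℕ.+ suc t ∷ μ)
    (ℕₚ.+-mono-<-≤ (ℕₚ.m<m+n y (s≤s z≤n)) lo) (cong suc e)) (interlace⁻-All y r d))

-- With ℓ = shift (x ∷ ν) and m = shift μ, each m_i ranges over [ℓ_{i+1}, ℓ_i): the terms with p in that
-- interval cancel under exchanging p and m_i.
∑-swap-cancel : ∀ x ν → Desc (x ∷ ν) → ∀ {F} → Alt F → (∀ m → sum m < sum (shift (x ∷ ν)) → F m ≡ + 0) →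
  ∑ (upTo (x ℕ.+ length ν)) (λ p → ∑ (interlace⁻ (x ∷ ν)) (λ μ → F (p ∷ shift μ))) ≡ + 0
∑-swap-cancel x [] d {F} alt v = ∑-upTo-0 (x ℕ.+ 0) (λ p p< →
  trans (ℤₚ.+-identityʳ (F (p ∷ []))) (v (p ∷ []) (ℕₚ.+-monoˡ-< 0 p<)))
∑-swap-cancel x (y ∷ r) (h ∷ d) {F} alt v = begin
  ∑ (upTo (x ℕ.+ suc L)) Φ
    ≡⟨ cong (λ n → ∑ (upTo n) Φ) bound ⟩
  ∑ (upTo (ℓ₂ ℕ.+ suc (x ∸ y))) Φ
    ≡⟨ ∑-upTo-+ ℓ₂ (suc (x ∸ y)) Φ ⟩
  ∑ (upTo ℓ₂) Φ + ∑ ts (λ s → Φ (ℓ₂ ℕ.+ s))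
    ≡⟨ cong₂ _+_
         (trans (∑-cong (upTo ℓ₂) Φ-expand)
           (trans (∑-swap (upTo ℓ₂) ts (λ p t → ∑ Is (λ μ → F (p ∷ ℓ₂ ℕ.+ t ∷ shift μ)))) (∑-upTo-0 (suc (x ∸ y)) low)))
         (trans (∑-cong ts (λ s → Φ-expand (ℓ₂ ℕ.+ s))) (∑-antisym ts (λ s t → ∑ Is (λ μ → F (ℓ₂ ℕ.+ s ∷ ℓ₂ ℕ.+ t ∷ shift μ)))
           (λ s t → trans (∑-cong Is (λ μ → alt [] (ℓ₂ ℕ.+ s) (ℓ₂ ℕ.+ t) (shift μ))) (∑-neg Is (λ μ → F (ℓ₂ ℕ.+ t ∷ ℓ₂ ℕ.+ s ∷ shift μ)))))) ⟩
  + 0 ∎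
  where
  L = length r
  ℓ₂ = y ℕ.+ L
  ts = upTo (suc (x ∸ y))
  Is = interlace⁻ (y ∷ r)
  Φ : ℕ → ℤ
  Φ p = ∑ (interlace⁻ (x ∷ y ∷ r)) (λ μ → F (p ∷ shift μ))
  arrange : ∀ y L t → y ℕ.+ t ℕ.+ L ≡ y ℕ.+ L ℕ.+ t
  arrange = ℕ-solve-∀
  Φ-expand : ∀ p → Φ p ≡ ∑ ts (λ t → ∑ Is (λ μ → F (p ∷ ℓ₂ ℕ.+ t ∷ shift μ)))
  Φ-expand p = trans (∑-interlace⁻-∷ x y r (λ μ → F (p ∷ shift μ))) (∑-cong ts (λ t → ∑-cong-All (All.map (λ {μ} (l , _) →
    cong (λ n → F (p ∷ n ∷ shift μ)) (trans (cong (y ℕ.+ t ℕ.+_) l) (arrange y L t))) (interlace⁻-All y r d))))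
  bound : x ℕ.+ suc L ≡ ℓ₂ ℕ.+ suc (x ∸ y)
  bound = sym (trans (ℕₚ.+-suc ℓ₂ (x ∸ y)) (trans (cong suc (trans (sym (arrange y L (x ∸ y))) (cong (ℕ._+ L) (ℕₚ.m+[n∸m]≡n h))))
                                                   (sym (ℕₚ.+-suc x L))))
  low : ∀ t → t < suc (x ∸ y) → ∑ (upTo ℓ₂) (λ p → ∑ Is (λ μ → F (p ∷ ℓ₂ ℕ.+ t ∷ shift μ))) ≡ + 0
  low t t< = begin
    ∑ (upTo ℓ₂) (λ p → ∑ Is (λ μ → F (p ∷ ℓ₂ ℕ.+ t ∷ shift μ)))
      ≡⟨ ∑-cong (upTo ℓ₂) (λ p → trans (∑-cong Is (λ μ → alt [] p (ℓ₂ ℕ.+ t) (shift μ))) (∑-neg Is (λ μ → F (ℓ₂ ℕ.+ t ∷ p ∷ shift μ)))) ⟩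
    ∑ (upTo ℓ₂) (λ p → - ∑ Is (λ μ → F (ℓ₂ ℕ.+ t ∷ p ∷ shift μ)))
      ≡⟨ ∑-neg (upTo ℓ₂) (λ p → ∑ Is (λ μ → F (ℓ₂ ℕ.+ t ∷ p ∷ shift μ))) ⟩
    - ∑ (upTo ℓ₂) (λ p → ∑ Is (λ μ → F (ℓ₂ ℕ.+ t ∷ p ∷ shift μ)))
      ≡⟨ cong -_ (∑-swap-cancel y r d (Alt-∷ {F} (ℓ₂ ℕ.+ t) alt) (λ m l → v (ℓ₂ ℕ.+ t ∷ m) (ℕₚ.+-mono-≤-< ℓ₂+t≤ l))) ⟩
    + 0 ∎
    where
    ℓ₂+t≤ : ℓ₂ ℕ.+ t ≤ x ℕ.+ suc L
    ℓ₂+t≤ = subst (ℓ₂ ℕ.+ t ≤_) (sym bound) (ℕₚ.+-monoʳ-≤ ℓ₂ (ℕₚ.<⇒≤ t<))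

-- With p = c + length ν as first entry, the missing p < length ν have too small a degree and may be
-- added. Then all p < x + length ν cancel, and above that the degree allows only p = x + length ν
-- with μ = ν.
∑-swap-total : ∀ N x ν → Desc (x ∷ ν) → x < N → ∀ {F} → Alt F → (∀ m → sum m ≢ sum (shift (x ∷ ν)) → F m ≡ + 0) →
  ∑ (upTo N) (λ c → ∑ (interlace⁻ (x ∷ ν)) (λ μ → F (shift (c ∷ μ)))) ≡ F (shift (x ∷ ν))
∑-swap-total N x ν d x<N {F} alt v = begin
  ∑ (upTo N) (λ c → ∑ Is (λ μ → F (shift (c ∷ μ))))
    ≡⟨ ∑-cong (upTo N) (λ c → ∑-cong-All (All.map (λ {μ} (l , _) → cong (λ n → F (n ∷ shift μ))
         (trans (ℕₚ.+-comm c (length μ)) (cong (ℕ._+ c) l))) Is-All)) ⟩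
  ∑ (upTo N) (λ c → Φ (L ℕ.+ c))
    ≡⟨ sym (trans (∑-upTo-+ L N Φ) (trans (+ʳ (∑ (upTo N) (λ c → Φ (L ℕ.+ c))) (∑-upTo-0 L small)) (ℤₚ.+-identityˡ _))) ⟩
  ∑ (upTo (L ℕ.+ N)) Φ
    ≡⟨ cong (λ n → ∑ (upTo n) Φ) bound ⟩
  ∑ (upTo (x ℕ.+ L ℕ.+ suc (N ∸ suc x))) Φ
    ≡⟨ ∑-upTo-+ (x ℕ.+ L) (suc (N ∸ suc x)) Φ ⟩
  ∑ (upTo (x ℕ.+ L)) Φ + ∑ (upTo (suc (N ∸ suc x))) (λ s → Φ (x ℕ.+ L ℕ.+ s))
    ≡⟨ cong₂ _+_ (∑-swap-cancel x ν d alt (λ m l → v m (ℕₚ.<⇒≢ l)))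
         (∑-upTo-single (suc (N ∸ suc x)) 0 {λ s → Φ (x ℕ.+ L ℕ.+ s)} (s≤s z≤n) large) ⟩
  + 0 + Φ (x ℕ.+ L ℕ.+ 0)
    ≡⟨ trans (ℤₚ.+-identityˡ (Φ (x ℕ.+ L ℕ.+ 0))) (cong Φ (ℕₚ.+-identityʳ (x ℕ.+ L))) ⟩
  Φ (x ℕ.+ L)
    ≡⟨ interlace⁻-min x ν (λ μ → F (x ℕ.+ L ∷ shift μ)) d (λ μ l e → v (x ℕ.+ L ∷ shift μ) (ℕₚ.<⇒≢
         (ℕₚ.+-monoʳ-< (x ℕ.+ L) (subst₂ _<_ (sym (sum-shift ν)) (sym (shift-sum μ e)) (ℕₚ.+-monoˡ-< (triangle L) l))) ∘ sym)) ⟩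
  F (shift (x ∷ ν)) ∎
  where
  L = length ν
  Is = interlace⁻ (x ∷ ν)
  Is-All = interlace⁻-All x ν d
  Φ : ℕ → ℤ
  Φ p = ∑ Is (λ μ → F (p ∷ shift μ))
  shift-sum : ∀ μ → length μ ≡ L → sum (shift μ) ≡ sum μ ℕ.+ triangle L
  shift-sum μ e = trans (sum-shift μ) (cong (λ n → sum μ ℕ.+ triangle n) e)
  bound : L ℕ.+ N ≡ x ℕ.+ L ℕ.+ suc (N ∸ suc x)
  bound = sym (trans (arrange x L (N ∸ suc x)) (cong (L ℕ.+_) (ℕₚ.m+[n∸m]≡n x<N)))
    where
    arrange : ∀ x L n → x ℕ.+ L ℕ.+ suc n ≡ L ℕ.+ (suc x ℕ.+ n)
    arrange = ℕ-solve-∀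
  small : ∀ p → p < L → Φ p ≡ + 0
  small p p<L = ∑-0-All (All.map (λ {μ} (e , _ , _ , _ , hi) → v (p ∷ shift μ) (ℕₚ.<⇒≢
    (subst₂ _<_ (cong (p ℕ.+_) (sym (shift-sum μ e))) (trans (arrange x L (sum ν) (triangle L)) (cong (x ℕ.+ L ℕ.+_) (sym (sum-shift ν))))
      (ℕₚ.+-mono-<-≤ p<L (ℕₚ.+-monoˡ-≤ (triangle L) hi))))) Is-All)
    where
    arrange : ∀ x L s t → L ℕ.+ (x ℕ.+ s ℕ.+ t) ≡ x ℕ.+ L ℕ.+ (s ℕ.+ t)
    arrange = ℕ-solve-∀
  large : ∀ s → s ≢ 0 → Φ (x ℕ.+ L ℕ.+ s) ≡ + 0
  large zero    ne = ⊥-elim (ne refl)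
  large (suc s) _  = ∑-0-All (All.map (λ {μ} (e , _ , _ , lo , _) → v (x ℕ.+ L ℕ.+ suc s ∷ shift μ) (ℕₚ.<⇒≢
    (ℕₚ.+-mono-<-≤ (ℕₚ.m<m+n (x ℕ.+ L) (s≤s z≤n)) (subst₂ _≤_ (sym (sum-shift ν)) (sym (shift-sum μ e)) (ℕₚ.+-monoˡ-≤ (triangle L) lo))) ∘ sym)) Is-All)

-- The bialternant formula in dual form: with ρ = (k-1, ..., 0), antisymmetrising s_ν x^ρ gives
-- a_{ν+ρ}, and A is an alternating functional on monomials. The branching rule removes one variable
-- at a time.
schur-pairing : ∀ N k ν → length ν ≡ k → Desc ν → sum ν < N → ∀ {A} → Alt A →
                ∑ (cube N k) (λ β → D (shift ν) β * A (shift β)) ≡ A (shift ν)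
schur-pairing N zero [] e d l {A} alt = trans (ℤₚ.+-identityʳ (+ 1 * A [])) (ℤₚ.*-identityˡ (A []))
schur-pairing N (suc k) (x ∷ ν) e d l {A} alt = begin
  ∑ (cube N (suc k)) (λ β → D (shift (x ∷ ν)) β * A (shift β))
    ≡⟨ ∑-cube-suc N k (λ β → D (shift (x ∷ ν)) β * A (shift β)) ⟩
  ∑ (upTo N) (λ c → ∑ (cube N k) (λ β → D (shift (x ∷ ν)) (c ∷ β) * A (shift (c ∷ β))))
    ≡⟨ ∑-cong (upTo N) branch ⟩
  ∑ (upTo N) (λ c → ∑ (interlace (x ∷ ν)) (λ μ → ind (sum (x ∷ ν)) (c ℕ.+ sum μ) * Q c μ))
    ≡⟨ ∑-cong (upTo N) (λ c → ∑-interlace-restrict x ν d (λ μ → ind (sum (x ∷ ν)) (c ℕ.+ sum μ) * Q c μ) (λ μ dμ _ lμ →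
         trans (cong (ind (sum (x ∷ ν)) (c ℕ.+ sum μ) *_) (Q-Long c μ dμ lμ)) (ℤₚ.*-zeroʳ (ind (sum (x ∷ ν)) (c ℕ.+ sum μ))))) ⟩
  ∑ (upTo N) (λ c → ∑ (interlace⁻ (x ∷ ν)) (λ μ → ind (sum (x ∷ ν)) (c ℕ.+ sum (μ ∷ʳ 0)) * Q c (μ ∷ʳ 0)))
    -- The strip condition is absorbed into F, which is thereby both alternating and homogeneous.
    ≡⟨ ∑-cong (upTo N) (λ c → ∑-cong-All (All.map (λ {μ} (eμ , dμ , _ , _ , hi) → cong₂ _*_
         (trans (cong (λ s → ind (sum (x ∷ ν)) (c ℕ.+ s)) (trans (sum-++ μ (0 ∷ [])) (ℕₚ.+-identityʳ (sum μ))))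
                (sym (ind-shift 0 (c ∷ μ) (x ∷ ν) (cong suc eμ))))
         (Q-pad c μ (trans eμ e′) dμ (ℕₚ.≤-<-trans hi l))) (interlace⁻-All x ν d))) ⟩
  ∑ (upTo N) (λ c → ∑ (interlace⁻ (x ∷ ν)) (λ μ → F (shift (c ∷ μ))))
    ≡⟨ ∑-swap-total N x ν d (ℕₚ.≤-<-trans (ℕₚ.m≤m+n x (sum ν)) l) (Alt-graded A 0 s alt) (λ m ne → ind-no-* (A m) (λ q → ne (trans (sym (ℕₚ.+-identityʳ (sum m))) q))) ⟩
  F (shift (x ∷ ν))
    ≡⟨ ind-yes-* (A (shift (x ∷ ν))) (ℕₚ.+-identityʳ s) ⟩
  A (shift (x ∷ ν)) ∎
  where
  e′ : length ν ≡ k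
  e′ = ℕₚ.suc-injective e
  s = sum (shift (x ∷ ν))
  F : List ℕ → ℤ
  F m = ind (sum m ℕ.+ 0) s * A m
  Q : ℕ → List ℕ → ℤ
  Q c μ = ∑ (cube N k) (λ β → D (shift μ) β * A (shift (c ∷ β)))
  branch : ∀ c → ∑ (cube N k) (λ β → D (shift (x ∷ ν)) (c ∷ β) * A (shift (c ∷ β))) ≡
                 ∑ (interlace (x ∷ ν)) (λ μ → ind (sum (x ∷ ν)) (c ℕ.+ sum μ) * Q c μ)
  branch c = begin
    ∑ (cube N k) (λ β → D (shift (x ∷ ν)) (c ∷ β) * A (shift (c ∷ β)))
      ≡⟨ ∑-cong (cube N k) (λ β → trans (trans (cong (_* A (shift (c ∷ β))) (D-strips (x ∷ ν) d c β))
           (trans (ℤₚ.*-comm _ (A (shift (c ∷ β)))) (sym (∑-*ˡ (A (shift (c ∷ β))) (interlace (x ∷ ν)) (λ μ → ind (sum (x ∷ ν)) (c ℕ.+ sum μ) * D (shift μ) β)))))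
           (∑-cong (interlace (x ∷ ν)) (λ μ → arrange (A (shift (c ∷ β))) (ind (sum (x ∷ ν)) (c ℕ.+ sum μ)) (D (shift μ) β)))) ⟩
    ∑ (cube N k) (λ β → ∑ (interlace (x ∷ ν)) (λ μ → ind (sum (x ∷ ν)) (c ℕ.+ sum μ) * (D (shift μ) β * A (shift (c ∷ β)))))
      ≡⟨ ∑-swap (cube N k) (interlace (x ∷ ν)) (λ β μ → ind (sum (x ∷ ν)) (c ℕ.+ sum μ) * (D (shift μ) β * A (shift (c ∷ β)))) ⟩
    ∑ (interlace (x ∷ ν)) (λ μ → ∑ (cube N k) (λ β → ind (sum (x ∷ ν)) (c ℕ.+ sum μ) * (D (shift μ) β * A (shift (c ∷ β)))))
      ≡⟨ ∑-cong (interlace (x ∷ ν)) (λ μ → ∑-*ˡ (ind (sum (x ∷ ν)) (c ℕ.+ sum μ)) (cube N k) (λ β → D (shift μ) β * A (shift (c ∷ β)))) ⟩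
    ∑ (interlace (x ∷ ν)) (λ μ → ind (sum (x ∷ ν)) (c ℕ.+ sum μ) * Q c μ) ∎
    where
    arrange : ∀ a b c → a * (b * c) ≡ b * (c * a)
    arrange = solve-∀
  Q-Long : ∀ c μ → Desc μ → Long (suc (length ν)) μ → Q c μ ≡ + 0
  Q-Long c μ dμ lμ = ∑-0-All (All.map (λ {β} eβ → cong (_* A (shift (c ∷ β)))
    (D-Long β μ dμ (subst (λ n → Long (suc n) μ) (trans e′ (sym eβ)) lμ))) (cube-length N k))
  Q-pad : ∀ c μ → length μ ≡ k → Desc μ → sum μ < N → Q c (μ ∷ʳ 0) ≡ A (shift (c ∷ μ))
  Q-pad c μ eμ dμ lμ = begin
    ∑ (cube N k) (λ β → D (shift (μ ∷ʳ 0)) β * A (c ℕ.+ length β ∷ shift β))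
      ≡⟨ ∑-cong-All (All.map (λ {β} eβ → cong₂ (λ u n → u * A (c ℕ.+ n ∷ shift β)) (D-pad μ β) (trans eβ (sym eμ))) (cube-length N k)) ⟩
    ∑ (cube N k) (λ β → D (shift μ) β * A (c ℕ.+ length μ ∷ shift β))
      ≡⟨ schur-pairing N k μ eμ dμ lμ {λ m → A (c ℕ.+ length μ ∷ m)} (Alt-∷ {A} (c ℕ.+ length μ) alt) ⟩
    A (shift (c ∷ μ)) ∎

-- Rectangles, zero padding and the evaluation of CS

map-shift : ∀ a ν → map (a ℕ.+_) (shift ν) ≡ shift (map (a ℕ.+_) ν)
map-shift a []      = refl
map-shift a (x ∷ ν) = cong₂ _∷_
  (trans (sym (ℕₚ.+-assoc a x (length ν))) (cong (a ℕ.+ x ℕ.+_) (sym (Lₚ.length-map (a ℕ.+_) ν)))) (map-shift a ν)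

map-Desc : ∀ a ν → Desc ν → Desc (map (a ℕ.+_) ν)
map-Desc a []          d       = []
map-Desc a (x ∷ [])    d       = [-]
map-Desc a (x ∷ y ∷ ν) (h ∷ d) = ℕₚ.+-monoʳ-≤ a h ∷ map-Desc a (y ∷ ν) d

D-map-Alt : ∀ a γ → Alt (λ m → D (map (a ℕ.+_) m) γ)
D-map-Alt a γ pre x y post = trans (cong (λ m → D m γ) (Lₚ.map-++ (a ℕ.+_) pre (x ∷ y ∷ post)))
  (trans (D-Alt γ (map (a ℕ.+_) pre) (a ℕ.+ x) (a ℕ.+ y) (map (a ℕ.+_) post))
         (cong (λ m → - D m γ) (sym (Lₚ.map-++ (a ℕ.+_) pre (y ∷ x ∷ post)))))

padded : ℕ → List ℕ → List ℕ
padded k ν = ν ++ replicate (k ∸ length ν) 0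

D-padded : ∀ n ν → D (shift (ν ++ replicate n 0)) ≈ D (shift ν)
D-padded zero    ν γ = cong (λ κ → D (shift κ) γ) (Lₚ.++-identityʳ ν)
D-padded (suc n) ν γ = trans (cong (λ κ → D (shift κ) γ) (sym (Lₚ.++-assoc ν (0 ∷ []) (replicate n 0))))
  (trans (D-padded n (ν ∷ʳ 0) γ) (D-pad ν γ))

padded-Desc : ∀ n ν → Desc ν → Desc (ν ++ replicate n 0)
padded-Desc n []          d       = conjugate-Desc n []
padded-Desc n (x ∷ [])    d       = Desc-∷ (zeros n) (conjugate-Desc n [])
  where
  zeros : ∀ n → headℕ (replicate n 0) ≤ x
  zeros zero    = z≤n
  zeros (suc n) = z≤n
padded-Desc n (x ∷ y ∷ ν) (h ∷ d) = h ∷ padded-Desc n (y ∷ ν) d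

sum-padded : ∀ n ν → sum (ν ++ replicate n 0) ≡ sum ν
sum-padded n ν = trans (sum-++ ν (replicate n 0))
  (trans (cong (sum ν ℕ.+_) (sum-conjugate n [] [] z≤n)) (ℕₚ.+-identityʳ (sum ν)))

length-padded : ∀ k ν → length ν ≤ k → length (padded k ν) ≡ k
length-padded k ν l = trans (Lₚ.length-++ ν)
  (trans (cong (length ν ℕ.+_) (Lₚ.length-replicate (k ∸ length ν))) (ℕₚ.m+[n∸m]≡n l))

mainTheorem17 : (ip : ℕ → Series → Series → ℤ) → IsHallPairing ip →
    (perp : Series → Series → Series) → IsSkewing ip perp →
    (a k : ℕ) (λ₀ : List ℕ) → IsPartition λ₀ →
    (length λ₀ ≤ k → CS perp a k (schurS λ₀) ≈ schurS (addRect a k λ₀))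
    × (k < length λ₀ → CS perp a k (schurS λ₀) ≈ zeroS)
mainTheorem17 ip hall perp skew a k ν (d , pos) = short , long
  where
  open Hall ip hall
  open Skewing ip hall perp skew
  open Expansion ip hall perp skew
  -- Coefficients of s_ν vanish in degree N and above, so the cube of side N contains every β that
  -- contributes.
  N = suc (sum ν)
  expand : ∀ γ → CS perp a k (schurS ν) γ ≡ ∑ (cube N k) (λ β → D (shift ν) β * rect a β γ)
  expand γ = trans
    (CS-expansion N a k (Sym-resp (λ δ → sym (schur≈D ν d δ)) (D-Sym ν d))
      (λ δ l → trans (schur≈D ν d δ) (D-homogeneous δ ν d (λ e → ℕₚ.<⇒≢ l (sym e)))) γ)
    (∑-cong (cube N k) (λ β → cong (_* rect a β γ) (schur≈D ν d β)))
  long : k < length ν → CS perp a k (schurS ν) ≈ zeroS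
  long l γ = trans (expand γ) (∑-0-All (All.map (λ {β} e → cong (_* rect a β γ)
    (D-Long β ν d (positive⇒Long (suc (length β)) ν pos (subst (_< length ν) (sym e) l)))) (cube-length N k)))
  short : length ν ≤ k → CS perp a k (schurS ν) ≈ schurS (addRect a k ν)
  short l γ = begin
    CS perp a k (schurS ν) γ
      ≡⟨ expand γ ⟩
    ∑ (cube N k) (λ β → D (shift ν) β * rect a β γ)
      -- Padding ν to k parts does not change s_ν, and adding a to all entries commutes with
      -- `shift`, so the second factor is alternating in `shift β`.
      ≡⟨ ∑-cong (cube N k) (λ β → cong₂ _*_ (sym (D-padded (k ∸ length ν) ν β)) (cong (λ m → D m γ) (sym (map-shift a β)))) ⟩
    ∑ (cube N k) (λ β → D (shift (padded k ν)) β * D (map (a ℕ.+_) (shift β)) γ)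
      ≡⟨ schur-pairing N k (padded k ν) (length-padded k ν l) (padded-Desc (k ∸ length ν) ν d)
           (s≤s (ℕₚ.≤-reflexive (sum-padded (k ∸ length ν) ν))) {λ m → D (map (a ℕ.+_) m) γ} (D-map-Alt a γ) ⟩
    D (map (a ℕ.+_) (shift (padded k ν))) γ
      ≡⟨ cong (λ m → D m γ) (map-shift a (padded k ν)) ⟩
    D (shift (addRect a k ν)) γ
      ≡⟨ sym (schur≈D (addRect a k ν) (map-Desc a (padded k ν) (padded-Desc (k ∸ length ν) ν d)) γ) ⟩
    schurS (addRect a k ν) γ ∎
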